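{- The problem $\{1,2\}$-CSP$(\mathbf{P}_\infty)$ is decidable in polynomial time.
   Context: $\mathbf{P}_\infty$ is the infinite path: vertex set $\mathbb{Z}$, edges $\{i,k\}$ with $|i-k|=1$. $\{1,2\}$-CSP$(\mathbf{P}_\infty)$ takes as input a sentence $Q_1 x_1 \ldots Q_m x_m\, \psi$, where $\psi$ is a conjunction of atoms $E(x_i,x_k)$ and each $Q_i$ is $\exists^{\geq 1}$ (i.e. $\exists$) or $\exists^{\geq 2}$ (there exist at least two distinct elements), and asks whether it is true in $\mathbf{P}_\infty$. -}

module Defs where

open import Data.Nat using (ℕ; zero; suc; _+_; _*_; _^_; _<_; _≡ᵇ_)
open import Data.Integer as ℤ using (ℤ; ∣_∣)
open import Data.Bool using (Bool; true; false; if_then_else_)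
open import Data.List using (List; []; _∷_; _++_; length; replicate; concatMap)
open import Data.List.Relation.Unary.All using (All)
open import Data.Product using (_×_; _,_; ∃; ∃-syntax)
open import Data.Fin using (Fin)
open import Relation.Binary.PropositionalEquality using (_≡_; _≢_)

Adj : ℤ → ℤ → Set
Adj a b = ∣ a ℤ.- b ∣ ≡ 1

data Quant : Set where
  ex1 ex2 : Quant

-- A sentence Q₁x₀ … Q_m x_{m-1} ψ ; variable x_i is the i-th quantified one
-- (0-based); ψ is a list (conjunction) of atoms E(x_i, x_k), given as (i , k).
-- Well-formedness: every atom only mentions quantified variables.
record Sentence : Set where
  field
    quants : List Quant
    atoms  : List (ℕ × ℕ)
    wf     : All (λ (p : ℕ × ℕ) → let (i , k) = p in
                    (i < length quants) × (k < length quants)) atoms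
open Sentence public

Env : Set
Env = ℕ → ℤ

_[_↦_] : Env → ℕ → ℤ → Env
(ρ [ i ↦ z ]) j = if j ≡ᵇ i then z else ρ j

SatAtoms : Env → List (ℕ × ℕ) → Set
SatAtoms ρ as = All (λ (p : ℕ × ℕ) → let (i , k) = p in Adj (ρ i) (ρ k)) as

Sat : List Quant → ℕ → Env → List (ℕ × ℕ) → Set
Sat []         j ρ as = SatAtoms ρ as
Sat (ex1 ∷ qs) j ρ as = ∃[ z ] Sat qs (suc j) (ρ [ j ↦ z ]) as
Sat (ex2 ∷ qs) j ρ as = ∃[ z ] ∃[ z' ] (z ≢ z')
                          × Sat qs (suc j) (ρ [ j ↦ z ]) as
                          × Sat qs (suc j) (ρ [ j ↦ z' ]) as

-- the sentence is true in P∞ (the initial assignment is irrelevant, since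
-- every variable is quantified before being used)
TrueInP∞ : Sentence → Set
TrueInP∞ φ = Sat (quants φ) 0 (λ _ → ℤ.0ℤ) (atoms φ)

data Sym : Set where
  sQ1 sQ2 sE sOne sSep : Sym

encQ : Quant → Sym
encQ ex1 = sQ1
encQ ex2 = sQ2

-- atom E(x_i,x_k) ↦  E 1^i # 1^k   (unary indices; polynomially
-- equivalent to binary since indices are < number of quantifiers)
encAtom : ℕ × ℕ → List Sym
encAtom (i , k) = sE ∷ replicate i sOne ++ sSep ∷ replicate k sOne

encode : Sentence → List Sym
encode φ = Data.List.map encQ (quants φ) ++ concatMap encAtom (atoms φ)

data Cell (g : ℕ) : Set where
  blank : Cell g
  inp   : Sym → Cell g
  wrk   : Fin g → Cell g

data Move : Set where
  L R S : Move

data Action (n g : ℕ) : Set where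
  halt : Bool → Action n g
  step : Fin n → Cell g → Move → Action n g

record TM : Set where
  field
    nStates : ℕ
    nWork   : ℕ
    δ       : Fin (suc nStates) → Cell nWork → Action (suc nStates) nWork
open TM public

-- tape: cells left of the head (nearest first), head cell, cells to the right
record Tape (g : ℕ) : Set where
  constructor tape
  field
    left  : List (Cell g)
    here  : Cell g
    right : List (Cell g)

data Config (M : TM) : Set where
  running : Fin (suc (nStates M)) → Tape (nWork M) → Config M
  halted  : Bool → Config M

moveTape : ∀ {g} → Move → Tape g → Tape g
moveTape L (tape []       c r) = tape [] blank (c ∷ r)
moveTape L (tape (x ∷ l)  c r) = tape l x (c ∷ r)
moveTape R (tape l c [])       = tape (c ∷ l) blank []
moveTape R (tape l c (x ∷ r))  = tape (c ∷ l) x r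
moveTape S t                   = t

stepM : (M : TM) → Config M → Config M
stepM M (halted b) = halted b
stepM M (running q (tape l c r)) with δ M q c
... | halt b        = halted b
... | step q' c' mv = running q' (moveTape mv (tape l c' r))

run : (M : TM) → ℕ → Config M → Config M
run M zero    cfg = cfg
run M (suc t) cfg = run M t (stepM M cfg)

initTape : ∀ {g} → List Sym → Tape g
initTape []       = tape [] blank []
initTape (s ∷ w)  = tape [] (inp s) (Data.List.map inp w)

initConfig : (M : TM) → List Sym → Config M
initConfig M w = running Fin.zero (initTape w)
  where import Data.Fin as Fin

{-# OPTIONS --safe #-}
-- Eliminate the quantified variables from the last to the first. Walks of length w
-- from x to y in the graph of atoms force the values of x and y to differ by at most
-- w, with the parity of w. A variable z that is subject to constraints of radius a
-- around x and b around y has a value iff the values of x and y are within a + b of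
-- each other, and two values iff they are within a + b − 2 and no radius is 0: the
-- intervals around the earlier values then meet in one of length at least 2. So the
-- sentence holds iff there is no odd closed walk and a variable quantified by ∃^{≥2}
-- is never tied to an earlier one by a constraint of radius 0. Constraints of radius
-- beyond twice the number of variables can be dropped, as a walk may be shortened by
-- cutting it between two visits to the same vertex of equal parity.
--
-- The table of constraints (stage, radius, x, y) has polynomially many bits, each
-- given by a bounded first-order formula in the earlier bits and the input. Such
-- formulas are evaluated by nested loops over registers; on the tape a register is a
-- pebble, and the table is one bit per cell.
module Submission where

open import Defs
import Algebra.Properties.AbelianGroup
import Algebra.Properties.CommutativeSemigroup
open import Data.Bool using (Bool; true; false; if_then_else_; not; T; _xor_)
open import Data.Bool.Properties using (not-involutive; not-injective; xor-identityʳ)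
import Data.Fin
open import Data.Fin using (Fin; zero; suc; toℕ; fromℕ<; funToFin; finToFun; splitAt; _↑ˡ_; _↑ʳ_; #_)
import Data.Fin.Properties as Fin
import Data.Integer as ℤ
open import Data.Integer using (ℤ; 0ℤ; 1ℤ)
import Data.Integer.Properties as ℤ
import Data.Integer.Solver as ℤ
open import Data.List using (List; []; _∷_; _++_; length; replicate; concatMap; map; drop; cartesianProduct; upTo)
open import Data.List.Membership.Propositional using (_∈_)
open import Data.List.Membership.Propositional.Properties using (∈-cartesianProduct⁺; ∈-upTo⁺)
open import Data.List.Properties using (++-assoc; drop-all)
import Data.List.Relation.Unary.All as All
open import Data.List.Relation.Unary.All using (All; []; _∷_)
import Data.List.Relation.Unary.All.Properties as All
import Data.List.Relation.Unary.Any as Any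
open import Data.List.Relation.Unary.Any using (here; there)
import Data.Nat as ℕ
open import Data.Nat
  using (ℕ; zero; suc; _+_; _*_; _^_; _∸_; _≤_; _<_; z≤n; s≤s; s≤s⁻¹; _≡ᵇ_; _<ᵇ_; _<?_)
open import Data.Nat.Induction using (<-wellFounded)
open import Data.Nat.Properties
import Data.Nat.Solver as ℕ
import Data.Product
open import Data.Product using (Σ; _×_; _,_; ∃-syntax; proj₁; proj₂)
import Data.Product.Properties as Product
import Data.Sum
open import Data.Sum using (_⊎_; inj₁; inj₂; [_,_]′)
open import Data.Unit using (⊤; tt)
open import Function.Base using (_∘_; id; case_of_)
open import Function.Bundles using (_⇔_; mk⇔; Equivalence)
open import Induction.WellFounded using (Acc; acc)
open import Relation.Binary.Definitions using (tri<; tri≈; tri>)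
open import Relation.Binary.PropositionalEquality
  using (_≡_; _≢_; refl; sym; trans; cong; cong₂; subst; subst₂; _≗_; module ≡-Reasoning)
open import Relation.Nullary using (Dec; yes; no; ¬_; does; contradiction)
open import Relation.Nullary.Decidable using (dec-true; dec-false; _×-dec_; _⊎-dec_; map′)
open import Relation.Nullary.Reflects using (Reflects; ofʸ; ofⁿ)

open Algebra.Properties.AbelianGroup ℤ.+-0-abelianGroup using () renaming (∙-cancelˡ to ℤ-+-cancelˡ)
open Algebra.Properties.CommutativeSemigroup +-commutativeSemigroup using () renaming (interchange to +-interchange)

-- The two branches of ∃^{≥2} continue with different values, so a condition on the sentence must
-- not mention values. Each elimination turns "the last variable has a value, or two" into pairwise
-- conditions on the earlier variables, the same in every branch. Pairwise conditions suffice
-- because intervals of a line have the Helly property: the largest left end lies in all intervals,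
-- and for ∃^{≥2} so does the point two further on, the next one of equal parity. Parity needs no
-- entry of its own: every derived constraint has the parity of a walk, so excluding odd closed
-- walks settles it for good. The machine never counts the variables. The input length N takes the
-- place of their number, which only adds eliminations that change nothing. Stage and radius are the
-- leading digits of an address, so both recursions, over the length of walks and over eliminations,
-- read smaller addresses only.

≡ᵇ-refl : ∀ n → (n ≡ᵇ n) ≡ true
≡ᵇ-refl zero = refl
≡ᵇ-refl (suc n) = ≡ᵇ-refl n

≢⇒≡ᵇ-false : ∀ m n → m ≢ n → (m ≡ᵇ n) ≡ false
≢⇒≡ᵇ-false zero zero p = contradiction refl p
≢⇒≡ᵇ-false zero (suc n) p = refl
≢⇒≡ᵇ-false (suc m) zero p = refl
≢⇒≡ᵇ-false (suc m) (suc n) p = ≢⇒≡ᵇ-false m n (p ∘ cong suc)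

opaque
  -- Opaque: the reasoning about runs uses only the two equations below. It is unfolded once, to
  -- compute the meaning of the concrete formulas.
  _[_≔_] : (ℕ → ℕ) → ℕ → ℕ → ℕ → ℕ
  (ρ [ r ≔ v ]) i = if i ≡ᵇ r then v else ρ i

  ≔-same : ∀ ρ r v → (ρ [ r ≔ v ]) r ≡ v
  ≔-same ρ r v rewrite ≡ᵇ-refl r = refl

  ≔-other : ∀ ρ r v i → i ≢ r → (ρ [ r ≔ v ]) i ≡ ρ i
  ≔-other ρ r v i p rewrite ≢⇒≡ᵇ-false i r p = refl

-- Tapes, and structured programs whose registers are pebbles

inputCell : ∀ {g} → List Sym → ℕ → Cell g
inputCell [] p = blank
inputCell (s ∷ w) zero = inp s
inputCell (s ∷ w) (suc p) = inputCell w p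

nth : ∀ {g} → List (Cell g) → ℕ → Cell g
nth [] i = blank
nth (c ∷ r) zero = c
nth (c ∷ r) (suc i) = nth r i

nth-map-inp : ∀ {g} w p → nth {g} (map inp w) p ≡ inputCell w p
nth-map-inp [] p = refl
nth-map-inp (s ∷ w) zero = refl
nth-map-inp (s ∷ w) (suc p) = nth-map-inp w p

_==ˢ_ : Sym → Sym → Bool
sQ1  ==ˢ sQ1  = true
sQ2  ==ˢ sQ2  = true
sE   ==ˢ sE   = true
sOne ==ˢ sOne = true
sSep ==ˢ sSep = true
_    ==ˢ _    = false

run-+ : ∀ M s t cfg → run M (s + t) cfg ≡ run M t (run M s cfg)
run-+ M zero t cfg = refl
run-+ M (suc s) t cfg = run-+ M s t (stepM M cfg)

run-halted : ∀ M t b → run M t (halted b) ≡ halted b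
run-halted M zero b = refl
run-halted M (suc t) b = run-halted M t b

-- A register holds a tape position, namely that of its own pebble; the only
-- other memory is one bit per cell.
module Machine (K : ℕ) where

  -- `home` flags the first cell, so that the head finds its way back; `filled` flags the cells of
  -- the input, so that its length can be measured.
  data Track : Set where
    home bit filled : Track
    symbol : Sym → Track
    pebble : Fin K → Track

  Content : Set
  Content = Track → Bool

  fromTrack : Track → Fin (8 + K)
  fromTrack home = zero
  fromTrack bit = suc zero
  fromTrack filled = suc (suc zero)
  fromTrack (symbol sQ1) = suc (suc (suc zero))
  fromTrack (symbol sQ2) = suc (suc (suc (suc zero)))
  fromTrack (symbol sE) = suc (suc (suc (suc (suc zero))))
  fromTrack (symbol sOne) = suc (suc (suc (suc (suc (suc zero)))))
  fromTrack (symbol sSep) = suc (suc (suc (suc (suc (suc (suc zero))))))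
  fromTrack (pebble r) = 8 ↑ʳ r

  toTrack : Fin (8 + K) → Track
  toTrack zero = home
  toTrack (suc zero) = bit
  toTrack (suc (suc zero)) = filled
  toTrack (suc (suc (suc zero))) = symbol sQ1
  toTrack (suc (suc (suc (suc zero)))) = symbol sQ2
  toTrack (suc (suc (suc (suc (suc zero))))) = symbol sE
  toTrack (suc (suc (suc (suc (suc (suc zero)))))) = symbol sOne
  toTrack (suc (suc (suc (suc (suc (suc (suc zero))))))) = symbol sSep
  toTrack (suc (suc (suc (suc (suc (suc (suc (suc r)))))))) = pebble r

  toTrack-fromTrack : ∀ τ → toTrack (fromTrack τ) ≡ τ
  toTrack-fromTrack home = refl
  toTrack-fromTrack bit = refl
  toTrack-fromTrack filled = refl
  toTrack-fromTrack (symbol sQ1) = refl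
  toTrack-fromTrack (symbol sQ2) = refl
  toTrack-fromTrack (symbol sE) = refl
  toTrack-fromTrack (symbol sOne) = refl
  toTrack-fromTrack (symbol sSep) = refl
  toTrack-fromTrack (pebble r) = refl

  fromBool : Bool → Fin 2
  fromBool false = zero
  fromBool true = suc zero

  toBool : Fin 2 → Bool
  toBool zero = false
  toBool (suc _) = true

  toBool-fromBool : ∀ b → toBool (fromBool b) ≡ b
  toBool-fromBool false = refl
  toBool-fromBool true = refl

  opaque
    size : ℕ
    size = 2 ^ (8 + K)

    pack : Content → Fin size
    pack x = funToFin (λ i → fromBool (x (toTrack i)))

    unpack : Fin size → Content
    unpack i τ = toBool (finToFun i (fromTrack τ))

    unpack-pack : ∀ x → unpack (pack x) ≗ x
    unpack-pack x τ
      rewrite Fin.finToFun-funToFin (λ i → fromBool (x (toTrack i))) (fromTrack τ)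
            | toTrack-fromTrack τ = toBool-fromBool (x τ)

  content : Cell size → Content
  content blank τ = false
  content (inp s) filled = true
  content (inp s) (symbol s′) = s ==ˢ s′
  content (inp s) τ = false
  content (wrk i) τ = unpack i τ

  setBit : Content → Content
  setBit x bit = true
  setBit x τ = x τ

  setPebble : Fin K → Bool → Content → Content
  setPebble r b x (pebble r′) = if does (r Fin.≟ r′) then b else x (pebble r′)
  setPebble r b x τ = x τ

  -- `test` reads a track in the cell of the given pebble; with the track of a second pebble it
  -- compares two registers.
  data Op : Set where
    clear incr mark : Op
    test : Track → Op

  data Code : Set where
    exit  : Bool → Code
    prim  : Op → Fin K → Code
    ite   : Code → Code → Code → Code
    until : Code → Code → Code

  -- A primitive starts and ends on the first cell. It runs right to its pebble, acts, and carries
  -- its result back; only `incr` passes through `place`.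
  data Phase : Set where
    seek place : Phase
    return : Bool → Phase

  St : Code → Set
  St (exit b) = ⊤
  St (prim o r) = Phase
  St (ite c d e) = St c ⊎ (St d ⊎ St e)
  St (until c d) = St c ⊎ St d

  start : ∀ c → St c
  start (exit b) = tt
  start (prim o r) = seek
  start (ite c d e) = inj₁ (start c)
  start (until c d) = inj₁ (start c)

  record Out (A : Set) : Set where
    constructor out
    field
      next : A
      new : Content
      move : Move

  mapOut : ∀ {A B} → (A → B) → Out A → Out B
  mapOut f (out a x m) = out (f a) x m

  found : Op → Fin K → Content → Out (Phase ⊎ Bool)
  found clear r x = out (inj₁ (return true)) (setPebble r false x) S
  found incr r x = out (inj₁ place) (setPebble r false x) R
  found mark r x = out (inj₁ (return true)) (setBit x) S
  found (test τ) r x = out (inj₁ (return (x τ))) x S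

  -- Only `clear` has work left on the first cell: the pebble it picked up is put down there.
  finish : Op → Fin K → Content → Content
  finish clear r x = setPebble r true x
  finish incr r x = x
  finish mark r x = x
  finish (test τ) r x = x

  δ-prim : Op → Fin K → Phase → Content → Out (Phase ⊎ Bool)
  δ-prim o r seek x = if x (pebble r) then found o r x else out (inj₁ seek) x R
  δ-prim o r place x = out (inj₁ (return true)) (setPebble r true x) S
  δ-prim o r (return b) x =
    if x home then out (inj₂ b) (finish o r x) S else out (inj₁ (return b)) x L

  ite-fst : ∀ c d e → St c ⊎ Bool → St (ite c d e) ⊎ Bool
  ite-fst c d e (inj₁ s) = inj₁ (inj₁ s)
  ite-fst c d e (inj₂ true) = inj₁ (inj₂ (inj₁ (start d)))
  ite-fst c d e (inj₂ false) = inj₁ (inj₂ (inj₂ (start e)))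

  ite-then : ∀ c d e → St d ⊎ Bool → St (ite c d e) ⊎ Bool
  ite-then c d e (inj₁ s) = inj₁ (inj₂ (inj₁ s))
  ite-then c d e (inj₂ b) = inj₂ b

  ite-else : ∀ c d e → St e ⊎ Bool → St (ite c d e) ⊎ Bool
  ite-else c d e (inj₁ s) = inj₁ (inj₂ (inj₂ s))
  ite-else c d e (inj₂ b) = inj₂ b

  until-test : ∀ c d → St c ⊎ Bool → St (until c d) ⊎ Bool
  until-test c d (inj₁ s) = inj₁ (inj₁ s)
  until-test c d (inj₂ true) = inj₂ true
  until-test c d (inj₂ false) = inj₁ (inj₂ (start d))

  until-body : ∀ c d → St d ⊎ Bool → St (until c d) ⊎ Bool
  until-body c d (inj₁ s) = inj₁ (inj₂ s)
  until-body c d (inj₂ b) = inj₁ (inj₁ (start c))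

  δᶜ : ∀ c → St c → Content → Out (St c ⊎ Bool)
  δᶜ (exit b) s x = out (inj₂ b) x S
  δᶜ (prim o r) s x = δ-prim o r s x
  δᶜ (ite c d e) (inj₁ s) x = mapOut (ite-fst c d e) (δᶜ c s x)
  δᶜ (ite c d e) (inj₂ (inj₁ s)) x = mapOut (ite-then c d e) (δᶜ d s x)
  δᶜ (ite c d e) (inj₂ (inj₂ s)) x = mapOut (ite-else c d e) (δᶜ e s x)
  δᶜ (until c d) (inj₁ s) x = mapOut (until-test c d) (δᶜ c s x)
  δᶜ (until c d) (inj₂ s) x = mapOut (until-body c d) (δᶜ d s x)

  after : Content → Move → Tape size → Tape size
  after x m (tape l c r) = moveTape m (tape l (wrk (pack x)) r)

  scanned : Tape size → Content
  scanned t = content (Tape.here t)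

  data Run (c : Code) (s : St c) (t : Tape size) : ℕ → Bool → Tape size → Set where
    stop : ∀ {b x m} → δᶜ c s (scanned t) ≡ out (inj₂ b) x m → Run c s t 1 b (after x m t)
    more : ∀ {s′ x m n b t′} → δᶜ c s (scanned t) ≡ out (inj₁ s′) x m →
           Run c s′ (after x m t) n b t′ → Run c s t (suc n) b t′

  Run-then : ∀ {c d e s t m b t′ n t″} → Run c s t m true t′ → Run d (start d) t′ n b t″ →
             Run (ite c d e) (inj₁ s) t (m + n) b t″
  Run-then {c} {d} {e} (stop p) q = more (cong (mapOut (ite-fst c d e)) p) (second q)
    where
    second : ∀ {s t n b t′} → Run d s t n b t′ → Run (ite c d e) (inj₂ (inj₁ s)) t n b t′
    second (stop p) = stop (cong (mapOut (ite-then c d e)) p)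
    second (more p q) = more (cong (mapOut (ite-then c d e)) p) (second q)
  Run-then {c} {d} {e} (more p r) q = more (cong (mapOut (ite-fst c d e)) p) (Run-then r q)

  Run-else : ∀ {c d e s t m b t′ n t″} → Run c s t m false t′ → Run e (start e) t′ n b t″ →
             Run (ite c d e) (inj₁ s) t (m + n) b t″
  Run-else {c} {d} {e} (stop p) q = more (cong (mapOut (ite-fst c d e)) p) (second q)
    where
    second : ∀ {s t n b t′} → Run e s t n b t′ → Run (ite c d e) (inj₂ (inj₂ s)) t n b t′
    second (stop p) = stop (cong (mapOut (ite-else c d e)) p)
    second (more p q) = more (cong (mapOut (ite-else c d e)) p) (second q)
  Run-else {c} {d} {e} (more p r) q = more (cong (mapOut (ite-fst c d e)) p) (Run-else r q)

  Run-until-done : ∀ {c d s t m t′} → Run c s t m true t′ → Run (until c d) (inj₁ s) t m true t′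
  Run-until-done {c} {d} (stop p) = stop (cong (mapOut (until-test c d)) p)
  Run-until-done {c} {d} (more p r) =
    more (cong (mapOut (until-test c d)) p) (Run-until-done r)

  Run-until-body : ∀ {c d s t m b′ t′ n b t″} → Run d s t m b′ t′ →
                   Run (until c d) (inj₁ (start c)) t′ n b t″ →
                   Run (until c d) (inj₂ s) t (m + n) b t″
  Run-until-body {c} {d} (stop p) q = more (cong (mapOut (until-body c d)) p) q
  Run-until-body {c} {d} (more p r) q =
    more (cong (mapOut (until-body c d)) p) (Run-until-body r q)

  Run-until-test : ∀ {c d s t m t′ n b t″} → Run c s t m false t′ →
                   Run (until c d) (inj₂ (start d)) t′ n b t″ →
                   Run (until c d) (inj₁ s) t (m + n) b t″
  Run-until-test {c} {d} (stop p) q = more (cong (mapOut (until-test c d)) p) q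
  Run-until-test {c} {d} (more p r) q =
    more (cong (mapOut (until-test c d)) p) (Run-until-test r q)

  World : Set
  World = ℕ → Content

  data Left (W : World) : ℕ → List (Cell size) → Set where
    []  : Left W zero []
    _∷_ : ∀ {h c l} → content c ≗ W h → Left W h l → Left W (suc h) (c ∷ l)

  -- The head is `h` cells from the first one, so exactly `h` cells lie to its left. The right side
  -- is compared through `nth`, which reads blanks past the end of the list, so its length is
  -- immaterial.
  record Rep (W : World) (h : ℕ) (t : Tape size) : Set where
    constructor rep
    field
      onLeft  : Left W h (Tape.left t)
      atHead  : scanned t ≗ W h
      onRight : ∀ i → content (nth (Tape.right t) i) ≗ W (i + suc h)
  open Rep

  Left-resp : ∀ {W W′ h l} → (∀ p → p < h → W p ≗ W′ p) → Left W h l → Left W′ h l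
  Left-resp e [] = []
  Left-resp e (p ∷ ps) =
    (λ τ → trans (p τ) (e _ ≤-refl τ)) ∷ Left-resp (λ q lt → e q (m<n⇒m<1+n lt)) ps

  Rep-resp : ∀ {W W′ h t} → (∀ p → W p ≗ W′ p) → Rep W h t → Rep W′ h t
  Rep-resp e (rep l a r) = rep (Left-resp (λ p _ → e p) l) (λ τ → trans (a τ) (e _ τ))
                               (λ i τ → trans (r i τ) (e _ τ))

  Rep-write : ∀ {W W′ h t} x → (∀ p → p ≢ h → W p ≗ W′ p) → x ≗ W′ h →
              Rep W h t → Rep W′ h (after x S t)
  Rep-write {h = h} x e q (rep l a r) =
    rep (Left-resp (λ p lt → e p (<⇒≢ lt)) l) (λ τ → trans (unpack-pack x τ) (q τ))
        (λ i τ → trans (r i τ) (e _ (λ eq → <⇒≢ (m≤n+m (suc h) i) (sym eq)) τ))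

  Rep-right : ∀ {W h t} → Rep W h t → Rep W (suc h) (moveTape R t)
  Rep-right {W} {h} {tape l c []} (rep pl a r) =
    rep (a ∷ pl) (r 0) (λ i τ → trans (r (suc i) τ) (cong (λ n → W n τ) (sym (+-suc i (suc h)))))
  Rep-right {W} {h} {tape l c (x ∷ xs)} (rep pl a r) =
    rep (a ∷ pl) (r 0) (λ i τ → trans (r (suc i) τ) (cong (λ n → W n τ) (sym (+-suc i (suc h)))))

  Rep-left : ∀ {W h t} → Rep W (suc h) t → Rep W h (moveTape L t)
  Rep-left {W} {h} {tape (x ∷ l) c r} (rep (p ∷ ps) a q) =
    rep ps p λ { zero → a ; (suc i) τ → trans (q i τ) (cong (λ n → W n τ) (+-suc i (suc h))) }

  afterR : ∀ x t → after x R t ≡ moveTape R (after x S t)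
  afterR x (tape l c r) = refl

  afterL : ∀ x t → after x L t ≡ moveTape L (after x S t)
  afterL x (tape l c r) = refl

  Rep-keep : ∀ {W h t} → Rep W h t → Rep W h (after (scanned t) S t)
  Rep-keep Rt = Rep-write _ (λ _ _ _ → refl) (atHead Rt) Rt

  -- In continuation form, because a `Run` always ends in an exit and the way to the pebble is only
  -- the beginning of one.
  seek-run : ∀ o r d {W h t} → Rep W h t →
    (∀ i → i < d → W (i + h) (pebble r) ≡ false) →
    ∃[ t₁ ] (Rep W (d + h) t₁ ×
      (∀ {n b t₂} → Run (prim o r) seek t₁ n b t₂ → Run (prim o r) seek t (d + n) b t₂))
  seek-run o r zero {t = t} Rt none = t , Rt , id
  seek-run o r (suc d) {W} {h} {t} Rt none
    with t₁ , Rt₁ , k ← seek-run o r d {W} {suc h} {after (scanned t) R t}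
           (subst (Rep W (suc h)) (sym (afterR _ t)) (Rep-right (Rep-keep Rt)))
           (λ i lt → trans (cong (λ n → W n (pebble r)) (+-suc i h)) (none (suc i) (s≤s lt)))
    = t₁ , subst (λ n → Rep W n t₁) (+-suc d h) Rt₁ , λ q → more step-eq (k q)
    where
    step-eq : δ-prim o r seek (scanned t) ≡ out (inj₁ seek) (scanned t) R
    step-eq rewrite atHead Rt (pebble r) | none 0 (s≤s z≤n) = refl

  finish-cong : ∀ o r {x y : Content} → x ≗ y → finish o r x ≗ finish o r y
  finish-cong clear r e (pebble r′) with does (r Fin.≟ r′)
  ... | true = refl
  ... | false = e (pebble r′)
  finish-cong clear r e home = e home
  finish-cong clear r e bit = e bit
  finish-cong clear r e filled = e filled
  finish-cong clear r e (symbol s) = e (symbol s)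
  finish-cong incr r e = e
  finish-cong mark r e = e
  finish-cong (test τ) r e = e

  -- Nothing is written on the way back, so the worlds before and after can differ only in the first
  -- cell, by `finish`.
  return-run : ∀ o r b h {W W′ t} → Rep W h t →
    (∀ p → W p home ≡ (p ≡ᵇ 0)) →
    (∀ p → p ≢ 0 → W p ≗ W′ p) → finish o r (W 0) ≗ W′ 0 →
    ∃[ t′ ] (Rep W′ 0 t′ × Run (prim o r) (return b) t (suc h) b t′)
  return-run o r b zero {W} {W′} {t} Rt hm e f =
    after (finish o r (scanned t)) S t ,
    Rep-write _ e (λ τ → trans (finish-cong o r (atHead Rt) τ) (f τ)) Rt ,
    stop step-eq
    where
    step-eq : δ-prim o r (return b) (scanned t) ≡ out (inj₂ b) (finish o r (scanned t)) S
    step-eq rewrite atHead Rt home | hm 0 = refl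
  return-run o r b (suc h) {W} {W′} {t} Rt hm e f
    with t′ , Rt′ , k ← return-run o r b h {W} {W′} {after (scanned t) L t}
           (subst (Rep W h) (sym (afterL _ t)) (Rep-left (Rep-keep Rt))) hm e f
    = t′ , Rt′ , more step-eq k
    where
    step-eq : δ-prim o r (return b) (scanned t) ≡ out (inj₁ (return b)) (scanned t) L
    step-eq rewrite atHead Rt home | hm (suc h) = refl

-- Timed Hoare triples for the program constructs

symbolAt : List Sym → ℕ → Sym → Bool
symbolAt [] p s = false
symbolAt (x ∷ w) zero s = x ==ˢ s
symbolAt (x ∷ w) (suc p) s = symbolAt w p s

_∪_ : (ℕ → Bool) → ℕ → ℕ → Bool
(β ∪ a) p = if p ≡ᵇ a then true else β p

-- Cost of a primitive on a register of value `v`. The 4 is what `incr` needs: finding the pebble,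
-- placing it, one more cell on the way back, and the exit on the first cell.
visit : ℕ → ℕ
visit v = 2 * v + 4

module Execution (K : ℕ) (w : List Sym) where
  open Machine K

  world : (Fin K → ℕ → Bool) → (ℕ → Bool) → World
  world π β p home = p ≡ᵇ 0
  world π β p bit = β p
  world π β p filled = p <ᵇ length w
  world π β p (symbol s) = symbolAt w p s
  world π β p (pebble r) = π r p

  at : (ℕ → ℕ) → Fin K → ℕ → Bool
  at ρ r p = ρ (toℕ r) ≡ᵇ p

  state : (ℕ → ℕ) → (ℕ → Bool) → World
  state ρ β = world (at ρ) β

  -- The tape while pebble `r` is off it, between its removal and its new placement; no register
  -- assignment describes this situation.
  erased : Fin K → (ℕ → ℕ) → Fin K → ℕ → Bool
  erased r ρ r′ p = if does (r Fin.≟ r′) then false else at ρ r′ p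

  -- A Hoare triple with time bound `T`. The head is on the first cell before and after, which lets
  -- triples be chained.
  record Exec (c : Code) (ρ : ℕ → ℕ) (β : ℕ → Bool) (b : Bool)
              (ρ′ : ℕ → ℕ) (β′ : ℕ → Bool) (T : ℕ) : Set where
    field
      execute : ∀ {t} → Rep (state ρ β) 0 t →
        ∃[ n ] ∃[ t′ ] (n ≤ T × Run c (start c) t n b t′ × Rep (state ρ′ β′) 0 t′)
  open Exec

  world-resp : ∀ {π π′ β β′} p → (∀ r → π r p ≡ π′ r p) → β p ≡ β′ p → world π β p ≗ world π′ β′ p
  world-resp p e f home = refl
  world-resp p e f bit = f
  world-resp p e f filled = refl
  world-resp p e f (symbol s) = refl
  world-resp p e f (pebble r) = e r

  Exec-weaken : ∀ {c ρ β b ρ′ β′ T T′} → T ≤ T′ → Exec c ρ β b ρ′ β′ T → Exec c ρ β b ρ′ β′ T′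
  Exec-weaken le ex .execute Rt with n , t′ , le′ , run , Rt′ ← ex .execute Rt = n , t′ , ≤-trans le′ le , run , Rt′

  Exec-post : ∀ {c ρ β b ρ′ β′ ρ″ β″ T} → ρ′ ≗ ρ″ → β′ ≗ β″ →
              Exec c ρ β b ρ′ β′ T → Exec c ρ β b ρ″ β″ T
  Exec-post e f ex .execute Rt with n , t′ , le , run , Rt′ ← ex .execute Rt =
    n , t′ , le , run ,
    Rep-resp (λ p → world-resp p (λ r → cong (_≡ᵇ p) (e (toℕ r))) (f p)) Rt′

  Exec-exit : ∀ b {ρ β} → Exec (exit b) ρ β b ρ β 1
  Exec-exit b .execute {t} Rt = 1 , after (scanned t) S t , ≤-refl , stop refl , Rep-keep Rt

  Exec-then : ∀ {c d e ρ β ρ′ β′ b ρ″ β″ T U} → Exec c ρ β true ρ′ β′ T →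
              Exec d ρ′ β′ b ρ″ β″ U → Exec (ite c d e) ρ β b ρ″ β″ (T + U)
  Exec-then x y .execute Rt with m , _ , le , run , Rt₁ ← x .execute Rt with n , t₂ , le′ , run′ , Rt₂ ← y .execute Rt₁ =
    m + n , t₂ , +-mono-≤ le le′ , Run-then run run′ , Rt₂

  Exec-else : ∀ {c d e ρ β ρ′ β′ b ρ″ β″ T U} → Exec c ρ β false ρ′ β′ T →
              Exec e ρ′ β′ b ρ″ β″ U → Exec (ite c d e) ρ β b ρ″ β″ (T + U)
  Exec-else x y .execute Rt with m , _ , le , run , Rt₁ ← x .execute Rt with n , t₂ , le′ , run′ , Rt₂ ← y .execute Rt₁ =
    m + n , t₂ , +-mono-≤ le le′ , Run-else run run′ , Rt₂

  Exec-until-done : ∀ {c d ρ β ρ′ β′ T} → Exec c ρ β true ρ′ β′ T →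
                    Exec (until c d) ρ β true ρ′ β′ T
  Exec-until-done x .execute Rt with m , t₁ , le , run , Rt₁ ← x .execute Rt = m , t₁ , le , Run-until-done run , Rt₁

  Exec-until-step : ∀ {c d ρ β ρ₁ β₁ b₂ ρ₂ β₂ b ρ₃ β₃ T U V} → Exec c ρ β false ρ₁ β₁ T →
                    Exec d ρ₁ β₁ b₂ ρ₂ β₂ U → Exec (until c d) ρ₂ β₂ b ρ₃ β₃ V →
                    Exec (until c d) ρ β b ρ₃ β₃ (T + (U + V))
  Exec-until-step x y z .execute Rt
    with m , _ , le , run , Rt₁ ← x .execute Rt with n , _ , le′ , run′ , Rt₂ ← y .execute Rt₁
    with k , t₃ , le″ , run″ , Rt₃ ← z .execute Rt₂ =
    m + (n + k) , t₃ , +-mono-≤ le (+-mono-≤ le′ le″) ,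
    Run-until-test run (Run-until-body run′ run″) , Rt₃

  seek-register : ∀ o r ρ β {t} → Rep (state ρ β) 0 t →
    ∃[ t₁ ] (Rep (state ρ β) (ρ (toℕ r)) t₁ ×
      (∀ {n b t₂} → Run (prim o r) seek t₁ n b t₂ → Run (prim o r) seek t (ρ (toℕ r) + n) b t₂))
  seek-register o r ρ β Rt
    with t₁ , Rt₁ , k ← seek-run o r (ρ (toℕ r)) Rt
           (λ i lt → ≢⇒≡ᵇ-false (ρ (toℕ r)) (i + 0) (λ e → <⇒≢ lt (sym (trans e (+-identityʳ i)))))
    = t₁ , subst (λ n → Rep (state ρ β) n t₁) (+-identityʳ _) Rt₁ , k

  found-eq : ∀ o r ρ β {t} → Rep (state ρ β) (ρ (toℕ r)) t →
             δ-prim o r seek (scanned t) ≡ found o r (scanned t)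
  found-eq o r ρ β Rt rewrite Rep.atHead Rt (pebble r) | ≡ᵇ-refl (ρ (toℕ r)) = refl

  visit-bound : ∀ v → v + suc (suc v) ≤ visit v
  visit-bound v = begin
    v + suc (suc v)  ≡⟨ +-assoc v 2 v ⟨
    v + 2 + v        ≡⟨ cong (_+ v) (+-comm v 2) ⟩
    2 + v + v        ≡⟨ +-assoc 2 v v ⟩
    2 + (v + v)      ≡⟨ cong (λ u → 2 + (v + u)) (+-identityʳ v) ⟨
    2 + 2 * v        ≤⟨ +-monoˡ-≤ (2 * v) (m≤m+n 2 2) ⟩
    4 + 2 * v        ≡⟨ +-comm 4 (2 * v) ⟩
    visit v           ∎
    where open ≤-Reasoning

  visit-incr-bound : ∀ v → v + suc (suc (suc (suc v))) ≤ visit v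
  visit-incr-bound v = ≤-reflexive (begin
    v + (4 + v)      ≡⟨ +-assoc v 4 v ⟨
    v + 4 + v        ≡⟨ cong (_+ v) (+-comm v 4) ⟩
    4 + v + v        ≡⟨ +-assoc 4 v v ⟩
    4 + (v + v)      ≡⟨ cong (λ u → 4 + (v + u)) (+-identityʳ v) ⟨
    4 + 2 * v        ≡⟨ +-comm 4 (2 * v) ⟩
    visit v           ∎)
    where open ≡-Reasoning

  Exec-test : ∀ τ r ρ β {b} → state ρ β (ρ (toℕ r)) τ ≡ b →
              Exec (prim (test τ) r) ρ β b ρ β (visit (ρ (toℕ r)))
  Exec-test τ r ρ β {b} eq .execute Rt
    with t₁ , Rt₁ , k ← seek-register (test τ) r ρ β Rt
    with t₂ , Rt₂ , q ← return-run (test τ) r b (ρ (toℕ r)) (Rep-keep Rt₁) (λ _ → refl)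
           (λ _ _ _ → refl) (λ _ → refl)
    = _ , t₂ , visit-bound (ρ (toℕ r)) ,
      k (more (trans (found-eq (test τ) r ρ β Rt₁)
        (cong (λ b → out (inj₁ (return b)) _ S) (trans (Rep.atHead Rt₁ τ) eq))) q) , Rt₂

  setBit-state : ∀ {x : Content} ρ β a → x ≗ state ρ β a → setBit x ≗ state ρ (β ∪ a) a
  setBit-state ρ β a e home = e home
  setBit-state ρ β a e bit rewrite ≡ᵇ-refl a = refl
  setBit-state ρ β a e filled = e filled
  setBit-state ρ β a e (symbol s) = e (symbol s)
  setBit-state ρ β a e (pebble r) = e (pebble r)

  Exec-mark : ∀ r ρ β → Exec (prim mark r) ρ β true ρ (β ∪ ρ (toℕ r)) (visit (ρ (toℕ r)))
  Exec-mark r ρ β .execute Rt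
    with t₁ , Rt₁ , k ← seek-register mark r ρ β Rt
    with t₂ , Rt₂ , q ← return-run mark r true (ρ (toℕ r)) {W′ = state ρ (β ∪ ρ (toℕ r))}
           (Rep-write {W′ = state ρ (β ∪ ρ (toℕ r))} (setBit (scanned t₁))
             (λ p ne → world-resp p (λ _ → refl)
               (cong (if_then true else β p) (sym (≢⇒≡ᵇ-false p _ ne))))
             (setBit-state ρ β _ (Rep.atHead Rt₁)) Rt₁)
           (λ _ → refl) (λ _ _ _ → refl) (λ _ → refl)
    = _ , t₂ , visit-bound (ρ (toℕ r)) , k (more (found-eq mark r ρ β Rt₁) q) , Rt₂

  erase-state : ∀ {x : Content} r ρ β a → x ≗ state ρ β a → setPebble r false x ≗ world (erased r ρ) β a
  erase-state r ρ β a e home = e home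
  erase-state r ρ β a e bit = e bit
  erase-state r ρ β a e filled = e filled
  erase-state r ρ β a e (symbol s) = e (symbol s)
  erase-state r ρ β a e (pebble r′) with does (r Fin.≟ r′)
  ... | true = refl
  ... | false = e (pebble r′)

  ≔-register : ∀ ρ (r r′ : Fin K) v →
               (ρ [ toℕ r ≔ v ]) (toℕ r′) ≡ (if does (r Fin.≟ r′) then v else ρ (toℕ r′))
  ≔-register ρ r r′ v with r Fin.≟ r′
  ... | yes refl = ≔-same ρ (toℕ r) v
  ... | no ne = ≔-other ρ (toℕ r) v (toℕ r′) (λ e → ne (sym (Fin.toℕ-injective e)))

  place-state : ∀ {x : Content} r ρ β a → x ≗ world (erased r ρ) β a →
                setPebble r true x ≗ state (ρ [ toℕ r ≔ a ]) β a
  place-state r ρ β a e home = e home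
  place-state r ρ β a e bit = e bit
  place-state r ρ β a e filled = e filled
  place-state r ρ β a e (symbol s) = e (symbol s)
  place-state r ρ β a e (pebble r′) rewrite ≔-register ρ r r′ a with does (r Fin.≟ r′) | e (pebble r′)
  ... | true | _ = sym (≡ᵇ-refl a)
  ... | false | e′ = e′

  erased-elsewhere : ∀ r ρ p → p ≢ ρ (toℕ r) → ∀ r′ → at ρ r′ p ≡ erased r ρ r′ p
  erased-elsewhere r ρ p ne r′ with r Fin.≟ r′
  ... | yes refl = ≢⇒≡ᵇ-false (ρ (toℕ r)) p (ne ∘ sym)
  ... | no _ = refl

  placed-elsewhere : ∀ r ρ a p → p ≢ a → ∀ r′ → erased r ρ r′ p ≡ at (ρ [ toℕ r ≔ a ]) r′ p
  placed-elsewhere r ρ a p ne r′ rewrite ≔-register ρ r r′ a with r Fin.≟ r′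
  ... | yes refl = sym (≢⇒≡ᵇ-false a p (ne ∘ sym))
  ... | no _ = refl

  erase : ∀ r ρ β {t} → Rep (state ρ β) (ρ (toℕ r)) t →
          Rep (world (erased r ρ) β) (ρ (toℕ r)) (after (setPebble r false (scanned t)) S t)
  erase r ρ β Rt = Rep-write _ (λ p ne → world-resp p (erased-elsewhere r ρ p ne) refl)
                     (erase-state r ρ β _ (Rep.atHead Rt)) Rt

  Exec-clear : ∀ r ρ β → Exec (prim clear r) ρ β true (ρ [ toℕ r ≔ 0 ]) β (visit (ρ (toℕ r)))
  Exec-clear r ρ β .execute Rt
    with t₁ , Rt₁ , k ← seek-register clear r ρ β Rt
    with t₂ , Rt₂ , q ← return-run clear r true (ρ (toℕ r)) {W′ = state (ρ [ toℕ r ≔ 0 ]) β}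
           (erase r ρ β Rt₁) (λ _ → refl)
           (λ p ne → world-resp p (placed-elsewhere r ρ 0 p ne) refl)
           (place-state r ρ β 0 (λ _ → refl))
    = _ , t₂ , visit-bound (ρ (toℕ r)) , k (more (found-eq clear r ρ β Rt₁) q) , Rt₂

  Exec-incr : ∀ r ρ β → Exec (prim incr r) ρ β true (ρ [ toℕ r ≔ suc (ρ (toℕ r)) ]) β (visit (ρ (toℕ r)))
  Exec-incr r ρ β .execute Rt
    with t₁ , Rt₁ , k ← seek-register incr r ρ β Rt
    with Rt₂ ← subst (Rep (world (erased r ρ) β) (suc (ρ (toℕ r)))) (sym (afterR _ t₁))
                 (Rep-right (erase r ρ β Rt₁))
    with t₃ , Rt₃ , q ← return-run incr r true (suc (ρ (toℕ r))) {W′ = state (ρ [ toℕ r ≔ _ ]) β}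
           (Rep-write {W′ = state (ρ [ toℕ r ≔ _ ]) β} _
             (λ p ne → world-resp p (placed-elsewhere r ρ _ p ne) refl)
             (place-state r ρ β _ (Rep.atHead Rt₂)) Rt₂)
           (λ _ → refl) (λ _ _ _ → refl) (λ _ → refl)
    = _ , t₃ , visit-incr-bound (ρ (toℕ r)) , k (more (found-eq incr r ρ β Rt₁) (more refl q)) , Rt₃

-- Translation of programs into Turing machines

initial : ℕ → ℕ
initial _ = 0

unmarked : ℕ → Bool
unmarked _ = false

input-left : ∀ {g} w → Tape.left (initTape {g} w) ≡ []
input-left [] = refl
input-left (x ∷ w) = refl

input-head : ∀ {g} w → Tape.here (initTape {g} w) ≡ inputCell w 0
input-head [] = refl
input-head (x ∷ w) = refl

input-right : ∀ {g} w i → nth (Tape.right (initTape {g} w)) i ≡ inputCell w (suc i)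
input-right [] i = refl
input-right (x ∷ w) i = nth-map-inp w i

module Compile (K : ℕ) where
  open Machine K

  card : Code → ℕ
  card (exit b) = 1
  card (prim o r) = 4
  card (ite c d e) = card c + (card d + card e)
  card (until c d) = card c + card d

  join₁ : ∀ {m n} {A B : Set} → (Fin m → A) → (Fin n → B) → Fin (m + n) → A ⊎ B
  join₁ {m} f g i = Data.Sum.map f g (splitAt m i)

  encodeSt : ∀ c → St c → Fin (card c)
  encodeSt (exit b) s = zero
  encodeSt (prim o r) seek = zero
  encodeSt (prim o r) place = suc zero
  encodeSt (prim o r) (return false) = suc (suc zero)
  encodeSt (prim o r) (return true) = suc (suc (suc zero))
  encodeSt (ite c d e) (inj₁ s) = encodeSt c s ↑ˡ _
  encodeSt (ite c d e) (inj₂ (inj₁ s)) = card c ↑ʳ (encodeSt d s ↑ˡ _)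
  encodeSt (ite c d e) (inj₂ (inj₂ s)) = card c ↑ʳ (card d ↑ʳ encodeSt e s)
  encodeSt (until c d) (inj₁ s) = encodeSt c s ↑ˡ _
  encodeSt (until c d) (inj₂ s) = card c ↑ʳ encodeSt d s

  decodeSt : ∀ c → Fin (card c) → St c
  decodeSt (exit b) i = tt
  decodeSt (prim o r) zero = seek
  decodeSt (prim o r) (suc zero) = place
  decodeSt (prim o r) (suc (suc zero)) = return false
  decodeSt (prim o r) (suc (suc (suc i))) = return true
  decodeSt (ite c d e) i = join₁ (decodeSt c) (join₁ (decodeSt d) (decodeSt e)) i
  decodeSt (until c d) i = join₁ (decodeSt c) (decodeSt d) i

  decode-encode : ∀ c s → decodeSt c (encodeSt c s) ≡ s
  decode-encode (exit b) s = refl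
  decode-encode (prim o r) seek = refl
  decode-encode (prim o r) place = refl
  decode-encode (prim o r) (return false) = refl
  decode-encode (prim o r) (return true) = refl
  decode-encode (ite c d e) (inj₁ s)
    rewrite Fin.splitAt-↑ˡ (card c) (encodeSt c s) (card d + card e) = cong inj₁ (decode-encode c s)
  decode-encode (ite c d e) (inj₂ (inj₁ s))
    rewrite Fin.splitAt-↑ʳ (card c) (card d + card e) (encodeSt d s ↑ˡ card e)
          | Fin.splitAt-↑ˡ (card d) (encodeSt d s) (card e) = cong (inj₂ ∘ inj₁) (decode-encode d s)
  decode-encode (ite c d e) (inj₂ (inj₂ s))
    rewrite Fin.splitAt-↑ʳ (card c) (card d + card e) (card d ↑ʳ encodeSt e s)
          | Fin.splitAt-↑ʳ (card d) (card e) (encodeSt e s) = cong (inj₂ ∘ inj₂) (decode-encode e s)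
  decode-encode (until c d) (inj₁ s)
    rewrite Fin.splitAt-↑ˡ (card c) (encodeSt c s) (card d) = cong inj₁ (decode-encode c s)
  decode-encode (until c d) (inj₂ s)
    rewrite Fin.splitAt-↑ʳ (card c) (card d) (encodeSt d s) = cong inj₂ (decode-encode d s)

  -- Three states besides those of the code: installing the pebbles, accepting, rejecting.
  States : Code → ℕ
  States c = suc (2 + card c)

  target : ∀ c → St c ⊎ Bool → Fin (States c)
  target c (inj₁ s) = suc (suc (suc (encodeSt c s)))
  target c (inj₂ true) = suc zero
  target c (inj₂ false) = suc (suc zero)

  action : ∀ c → Out (St c ⊎ Bool) → Action (States c) size
  action c (out n x m) = step (target c n) (wrk (pack x)) m

  -- The first step puts the home flag and all pebbles on the first cell.
  install : Content → Content
  install x home = true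
  install x bit = false
  install x filled = x filled
  install x (symbol s) = x (symbol s)
  install x (pebble r) = true

  δ-tm : ∀ c → Fin (States c) → Cell size → Action (States c) size
  δ-tm c zero a = step (target c (inj₁ (start c))) (wrk (pack (install (content a)))) S
  δ-tm c (suc zero) a = halt true
  δ-tm c (suc (suc zero)) a = halt false
  δ-tm c (suc (suc (suc i))) a = action c (δᶜ c (decodeSt c i) (content a))

  machine : Code → TM
  machine c = record { nStates = 2 + card c ; nWork = size ; δ = δ-tm c }

  step-action : ∀ c s t {n x m} → δᶜ c s (scanned t) ≡ out n x m →
                stepM (machine c) (running (target c (inj₁ s)) t) ≡ running (target c n) (after x m t)
  step-action c s (tape l a r) eq rewrite decode-encode c s | eq = refl

  step-final : ∀ c b t → stepM (machine c) (running (target c (inj₂ b)) t) ≡ halted b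
  step-final c true (tape l a r) = refl
  step-final c false (tape l a r) = refl

  Run-machine : ∀ {c s t n b t′} → Run c s t n b t′ →
                run (machine c) (suc n) (running (target c (inj₁ s)) t) ≡ halted b
  Run-machine {c} {s} {t} (stop eq) =
    trans (cong (stepM (machine c)) (step-action c s t eq)) (step-final c _ _)
  Run-machine {c} {s} {t} (more {n = n} eq q) =
    trans (cong (run (machine c) (suc n)) (step-action c s t eq)) (Run-machine q)

  module _ (w : List Sym) where
    open Execution K w

    content-input : ∀ p s → content (inputCell w p) (symbol s) ≡ symbolAt w p s
    content-input p s = go w p
      where
      go : ∀ w p → content (inputCell w p) (symbol s) ≡ symbolAt w p s
      go [] p = refl
      go (x ∷ w) zero = refl
      go (x ∷ w) (suc p) = go w p

    content-filled : ∀ p → content (inputCell w p) filled ≡ (p <ᵇ length w)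
    content-filled p = go w p
      where
      go : ∀ w p → content (inputCell w p) filled ≡ (p <ᵇ length w)
      go [] p = refl
      go (x ∷ w) zero = refl
      go (x ∷ w) (suc p) = go w p

    content-working : ∀ τ → (∀ s → content (inp s) τ ≡ false) →
                      ∀ p → content (inputCell w p) τ ≡ false
    content-working τ none = go w
      where
      go : ∀ w p → content (inputCell w p) τ ≡ false
      go [] p = refl
      go (x ∷ w) zero = none x
      go (x ∷ w) (suc p) = go w p

    content-state : ∀ p → content (inputCell w (suc p)) ≗ state initial unmarked (suc p)
    content-state p home = content-working home (λ _ → refl) (suc p)
    content-state p bit = content-working bit (λ _ → refl) (suc p)
    content-state p filled = content-filled (suc p)
    content-state p (symbol s) = content-input (suc p) s
    content-state p (pebble r) = content-working (pebble r) (λ _ → refl) (suc p)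

    install-state : ∀ {x : Content} → x ≗ content (inputCell w 0) → install x ≗ state initial unmarked 0
    install-state e home = refl
    install-state e bit = refl
    install-state e filled = trans (e filled) (content-filled 0)
    install-state e (symbol s) = trans (e (symbol s)) (content-input 0 s)
    install-state e (pebble r) = refl

    installed : Tape size
    installed = after (install (scanned (initTape w))) S (initTape w)

    Rep-installed : Rep (state initial unmarked) 0 installed
    Rep-installed = rep (subst (Left _ 0) (sym (input-left w)) [])
      (λ τ → trans (unpack-pack _ τ) (install-state (λ τ → cong (λ a → content a τ) (input-head w)) τ))
      (λ i τ → trans (cong (λ a → content a τ) (input-right w i))
        (trans (content-state i τ) (cong (λ p → state initial unmarked p τ) (+-comm 1 i))))

    -- The two extra steps are the installation and the final halt.
    Exec-machine : ∀ {c b ρ β T} → Exec c initial unmarked b ρ β T →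
                   ∀ t → 2 + T ≤ t → run (machine c) t (initConfig (machine c) w) ≡ halted b
    Exec-machine {c} {b} {T = T} ex t le
      with n , t′ , n≤T , q , _ ← Exec.execute ex Rep-installed
      with k , refl ← m≤n⇒∃[o]m+o≡n (≤-trans (+-monoʳ-≤ 2 n≤T) le) = begin
      run M (2 + n + k) (initConfig M w)                   ≡⟨ run-+ M (2 + n) k (initConfig M w) ⟩
      run M k (run M (suc n) (running (target c (inj₁ (start c))) installed)) ≡⟨ cong (run M k) (Run-machine q) ⟩
      run M k (halted b)                                   ≡⟨ run-halted M k b ⟩
      halted b                                             ∎
      where
      open ≡-Reasoning
      M : TM
      M = machine c

-- Closure properties of polynomial bounds

-- The base 2 + n makes powers monotone in the exponent and absorbs a doubling into one more factor,
-- also for n = 0.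
Poly : (ℕ → ℕ) → Set
Poly f = ∃[ k ] (∀ n → f n ≤ (2 + n) ^ k)

1≤pow : ∀ n k → 1 ≤ (2 + n) ^ k
1≤pow n k = m^n>0 (2 + n) k

pow-≤ : ∀ n {j k} → j ≤ k → (2 + n) ^ j ≤ (2 + n) ^ k
pow-≤ n = ^-monoʳ-≤ (2 + n)

Poly-const : ∀ c → Poly (λ _ → c)
Poly-const c = c , λ n → ≤-trans (bound c) (^-monoˡ-≤ c (m≤m+n 2 n))
  where
  bound : ∀ c → c ≤ 2 ^ c
  bound zero = z≤n
  bound (suc c) = subst (suc c ≤_) (cong (2 ^ c +_) (sym (+-identityʳ (2 ^ c))))
                        (+-mono-≤ (m^n>0 2 c) (bound c))

Poly-id : Poly (λ n → n)
Poly-id = 1 , λ n → ≤-trans (m≤n+m n 2) (≤-reflexive (sym (*-identityʳ (2 + n))))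

double-≤ : ∀ n x → x + x ≤ (2 + n) * x
double-≤ n x = +-monoʳ-≤ x (m≤m+n x (n * x))

Poly-+ : ∀ {f g} → Poly f → Poly g → Poly (λ n → f n + g n)
Poly-+ {f} {g} (j , p) (k , q) = suc (j + k) , λ n → begin
  f n + g n                               ≤⟨ +-mono-≤ (p n) (q n) ⟩
  (2 + n) ^ j + (2 + n) ^ k               ≤⟨ +-mono-≤ (pow-≤ n (m≤m+n j k)) (pow-≤ n (m≤n+m k j)) ⟩
  (2 + n) ^ (j + k) + (2 + n) ^ (j + k)   ≤⟨ double-≤ n ((2 + n) ^ (j + k)) ⟩
  (2 + n) ^ suc (j + k)                   ∎
  where open ≤-Reasoning

Poly-* : ∀ {f g} → Poly f → Poly g → Poly (λ n → f n * g n)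
Poly-* (j , p) (k , q) = j + k , λ n →
  ≤-trans (*-mono-≤ (p n) (q n)) (≤-reflexive (sym (^-distribˡ-+-* (2 + n) j k)))

Poly-∘ : ∀ {f g} → Poly f → Poly g → Poly (λ n → f (g n))
Poly-∘ {f} {g} (j , p) (k , q) = suc (suc k) * j , λ n → begin
  f (g n)                      ≤⟨ p (g n) ⟩
  (2 + g n) ^ j                ≤⟨ ^-monoˡ-≤ j (bound n) ⟩
  ((2 + n) ^ suc (suc k)) ^ j  ≡⟨ ^-*-assoc (2 + n) (suc (suc k)) j ⟩
  (2 + n) ^ (suc (suc k) * j)  ∎
  where
  open ≤-Reasoning
  bound : ∀ n → 2 + g n ≤ (2 + n) ^ suc (suc k)
  bound n = begin
    2 + g n                                  ≤⟨ +-mono-≤ (*-mono-≤ (m≤m+n 2 n) (1≤pow n k)) (q n) ⟩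
    (2 + n) * (2 + n) ^ k + (2 + n) ^ k      ≤⟨ +-monoʳ-≤ ((2 + n) ^ suc k) (pow-≤ n (n≤1+n k)) ⟩
    (2 + n) ^ suc k + (2 + n) ^ suc k        ≤⟨ double-≤ n ((2 + n) ^ suc k) ⟩
    (2 + n) ^ suc (suc k)                    ∎

-- A language of bounded formulas and its compilation

-- In Form l the registers below l are free, the binder of Form (suc l) being
-- register l. In Exp m l variables are registers from m on, and evaluation uses
-- scratch registers below l.
module Language (K : ℕ) where
  open Machine K

  data Exp (m : ℕ) : ℕ → Set where
    num : ∀ {l} → ℕ → Exp m l
    var : ∀ {l} (r : Fin K) {_ : T (m ℕ.≤ᵇ toℕ r)} → Exp m (suc l)
    _⊕_ : ∀ {l} → Exp m l → Exp m l → Exp m l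
    _⊗_ : ∀ {l} → Exp m l → (r : Fin K) {_ : T (m ℕ.≤ᵇ toℕ r)} → Exp m (suc l)

  infixl 6 _⊕_
  infixl 7 _⊗_

  value : ∀ {m l} → (ℕ → ℕ) → Exp m l → ℕ
  value ρ (num n) = n
  value ρ (var r) = ρ (toℕ r)
  value ρ (e ⊕ f) = value ρ e + value ρ f
  value ρ (e ⊗ r) = ρ (toℕ r) * value ρ e

  data Form : ℕ → Set where
    eq : ∀ {l} → Exp (2 + l) l → Exp (2 + l) l → Form (2 + l)
    bitAt : ∀ {l} → Exp (suc l) l → Form (suc l)
    symAt : ∀ {l} → Sym → Exp (suc l) l → Form (suc l)
    neg : ∀ {l} → Form l → Form l
    _∧ᶠ_ _∨ᶠ_ : ∀ {l} → Form l → Form l → Form l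
    any : ∀ {l} (b : Fin K) {_ : T (suc l ℕ.≤ᵇ toℕ b)} → Form l → Form (suc l)

  infixr 5 _∧ᶠ_
  infixr 4 _∨ᶠ_

  -- Valued in `Set`, so that for a concrete formula it computes to a readable statement.
  ⟦_⟧ : ∀ {l} → Form l → List Sym → (ℕ → Bool) → (ℕ → ℕ) → Set
  ⟦ eq e f ⟧ w β ρ = value ρ e ≡ value ρ f
  ⟦ bitAt e ⟧ w β ρ = β (value ρ e) ≡ true
  ⟦ symAt s e ⟧ w β ρ = symbolAt w (value ρ e) s ≡ true
  ⟦ neg φ ⟧ w β ρ = ¬ ⟦ φ ⟧ w β ρ
  ⟦ φ ∧ᶠ ψ ⟧ w β ρ = ⟦ φ ⟧ w β ρ × ⟦ ψ ⟧ w β ρ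
  ⟦ φ ∨ᶠ ψ ⟧ w β ρ = ⟦ φ ⟧ w β ρ ⊎ ⟦ ψ ⟧ w β ρ
  ⟦ any {l} b φ ⟧ w β ρ = ∃[ i ] (i < ρ (toℕ b) × ⟦ φ ⟧ w β (ρ [ l ≔ i ]))

  infixr 3 _⨾_
  _⨾_ : Code → Code → Code
  c ⨾ d = ite c d (exit false)

  loop : Fin K → Fin K → Code → Code
  loop l r c = until (prim (test (pebble r)) l) (c ⨾ prim incr l) ⨾ prim clear l

  count : Fin K → ℕ → Code
  count a zero = exit true
  count a (suc n) = prim incr a ⨾ count a n

  -- Adds to register `a` instead of overwriting it, so that sums and products become successive
  -- additions. A loop runs until its counter meets a pebble, which is why one factor of a product
  -- is a register.
  add : ∀ {m l} → l ≤ K → Fin K → Exp m l → Code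
  add p a (num n) = count a n
  add p a (var r) = loop (fromℕ< p) r (prim incr a)
  add p a (e ⊕ f) = add p a e ⨾ add p a f
  add p a (e ⊗ r) = loop (fromℕ< p) r (add (<⇒≤ p) a e)

  answer : Fin K → Code → Code
  answer a c = ite c (prim clear a ⨾ exit true) (prim clear a ⨾ exit false)

  probe : ∀ {m l} → l ≤ K → Fin K → Exp m l → Code → Code
  probe p a e c = add p a e ⨾ answer a c

  compile : ∀ {l} → l ≤ K → Form l → Code
  -- The two values are placed in registers l and l + 1; they are equal iff both pebbles stand in
  -- one cell.
  compile p (eq e f) =
    probe (<⇒≤ (<⇒≤ p)) (fromℕ< (<⇒≤ p)) f
      (probe (<⇒≤ (<⇒≤ p)) (fromℕ< p) e (prim (test (pebble (fromℕ< (<⇒≤ p)))) (fromℕ< p)))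
  compile p (bitAt e) = probe (<⇒≤ p) (fromℕ< p) e (prim (test bit) (fromℕ< p))
  compile p (symAt s e) = probe (<⇒≤ p) (fromℕ< p) e (prim (test (symbol s)) (fromℕ< p))
  compile p (neg φ) = ite (compile p φ) (exit false) (exit true)
  compile p (φ ∧ᶠ ψ) = ite (compile p φ) (compile p ψ) (exit false)
  compile p (φ ∨ᶠ ψ) = ite (compile p φ) (exit true) (compile p ψ)
  compile p (any b φ) =
    until (ite (prim (test (pebble b)) (fromℕ< p)) (exit true) (compile (<⇒≤ p) φ)) (prim incr (fromℕ< p))
    -- The search stops at a witness or at the bound; comparing with the bound once more tells
    -- which.
    ⨾ ite (prim (test (pebble b)) (fromℕ< p)) (prim clear (fromℕ< p) ⨾ exit false)
                                              (prim clear (fromℕ< p) ⨾ exit true)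

  loopTime : (ℕ → ℕ) → ℕ → ℕ
  loopTime U Y = (Y * (visit Y + (U Y + visit Y)) + visit Y) + visit Y

  addTime : ∀ {m l} → Exp m l → ℕ → ℕ
  addTime (num n) Y = n * visit Y + 1
  addTime (var r) Y = loopTime visit Y
  addTime (e ⊕ f) Y = addTime e Y + addTime f Y
  addTime (e ⊗ r) Y = loopTime (addTime e) Y

  maxValue : ∀ {m l} → Exp m l → ℕ → ℕ
  maxValue (num n) B = n
  maxValue (var r) B = B
  maxValue (e ⊕ f) B = maxValue e B + maxValue f B
  maxValue (e ⊗ r) B = B * maxValue e B

  answerTime : (ℕ → ℕ) → ℕ → ℕ
  answerTime U Y = U Y + (visit Y + 1)

  probeTime : ∀ {m l} → Exp m l → (ℕ → ℕ) → ℕ → ℕ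
  probeTime e U B = addTime e (B + maxValue e B) + answerTime U (B + maxValue e B)

  time : ∀ {l} → Form l → ℕ → ℕ
  time (eq e f) B = probeTime f (probeTime e visit) B
  time (bitAt e) B = probeTime e visit B
  time (symAt s e) B = probeTime e visit B
  time (neg φ) B = time φ B + 1
  time (φ ∧ᶠ ψ) B = time φ B + (time ψ B + 1)
  time (φ ∨ᶠ ψ) B = time φ B + (1 + time ψ B)
  time (any b φ) B =
    (B * ((visit B + time φ B) + visit B) + (visit B + (1 + time φ B))) + answerTime visit B

  Poly-visit : Poly visit
  Poly-visit = Poly-+ (Poly-* (Poly-const 2) Poly-id) (Poly-const 4)

  Poly-loop : ∀ {U} → Poly U → Poly (loopTime U)
  Poly-loop u = Poly-+ (Poly-+ (Poly-* Poly-id (Poly-+ Poly-visit (Poly-+ u Poly-visit))) Poly-visit) Poly-visit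

  Poly-addTime : ∀ {m l} (e : Exp m l) → Poly (addTime e)
  Poly-addTime (num n) = Poly-+ (Poly-* (Poly-const n) Poly-visit) (Poly-const 1)
  Poly-addTime (var r) = Poly-loop Poly-visit
  Poly-addTime (e ⊕ f) = Poly-+ (Poly-addTime e) (Poly-addTime f)
  Poly-addTime (e ⊗ r) = Poly-loop (Poly-addTime e)

  Poly-maxValue : ∀ {m l} (e : Exp m l) → Poly (maxValue e)
  Poly-maxValue (num n) = Poly-const n
  Poly-maxValue (var r) = Poly-id
  Poly-maxValue (e ⊕ f) = Poly-+ (Poly-maxValue e) (Poly-maxValue f)
  Poly-maxValue (e ⊗ r) = Poly-* Poly-id (Poly-maxValue e)

  Poly-answer : ∀ {U} → Poly U → Poly (answerTime U)
  Poly-answer u = Poly-+ u (Poly-+ Poly-visit (Poly-const 1))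

  Poly-probe : ∀ {m l} (e : Exp m l) {U} → Poly U → Poly (probeTime e U)
  Poly-probe e {U} u = Poly-+ (Poly-∘ (Poly-addTime e) inner) (Poly-∘ (Poly-answer u) inner)
    where
    inner : Poly (λ B → B + maxValue e B)
    inner = Poly-+ Poly-id (Poly-maxValue e)

  Poly-time : ∀ {l} (φ : Form l) → Poly (time φ)
  Poly-time (eq e f) = Poly-probe f (Poly-probe e Poly-visit)
  Poly-time (bitAt e) = Poly-probe e Poly-visit
  Poly-time (symAt s e) = Poly-probe e Poly-visit
  Poly-time (neg φ) = Poly-+ (Poly-time φ) (Poly-const 1)
  Poly-time (φ ∧ᶠ ψ) = Poly-+ (Poly-time φ) (Poly-+ (Poly-time ψ) (Poly-const 1))
  Poly-time (φ ∨ᶠ ψ) = Poly-+ (Poly-time φ) (Poly-+ (Poly-const 1) (Poly-time ψ))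
  Poly-time (any b φ) =
    Poly-+ (Poly-+ (Poly-* Poly-id (Poly-+ (Poly-+ Poly-visit (Poly-time φ)) Poly-visit))
                   (Poly-+ Poly-visit (Poly-+ (Poly-const 1) (Poly-time φ))))
           (Poly-answer Poly-visit)

-- Correctness and running time of compiled formulas

≔-agree : ∀ {ρ ρ′} l {v v′} → v ≡ v′ → (∀ i → i ≢ l → ρ i ≡ ρ′ i) → ρ [ l ≔ v ] ≗ ρ′ [ l ≔ v′ ]
≔-agree {ρ} {ρ′} l {v} refl e i with i ≟ l
... | yes refl = trans (≔-same ρ l v) (sym (≔-same ρ′ l v))
... | no ne = trans (≔-other ρ l v i ne) (trans (e i ne) (sym (≔-other ρ′ l v i ne)))

≔-value : ∀ {ρ l v v′} → v ≡ v′ → ρ [ l ≔ v ] ≗ ρ [ l ≔ v′ ]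
≔-value refl i = refl

≔-≔ : ∀ ρ l x y → (ρ [ l ≔ x ]) [ l ≔ y ] ≗ ρ [ l ≔ y ]
≔-≔ ρ l x y = ≔-agree l refl (≔-other ρ l x)

≔-id : ∀ ρ l {v} → ρ l ≡ v → ρ [ l ≔ v ] ≗ ρ
≔-id ρ l e i with i ≟ l
... | yes refl = trans (≔-same ρ l _) (sym e)
... | no ne = ≔-other ρ l _ i ne

≔-overwrite : ∀ ρ a l x i y → l ≢ a → ((ρ [ a ≔ x ]) [ l ≔ i ]) [ a ≔ y ] ≗ (ρ [ a ≔ y ]) [ l ≔ i ]
≔-overwrite ρ a l x i y ne j with j ≟ a
... | yes refl = trans (≔-same _ j y) (sym (trans (≔-other (ρ [ j ≔ y ]) l i j (ne ∘ sym)) (≔-same ρ j y)))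
... | no j≢a = trans (≔-other _ a y j j≢a) (inner j j≢a)
  where
  inner : ∀ j → j ≢ a → ((ρ [ a ≔ x ]) [ l ≔ i ]) j ≡ ((ρ [ a ≔ y ]) [ l ≔ i ]) j
  inner j j≢a with j ≟ l
  ... | yes refl = trans (≔-same (ρ [ a ≔ x ]) l i) (sym (≔-same (ρ [ a ≔ y ]) l i))
  ... | no j≢l = trans (≔-other (ρ [ a ≔ x ]) l i j j≢l) (trans (trans (≔-other ρ a x j j≢a)
                   (sym (≔-other ρ a y j j≢a))) (sym (≔-other (ρ [ a ≔ y ]) l i j j≢l)))

≔-≤ : ∀ {ρ l v Y} → (∀ i → ρ i ≤ Y) → v ≤ Y → ∀ i → (ρ [ l ≔ v ]) i ≤ Y
≔-≤ {ρ} {l} {v} {Y} h le i with i ≟ l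
... | yes refl = subst (_≤ Y) (sym (≔-same ρ l v)) le
... | no ne = subst (_≤ Y) (sym (≔-other ρ l v i ne)) (h i)

Reflects-true : ∀ b → Reflects (b ≡ true) b
Reflects-true true = ofʸ refl
Reflects-true false = ofⁿ λ ()

Reflects-⇔ : ∀ {A B : Set} {b} → (A → B) → (B → A) → Reflects A b → Reflects B b
Reflects-⇔ f g (ofʸ a) = ofʸ (f a)
Reflects-⇔ f g (ofⁿ na) = ofⁿ (na ∘ g)

module Evaluation (K : ℕ) (w : List Sym) where
  open Machine K
  open Language K
  open Execution K w

  Exec-pre : ∀ {c ρ ρ₀ β b ρ′ β′ T} → ρ ≗ ρ₀ → Exec c ρ₀ β b ρ′ β′ T → Exec c ρ β b ρ′ β′ T
  Exec-pre e ex .Exec.execute Rt = ex .Exec.execute (Rep-resp (λ p → world-resp p (λ r → cong (_≡ᵇ p) (e (toℕ r))) refl) Rt)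

  visit-mono : ∀ {u v} → u ≤ v → visit u ≤ visit v
  visit-mono le = +-monoˡ-≤ 4 (*-monoʳ-≤ 2 le)

  clear-at : ∀ {a l ρ β Y} → toℕ a ≡ l → ρ l ≤ Y → Exec (prim clear a) ρ β true (ρ [ l ≔ 0 ]) β (visit Y)
  clear-at refl le = Exec-weaken (visit-mono le) (Exec-clear _ _ _)

  incr-at : ∀ {a l ρ β Y} → toℕ a ≡ l → ρ l ≤ Y →
            Exec (prim incr a) ρ β true (ρ [ l ≔ suc (ρ l) ]) β (visit Y)
  incr-at refl le = Exec-weaken (visit-mono le) (Exec-incr _ _ _)

  test-at : ∀ {τ a l ρ β b Y} → toℕ a ≡ l → ρ l ≤ Y → state ρ β (ρ l) τ ≡ b →
            Exec (prim (test τ) a) ρ β b ρ β (visit Y)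
  test-at refl le e = Exec-weaken (visit-mono le) (Exec-test _ _ _ _ e)

  -- `σ i` describes the registers after i rounds except for the counter `l`, which is 0 in it and
  -- is set separately.
  Exec-loop : ∀ {a b l r} → toℕ a ≡ l → toℕ b ≡ r → ∀ (σ : ℕ → ℕ → ℕ) n Y body U {β} →
    l ≢ r → (∀ i → σ i r ≡ n) → (∀ i → σ i l ≡ 0) → n ≤ Y →
    (∀ i → i < n → Exec body (σ i [ l ≔ i ]) β true (σ (suc i) [ l ≔ i ]) β (U Y)) →
    Exec (loop a b body) (σ 0) β true (σ n) β (loopTime U Y)
  Exec-loop {a} {b} {l} {r} ea refl σ n Y body U {β} l≢r limit fresh n≤Y iterate =
    Exec-then
      (Exec-weaken (+-monoˡ-≤ (visit Y) (*-monoˡ-≤ _ n≤Y))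
        (Exec-pre (λ i → sym (≔-id (σ 0) l (fresh 0) i)) (from n 0 (+-identityʳ n))))
      (Exec-post (λ i → trans (≔-≔ (σ n) l n 0 i) (≔-id (σ n) l (fresh n) i)) (λ _ → refl)
        (clear-at ea (subst (_≤ Y) (sym (≔-same (σ n) l n)) n≤Y)))
    where
    at-l : ∀ i → i ≤ n → (σ i [ l ≔ i ]) l ≤ Y
    at-l i le = subst (_≤ Y) (sym (≔-same (σ i) l i)) (≤-trans le n≤Y)

    compare : ∀ i → state (σ i [ l ≔ i ]) β ((σ i [ l ≔ i ]) l) (pebble b) ≡ (n ≡ᵇ i)
    compare i = cong₂ _≡ᵇ_ (trans (≔-other (σ i) l i r (l≢r ∘ sym)) (limit i)) (≔-same (σ i) l i)

    from : ∀ d i → d + i ≡ n →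
      Exec (until (prim (test (pebble b)) a) (body ⨾ prim incr a)) (σ i [ l ≔ i ]) β
           true (σ n [ l ≔ n ]) β (d * (visit Y + (U Y + visit Y)) + visit Y)
    from zero i refl = Exec-until-done (test-at ea (at-l i ≤-refl) (trans (compare i) (≡ᵇ-refl i)))
    from (suc d) i refl =
      Exec-weaken (≤-reflexive (sym (trans (+-assoc (visit Y + (U Y + visit Y)) _ _)
                                           (+-assoc (visit Y) (U Y + visit Y) _))))
      (Exec-until-step
        (test-at ea (at-l i (<⇒≤ i<n)) (trans (compare i) (≢⇒≡ᵇ-false n i (λ e → <⇒≢ i<n (sym e)))))
        (Exec-then (iterate i i<n)
          (Exec-post (λ j → trans (≔-≔ (σ (suc i)) l i _ j)
                                  (≔-value (cong suc (≔-same (σ (suc i)) l i)) j))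
                     (λ _ → refl)
            (incr-at ea (subst (_≤ Y) (sym (≔-same (σ (suc i)) l i)) (≤-trans (<⇒≤ i<n) n≤Y)))))
        (from d (suc i) (+-suc d i)))
      where
      i<n : i < suc d + i
      i<n = s≤s (m≤n+m i d)

  value-cong : ∀ {m l ρ ρ′} (e : Exp m l) → (∀ i → m ≤ i → ρ i ≡ ρ′ i) → value ρ e ≡ value ρ′ e
  value-cong (num n) h = refl
  value-cong {m} (var r {v}) h = h (toℕ r) (≤ᵇ⇒≤ m _ v)
  value-cong (e ⊕ f) h = cong₂ _+_ (value-cong e h) (value-cong f h)
  value-cong {m} (_⊗_ e r {v}) h = cong₂ _*_ (h (toℕ r) (≤ᵇ⇒≤ m _ v)) (value-cong e h)

  Fresh : ℕ → (ℕ → ℕ) → Set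
  Fresh l ρ = ∀ i → i < l → ρ i ≡ 0

  Fresh-≔ : ∀ {l ρ} a {v} → l ≤ a → Fresh l ρ → Fresh l (ρ [ a ≔ v ])
  Fresh-≔ a le h i lt = trans (≔-other _ a _ i (<⇒≢ (<-≤-trans lt le))) (h i lt)

  Fresh-weaken : ∀ {l ρ} → Fresh (suc l) ρ → Fresh l ρ
  Fresh-weaken h i lt = h i (m<n⇒m<1+n lt)

  Exec-count : ∀ a n ρ β Y → ρ (toℕ a) + n ≤ Y →
    Exec (count a n) ρ β true (ρ [ toℕ a ≔ ρ (toℕ a) + n ]) β (n * visit Y + 1)
  Exec-count a zero ρ β Y le =
    Exec-post (λ i → sym (≔-id ρ (toℕ a) (sym (+-identityʳ _)) i)) (λ _ → refl) (Exec-exit true)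
  Exec-count a (suc n) ρ β Y le =
    Exec-weaken (≤-reflexive (sym (+-assoc (visit Y) (n * visit Y) 1)))
    (Exec-then (incr-at refl (≤-trans (m≤m+n _ _) le))
      (Exec-post (λ i → trans (≔-≔ ρ (toℕ a) _ _ i) (≔-value sum i)) (λ _ → refl)
        (Exec-count a n _ β Y (subst (_≤ Y) (sym sum) le))))
    where
    sum : (ρ [ toℕ a ≔ suc (ρ (toℕ a)) ]) (toℕ a) + n ≡ ρ (toℕ a) + suc n
    sum = trans (cong (_+ n) (≔-same ρ (toℕ a) _)) (sym (+-suc _ n))

  Exec-add : ∀ {m l} (p : l ≤ K) a (e : Exp m l) ρ β Y →
    l ≤ toℕ a → toℕ a < m → Fresh l ρ → (∀ i → ρ i ≤ Y) → ρ (toℕ a) + value ρ e ≤ Y →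
    Exec (add p a e) ρ β true (ρ [ toℕ a ≔ ρ (toℕ a) + value ρ e ]) β (addTime e Y)
  Exec-add p a (num n) ρ β Y l≤a a<m fr bd le = Exec-count a n ρ β Y le
  Exec-add {m} {suc l} p a (var r {v}) ρ β Y l<a a<m fr bd le =
    Exec-pre (λ i → sym (≔-id ρ (toℕ a) (sym (+-identityʳ _)) i))
    (Exec-loop (Fin.toℕ-fromℕ< p) refl (λ i → ρ [ toℕ a ≔ ρ (toℕ a) + i ]) (ρ (toℕ r)) Y
      (prim incr a) visit
      (<⇒≢ (<-trans l<a a<r)) (λ i → ≔-other ρ (toℕ a) _ (toℕ r) (λ e → <⇒≢ a<r (sym e)))
      (λ i → trans (≔-other ρ (toℕ a) _ l (<⇒≢ l<a)) (fr l ≤-refl)) (bd (toℕ r))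
      (λ i i<n → Exec-post (λ j → trans (≔-overwrite ρ (toℕ a) l _ i _ (<⇒≢ l<a) j)
                                        (≔-agree l refl (λ k _ → ≔-value
                                          (trans (cong suc (current i)) (sym (+-suc _ i))) k) j))
                           (λ _ → refl)
        (incr-at refl (subst (_≤ Y) (sym (current i))
          (≤-trans (+-monoʳ-≤ (ρ (toℕ a)) (<⇒≤ i<n)) le)))))
    where
    a<r : toℕ a < toℕ r
    a<r = <-≤-trans a<m (≤ᵇ⇒≤ m _ v)
    current : ∀ i → ((ρ [ toℕ a ≔ ρ (toℕ a) + i ]) [ l ≔ i ]) (toℕ a) ≡ ρ (toℕ a) + i
    current i = trans (≔-other _ l i (toℕ a) (λ e → <⇒≢ l<a (sym e))) (≔-same ρ (toℕ a) _)
  Exec-add p a (e ⊕ f) ρ β Y l≤a a<m fr bd le =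
    Exec-then (Exec-add p a e ρ β Y l≤a a<m fr bd le₁)
      (Exec-post (λ i → trans (≔-≔ ρ (toℕ a) _ _ i) (≔-value sum i)) (λ _ → refl)
        (Exec-add p a f _ β Y l≤a a<m (Fresh-≔ (toℕ a) l≤a fr) (≔-≤ bd le₁)
          (subst (_≤ Y) (sym sum) le)))
    where
    le₁ : ρ (toℕ a) + value ρ e ≤ Y
    le₁ = ≤-trans (+-monoʳ-≤ (ρ (toℕ a)) (m≤m+n _ _)) le
    ρ₁ : ℕ → ℕ
    ρ₁ = ρ [ toℕ a ≔ ρ (toℕ a) + value ρ e ]
    sum : ρ₁ (toℕ a) + value ρ₁ f ≡ ρ (toℕ a) + (value ρ e + value ρ f)
    sum = trans (cong₂ _+_ (≔-same ρ (toℕ a) _)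
                  (value-cong f (λ i m≤i → ≔-other ρ (toℕ a) _ i (λ e → <⇒≢ (<-≤-trans a<m m≤i) (sym e)))))
                (+-assoc (ρ (toℕ a)) _ _)
  Exec-add {m} {suc l} p a (_⊗_ e r {v}) ρ β Y l<a a<m fr bd le =
    Exec-pre (λ i → sym (≔-id ρ (toℕ a) (sym (+-identityʳ _)) i))
    (Exec-loop (Fin.toℕ-fromℕ< p) refl (λ i → ρ [ toℕ a ≔ ρ (toℕ a) + i * x ]) (ρ (toℕ r)) Y
      (add (<⇒≤ p) a e) (addTime e)
      (<⇒≢ (<-trans l<a a<r)) (λ i → ≔-other ρ (toℕ a) _ (toℕ r) (λ e → <⇒≢ a<r (sym e)))
      (λ i → trans (≔-other ρ (toℕ a) _ l (<⇒≢ l<a)) (fr l ≤-refl)) (bd (toℕ r))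
      (λ i i<n → Exec-post (λ j → trans (≔-overwrite ρ (toℕ a) l _ i _ (<⇒≢ l<a) j)
                                        (≔-agree l refl (λ k _ → ≔-value (sum i) k) j))
                           (λ _ → refl)
        (Exec-add (<⇒≤ p) a e _ β Y (<⇒≤ l<a) a<m
          (Fresh-≔ l ≤-refl (Fresh-≔ (toℕ a) (<⇒≤ l<a) (Fresh-weaken fr)))
          (≔-≤ (≔-≤ bd (≤-trans (below i (<⇒≤ i<n)) le)) (≤-trans (<⇒≤ i<n) (bd (toℕ r))))
          (subst (_≤ Y) (sym (sum i)) (≤-trans (below (suc i) i<n) le)))))
    where
    x : ℕ
    x = value ρ e
    a<r : toℕ a < toℕ r
    a<r = <-≤-trans a<m (≤ᵇ⇒≤ m _ v)
    below : ∀ i → i ≤ ρ (toℕ r) → ρ (toℕ a) + i * x ≤ ρ (toℕ a) + ρ (toℕ r) * x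
    below i h = +-monoʳ-≤ (ρ (toℕ a)) (*-monoˡ-≤ x h)
    σ : ℕ → ℕ → ℕ
    σ i = (ρ [ toℕ a ≔ ρ (toℕ a) + i * x ]) [ l ≔ i ]
    sum : ∀ i → σ i (toℕ a) + value (σ i) e ≡ ρ (toℕ a) + suc i * x
    sum i = trans (cong₂ _+_ (trans (≔-other _ l i (toℕ a) (λ e → <⇒≢ l<a (sym e))) (≔-same ρ (toℕ a) _))
              (value-cong e (λ j m≤j → trans (≔-other _ l i j (λ e → <⇒≢ (<-trans l<a (<-≤-trans a<m m≤j)) (sym e)))
                (≔-other ρ (toℕ a) _ j (λ e → <⇒≢ (<-≤-trans a<m m≤j) (sym e))))))
              (trans (+-assoc (ρ (toℕ a)) (i * x) x) (cong (ρ (toℕ a) +_) (+-comm (i * x) x)))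

  Exec-answer : ∀ {a l c ρ ρ′ β b Y U} → toℕ a ≡ l → ρ′ [ l ≔ 0 ] ≗ ρ → ρ′ l ≤ Y →
    Exec c ρ′ β b ρ′ β (U Y) → Exec (answer a c) ρ′ β b ρ β (answerTime U Y)
  Exec-answer {b = true} ea e le ex =
    Exec-then ex (Exec-then (Exec-post e (λ _ → refl) (clear-at ea le)) (Exec-exit true))
  Exec-answer {b = false} ea e le ex =
    Exec-else ex (Exec-then (Exec-post e (λ _ → refl) (clear-at ea le)) (Exec-exit false))

  value-≤ : ∀ {m l} (e : Exp m l) {ρ B} → (∀ i → ρ i ≤ B) → value ρ e ≤ maxValue e B
  value-≤ (num n) bd = ≤-refl
  value-≤ (var r) bd = bd (toℕ r)
  value-≤ (e ⊕ f) bd = +-mono-≤ (value-≤ e bd) (value-≤ f bd)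
  value-≤ (e ⊗ r) bd = *-mono-≤ (bd (toℕ r)) (value-≤ e bd)

  Exec-probe : ∀ {m l} (p : l ≤ K) {a k} (e : Exp m l) {c ρ β b B U} → toℕ a ≡ k →
    l ≤ k → k < m → ρ k ≡ 0 → Fresh l ρ → (∀ i → ρ i ≤ B) →
    Exec c (ρ [ k ≔ value ρ e ]) β b (ρ [ k ≔ value ρ e ]) β (U (B + maxValue e B)) →
    Exec (probe p a e c) ρ β b ρ β (probeTime e U B)
  Exec-probe p {a} {k} e {ρ = ρ} {β} {B = B} {U} refl l≤k k<m zero-k fr bd ex =
    Exec-then
      (Exec-post (≔-value (cong (_+ value ρ e) zero-k)) (λ _ → refl)
        (Exec-add p a e ρ β (B + maxValue e B) l≤k k<m fr (λ i → ≤-trans (bd i) (m≤m+n B _))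
          (+-mono-≤ (bd k) (value-≤ e bd))))
      (Exec-answer {U = U} refl (λ i → trans (≔-≔ ρ k _ 0 i) (≔-id ρ k zero-k i))
        (subst (_≤ B + maxValue e B) (sym (≔-same ρ k _)) (≤-trans (value-≤ e bd) (m≤n+m _ B))) ex)

module Execute (K : ℕ) (w : List Sym) where
  open Machine K
  open Language K
  open Execution K w
  open Evaluation K w

  -- Evaluation restores all registers and leaves the table alone, so that subformulas can be
  -- evaluated one after another and repeatedly.
  Verdict : ∀ {l} → l ≤ K → Form l → (ℕ → ℕ) → (ℕ → Bool) → ℕ → Set
  Verdict p φ ρ β B =
    ∃[ b ] (Reflects (⟦ φ ⟧ w β ρ) b × Exec (compile p φ) ρ β b ρ β (time φ B))

  -- A search standing at candidate `i`, with `d` candidates left, ends with the counter at `k`: the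
  -- bound if there is no witness, and otherwise a witness.
  Searched : ∀ {l} → suc l ≤ K → Fin K → Form l → (ℕ → ℕ) → (ℕ → Bool) → ℕ → ℕ → ℕ → Set
  Searched {l} p b φ ρ β B d i =
    ∃[ k ] (k ≤ ρ (toℕ b) ×
      (k ≡ ρ (toℕ b) × (∀ j → j < ρ (toℕ b) → ¬ ⟦ φ ⟧ w β (ρ [ l ≔ j ])) ⊎
       k < ρ (toℕ b) × ⟦ φ ⟧ w β (ρ [ l ≔ k ])) ×
      Exec (until (ite (prim (test (pebble b)) (fromℕ< p)) (exit true) (compile (<⇒≤ p) φ))
                  (prim incr (fromℕ< p)))
           (ρ [ l ≔ i ]) β true (ρ [ l ≔ k ]) β
           (d * ((visit B + time φ B) + visit B) + (visit B + (1 + time φ B))))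

  Exec-form : ∀ {l} (p : l ≤ K) (φ : Form l) ρ β B →
              Fresh l ρ → (∀ i → ρ i ≤ B) → Verdict p φ ρ β B

  Exec-any : ∀ {l} (p : suc l ≤ K) (b : Fin K) (φ : Form l) ρ β B → suc l ≤ toℕ b →
    Fresh (suc l) ρ → (∀ i → ρ i ≤ B) →
    ∀ d i → d + i ≡ ρ (toℕ b) → (∀ j → j < i → ¬ ⟦ φ ⟧ w β (ρ [ l ≔ j ])) →
    Searched p b φ ρ β B d i

  Exec-form {suc (suc l)} p (eq e f) ρ β B fr bd =
    _ , Reflects-⇔ sym sym (Dec.proof (value ρ f ≟ value ρ e)) ,
    Exec-probe (<⇒≤ (<⇒≤ p)) f {U = probeTime e visit} (Fin.toℕ-fromℕ< (<⇒≤ p)) ≤-refl (m<n⇒m<1+n (n<1+n l))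
      (fr l (m<n⇒m<1+n (n<1+n l))) (Fresh-weaken (Fresh-weaken fr)) bd
      (Exec-probe (<⇒≤ (<⇒≤ p)) e {U = visit} (Fin.toℕ-fromℕ< p) (n≤1+n l) ≤-refl
        (trans (≔-other ρ l _ (suc l) 1+n≢n) (fr (suc l) ≤-refl))
        (Fresh-≔ l ≤-refl (Fresh-weaken (Fresh-weaken fr)))
        (≔-≤ (λ i → ≤-trans (bd i) (m≤m+n B _)) (≤-trans (value-≤ f bd) (m≤n+m _ B)))
        (test-at (Fin.toℕ-fromℕ< p) (subst (_≤ _) (sym (≔-same _ (suc l) _))
            (≤-trans (value-≤ e (≔-≤ (λ i → ≤-trans (bd i) (m≤m+n B _)) (≤-trans (value-≤ f bd) (m≤n+m _ B))))
                     (m≤n+m _ (B + maxValue f B))))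
          (cong₂ _≡ᵇ_
            (trans (cong ((ρ [ l ≔ value ρ f ]) [ suc l ≔ _ ]) (Fin.toℕ-fromℕ< (<⇒≤ p)))
              (trans (≔-other (ρ [ l ≔ value ρ f ]) (suc l) _ l (1+n≢n ∘ sym)) (≔-same ρ l _)))
            (trans (≔-same (ρ [ l ≔ value ρ f ]) (suc l) _)
              (value-cong e (λ i le → ≔-other ρ l _ i (λ { refl → 1+n≰n (<⇒≤ le) })))))))
  Exec-form {suc l} p (bitAt e) ρ β B fr bd =
    _ , Reflects-true _ ,
    Exec-probe (<⇒≤ p) e {U = visit} (Fin.toℕ-fromℕ< p) ≤-refl ≤-refl (fr l ≤-refl) (Fresh-weaken fr) bd
      (test-at (Fin.toℕ-fromℕ< p) (subst (_≤ _) (sym (≔-same ρ l _)) (≤-trans (value-≤ e bd) (m≤n+m _ B)))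
        (cong β (≔-same ρ l _)))
  Exec-form {suc l} p (symAt s e) ρ β B fr bd =
    _ , Reflects-true _ ,
    Exec-probe (<⇒≤ p) e {U = visit} (Fin.toℕ-fromℕ< p) ≤-refl ≤-refl (fr l ≤-refl) (Fresh-weaken fr) bd
      (test-at (Fin.toℕ-fromℕ< p) (subst (_≤ _) (sym (≔-same ρ l _)) (≤-trans (value-≤ e bd) (m≤n+m _ B)))
        (cong (λ a → symbolAt w a s) (≔-same ρ l _)))
  Exec-form p (neg φ) ρ β B fr bd with Exec-form p φ ρ β B fr bd
  ... | true , ofʸ h , ex = false , ofⁿ (λ k → k h) , Exec-then ex (Exec-exit false)
  ... | false , ofⁿ h , ex = true , ofʸ h , Exec-else ex (Exec-exit true)
  Exec-form p (φ ∧ᶠ ψ) ρ β B fr bd with Exec-form p φ ρ β B fr bd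
  ... | false , ofⁿ h , ex =
    false , ofⁿ (h ∘ proj₁) , Exec-else ex (Exec-weaken (m≤n+m 1 _) (Exec-exit false))
  ... | true , ofʸ h , ex with Exec-form p ψ ρ β B fr bd
  ...   | b , h′ , ex′ = b , Reflects-⇔ (h ,_) proj₂ h′ , Exec-then ex (Exec-weaken (m≤m+n _ 1) ex′)
  Exec-form p (φ ∨ᶠ ψ) ρ β B fr bd with Exec-form p φ ρ β B fr bd
  ... | true , ofʸ h , ex = true , ofʸ (inj₁ h) , Exec-then ex (Exec-weaken (m≤m+n 1 _) (Exec-exit true))
  ... | false , ofⁿ h , ex with Exec-form p ψ ρ β B fr bd
  ...   | b , h′ , ex′ = b , Reflects-⇔ inj₂ (λ { (inj₁ k) → contradiction k h ; (inj₂ k) → k }) h′ ,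
                         Exec-else ex (Exec-weaken (m≤n+m _ 1) ex′)
  Exec-form {suc l} p (any b {v} φ) ρ β B fr bd
    with k , k≤ , found , ex ← Exec-any p b φ ρ β B (≤ᵇ⇒≤ (suc l) _ v) fr bd (ρ (toℕ b)) 0 (+-identityʳ _) (λ j ())
    = result found
    where
    l<b : l < toℕ b
    l<b = ≤ᵇ⇒≤ (suc l) _ v

    search : Exec _ ρ β true (ρ [ l ≔ k ]) β _
    search = Exec-pre (λ i → sym (≔-id ρ l (fr l ≤-refl) i))
      (Exec-weaken (+-monoˡ-≤ _ (*-monoˡ-≤ ((visit B + time φ B) + visit B) (bd (toℕ b)))) ex)

    k≤B : (ρ [ l ≔ k ]) l ≤ B
    k≤B = subst (_≤ B) (sym (≔-same ρ l k)) (≤-trans k≤ (bd (toℕ b)))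

    restore : (ρ [ l ≔ k ]) [ l ≔ 0 ] ≗ ρ
    restore i = trans (≔-≔ ρ l k 0 i) (≔-id ρ l (fr l ≤-refl) i)

    compare : state (ρ [ l ≔ k ]) β ((ρ [ l ≔ k ]) l) (pebble b) ≡ (ρ (toℕ b) ≡ᵇ k)
    compare = cong₂ _≡ᵇ_ (≔-other ρ l k (toℕ b) (λ e → <⇒≢ l<b (sym e))) (≔-same ρ l k)

    finishing : ∀ c → Exec (prim clear (fromℕ< p) ⨾ exit c) (ρ [ l ≔ k ]) β c ρ β (visit B + 1)
    finishing c = Exec-then (Exec-post restore (λ _ → refl) (clear-at (Fin.toℕ-fromℕ< p) k≤B)) (Exec-exit c)

    result : _ → Verdict p (any b {v} φ) ρ β B
    result (inj₁ (k≡ , none)) = false , ofⁿ (λ { (i , lt , h) → none i lt h }) ,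
      Exec-then search (Exec-then
        (test-at (Fin.toℕ-fromℕ< p) k≤B (trans compare (trans (cong (ρ (toℕ b) ≡ᵇ_) k≡) (≡ᵇ-refl (ρ (toℕ b))))))
        (finishing false))
    result (inj₂ (k< , h)) = true , ofʸ (k , k< , h) ,
      Exec-then search (Exec-else
        (test-at (Fin.toℕ-fromℕ< p) k≤B (trans compare (≢⇒≡ᵇ-false _ k (λ e → <⇒≢ k< (sym e)))))
        (finishing true))

  Exec-any {l} p b φ ρ β B l<b fr bd d i e none = go d e
    where
    i≤n : i ≤ ρ (toℕ b)
    i≤n = subst (i ≤_) e (m≤n+m i d)
    i≤B : (ρ [ l ≔ i ]) l ≤ B
    i≤B = subst (_≤ B) (sym (≔-same ρ l i)) (≤-trans i≤n (bd (toℕ b)))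
    compare : state (ρ [ l ≔ i ]) β ((ρ [ l ≔ i ]) l) (pebble b) ≡ (ρ (toℕ b) ≡ᵇ i)
    compare = cong₂ _≡ᵇ_ (≔-other ρ l i (toℕ b) (λ e → <⇒≢ l<b (sym e))) (≔-same ρ l i)

    go : ∀ d → d + i ≡ ρ (toℕ b) → Searched p b φ ρ β B d i
    go zero e = i , i≤n , inj₁ (e , λ j lt → none j (subst (j <_) (sym e) lt)) ,
      Exec-until-done (Exec-weaken (+-monoʳ-≤ (visit B) (m≤m+n 1 _))
        (Exec-then (test-at (Fin.toℕ-fromℕ< p) i≤B (trans compare (trans (cong (ρ (toℕ b) ≡ᵇ_) e) (≡ᵇ-refl (ρ (toℕ b))))))
                   (Exec-exit true)))
    go (suc d) e with Exec-form (<⇒≤ p) φ (ρ [ l ≔ i ]) β B (Fresh-≔ l ≤-refl (Fresh-weaken fr))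
                        (≔-≤ bd (≤-trans i≤n (bd (toℕ b))))
    ... | true , ofʸ h , ex = i , i≤n , inj₂ (i<n , h) ,
      Exec-until-done (Exec-weaken (≤-trans (+-monoʳ-≤ (visit B) (n≤1+n _))
          (m≤n+m (visit B + (1 + time φ B)) (suc d * ((visit B + time φ B) + visit B))))
        (Exec-else (test-at (Fin.toℕ-fromℕ< p) i≤B (trans compare (≢⇒≡ᵇ-false _ i (λ e → <⇒≢ i<n (sym e))))) ex))
      where
      i<n : i < ρ (toℕ b)
      i<n = subst (i <_) e (s≤s (m≤n+m i d))
    ... | false , ofⁿ h , ex
      with k , k≤ , found , ex′ ← Exec-any p b φ ρ β B l<b fr bd d (suc i) (trans (+-suc d i) e)
             (λ j lt → [ none j , (λ { refl → h }) ]′ (m≤n⇒m<n∨m≡n (s≤s⁻¹ lt)))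
      = k , k≤ , found ,
      Exec-weaken (≤-reflexive (sym (trans (+-assoc ((visit B + time φ B) + visit B) _ _) (+-assoc (visit B + time φ B) (visit B) _))))
        (Exec-until-step
          (Exec-else (test-at (Fin.toℕ-fromℕ< p) i≤B (trans compare (≢⇒≡ᵇ-false _ i (λ e → <⇒≢ i<n (sym e))))) ex)
          (Exec-post (λ j → trans (≔-≔ ρ l i _ j) (≔-value (cong suc (≔-same ρ l i)) j)) (λ _ → refl)
            (incr-at (Fin.toℕ-fromℕ< p) i≤B))
          ex′)
      where
      i<n : i < ρ (toℕ b)
      i<n = subst (i <_) e (s≤s (m≤n+m i d))

-- The program that fills the table and evaluates the answer

-- Registers F to 3 + F hold the bit under construction, the number of bits, an
-- auxiliary size, and the length of the input; C computes a bit from the earlier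
-- ones and V the answer from all of them.
module Program (F : ℕ)
  (sizeE : Language.Exp (4 + F) (3 + F) F) (bitsE : Language.Exp (4 + F) (2 + F) F)
  (C V : Language.Form (4 + F) F) where

  K : ℕ
  K = 4 + F

  open Machine K
  open Language K

  rT rP rM rN : Fin K
  rT = fromℕ< {F} (s≤s (m≤n+m F 3))
  rP = fromℕ< {1 + F} (s≤s (s≤s (m≤n+m F 2)))
  rM = fromℕ< {2 + F} (s≤s (s≤s (s≤s (m≤n+m F 1))))
  rN = fromℕ< {3 + F} (s≤s (s≤s (s≤s (s≤s (≤-refl {F})))))

  F≤K : F ≤ K
  F≤K = m≤n+m F 4

  ρN ρM ρP : ℕ → ℕ → ℕ
  ρN n = initial [ 3 + F ≔ n ]
  ρM n = ρN n [ 2 + F ≔ value (ρN n) sizeE ]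
  ρP n = ρM n [ 1 + F ≔ value (ρM n) bitsE ]

  bits : ℕ → ℕ
  bits n = value (ρM n) bitsE

  env : ℕ → ℕ → ℕ → ℕ
  env n t = ρP n [ F ≔ t ]

  measure fill program : Code
  -- `until` stops on true, hence the negated test. The first cell past the input has the length of
  -- the input as its position.
  measure = until (ite (prim (test filled) rN) (exit false) (exit true)) (prim incr rN)
  fill = until (prim (test (pebble rP)) rT)
               (ite (compile F≤K C) (prim mark rT) (exit true) ⨾ prim incr rT)
  program = measure ⨾ add F≤K rM sizeE ⨾ add F≤K rP bitsE ⨾ fill ⨾ compile F≤K V

  -- Bounds on all registers once the size, respectively the number of bits, has been computed.
  B₁ B₂ : ℕ → ℕ
  B₁ n = n + maxValue sizeE n
  B₂ n = B₁ n + maxValue bitsE (B₁ n)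

  measureTime roundTime fillTime programTime : ℕ → ℕ
  measureTime n = n * ((visit n + 1) + visit n) + (visit n + 1)
  roundTime B = visit B + ((time C B + visit B) + visit B)
  fillTime B = B * roundTime B + visit B
  programTime n =
    measureTime n + (addTime sizeE (B₁ n) + (addTime bitsE (B₂ n) + (fillTime (B₂ n) + time V (B₂ n))))

  Poly-programTime : Poly programTime
  Poly-programTime =
    Poly-+ (Poly-+ (Poly-* Poly-id (Poly-+ (Poly-+ Poly-visit (Poly-const 1)) Poly-visit))
                   (Poly-+ Poly-visit (Poly-const 1)))
    (Poly-+ (Poly-∘ (Poly-addTime sizeE) p₁)
    (Poly-+ (Poly-∘ (Poly-addTime bitsE) p₂)
    (Poly-+ (Poly-∘ {fillTime} (Poly-+ (Poly-* Poly-id (Poly-+ Poly-visit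
              (Poly-+ (Poly-+ (Poly-time C) Poly-visit) Poly-visit))) Poly-visit) p₂)
            (Poly-∘ (Poly-time V) p₂))))
    where
    p₁ : Poly B₁
    p₁ = Poly-+ Poly-id (Poly-maxValue sizeE)
    p₂ : Poly B₂
    p₂ = Poly-+ p₁ (Poly-∘ (Poly-maxValue bitsE) p₁)

  module _ (w : List Sym) where
    open Execution K w
    open Evaluation K w
    open Execute K w

    n P : ℕ
    n = length w
    P = bits n

    -- `β′` is the table as it stood when bit `t` was computed. Only its agreement with the final
    -- table below `t` is recorded, so a use of the table has to show that the bits it consults are
    -- earlier ones.
    Correct : (ℕ → Bool) → ℕ → Set
    Correct β t = ∃[ β′ ] ((∀ p → p < t → β′ p ≡ β p) × (β t ≡ true ⇔ ⟦ C ⟧ w β′ (env n t)))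

    Table : (ℕ → Bool) → Set
    Table β = ∀ t → t < P → Correct β t

    -- The second half says that bits not yet reached are unset, which makes omitting `mark` the
    -- same as writing false.
    Upto : ℕ → (ℕ → Bool) → Set
    Upto t β = (∀ s → s < t → Correct β s) × (∀ p → t ≤ p → β p ≡ false)

    toℕ-rT : toℕ rT ≡ F
    toℕ-rT = Fin.toℕ-fromℕ< (s≤s (m≤n+m F 3))
    toℕ-rP : toℕ rP ≡ 1 + F
    toℕ-rP = Fin.toℕ-fromℕ< (s≤s (s≤s (m≤n+m F 2)))
    toℕ-rM : toℕ rM ≡ 2 + F
    toℕ-rM = Fin.toℕ-fromℕ< (s≤s (s≤s (s≤s (m≤n+m F 1))))
    toℕ-rN : toℕ rN ≡ 3 + F
    toℕ-rN = Fin.toℕ-fromℕ< (s≤s (s≤s (s≤s (s≤s (≤-refl {F})))))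

    bound-N : ∀ {m} → m ≤ n → ∀ i → (initial [ 3 + F ≔ m ]) i ≤ n
    bound-N le = ≔-≤ (λ _ → z≤n) le

    sizeE-≤ : value (ρN n) sizeE ≤ maxValue sizeE n
    sizeE-≤ = value-≤ sizeE (bound-N ≤-refl)

    bound-M : ∀ i → ρM n i ≤ B₁ n
    bound-M = ≔-≤ (λ i → ≤-trans (bound-N ≤-refl i) (m≤m+n n _)) (≤-trans sizeE-≤ (m≤n+m _ n))

    P≤ : P ≤ B₂ n
    P≤ = ≤-trans (value-≤ bitsE bound-M) (m≤n+m _ (B₁ n))

    bound-P : ∀ i → ρP n i ≤ B₂ n
    bound-P = ≔-≤ (λ i → ≤-trans (bound-M i) (m≤m+n (B₁ n) _)) P≤

    fresh-N : Fresh F (ρN n)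
    fresh-N = Fresh-≔ (3 + F) (m≤n+m F 3) (λ _ _ → refl)
    fresh-M : Fresh F (ρM n)
    fresh-M = Fresh-≔ (2 + F) (m≤n+m F 2) fresh-N
    fresh-P : Fresh F (ρP n)
    fresh-P = Fresh-≔ (1 + F) (m≤n+m F 1) fresh-M

    ρM-unset : ρM n (1 + F) ≡ 0
    ρM-unset = trans (≔-other (ρN n) (2 + F) _ (1 + F) (<⇒≢ ≤-refl))
                     (≔-other initial (3 + F) n (1 + F) (<⇒≢ (n≤1+n (2 + F))))

    ρP-unset : ρP n F ≡ 0
    ρP-unset = trans (≔-other (ρM n) (1 + F) _ F (<⇒≢ ≤-refl))
               (trans (≔-other (ρN n) (2 + F) _ F (<⇒≢ (n≤1+n (1 + F))))
                      (≔-other initial (3 + F) n F (<⇒≢ (m≤n+m (suc F) 2))))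

    Exec-measure : Exec measure initial unmarked true (ρN n) unmarked (measureTime n)
    Exec-measure = Exec-pre (λ i → sym (≔-id initial (3 + F) refl i)) (from n 0 (+-identityʳ n))
      where
      at-N : ∀ m → m ≤ n → (initial [ 3 + F ≔ m ]) (3 + F) ≤ n
      at-N m le = subst (_≤ n) (sym (≔-same initial (3 + F) m)) le

      inside : ∀ m → state (initial [ 3 + F ≔ m ]) unmarked ((initial [ 3 + F ≔ m ]) (3 + F)) filled
                     ≡ (m <ᵇ n)
      inside m = cong (_<ᵇ n) (≔-same initial (3 + F) m)

      from : ∀ d i → d + i ≡ n → Exec measure (initial [ 3 + F ≔ i ]) unmarked true (ρN n) unmarked
               (d * ((visit n + 1) + visit n) + (visit n + 1))
      from zero i refl = Exec-until-done
        (Exec-else (test-at toℕ-rN (at-N i ≤-refl) (trans (inside i) (dec-false (i <? i) (<-irrefl refl))))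
                   (Exec-exit true))
      from (suc d) i e =
        Exec-weaken (≤-reflexive (sym (trans (+-assoc ((visit n + 1) + visit n) _ _) (+-assoc (visit n + 1) (visit n) _))))
        (Exec-until-step
          (Exec-then (test-at toℕ-rN (at-N i (<⇒≤ i<n)) (trans (inside i) (dec-true (i <? n) i<n)))
                     (Exec-exit false))
          (Exec-post (λ j → trans (≔-≔ initial (3 + F) i _ j) (≔-value (cong suc (≔-same initial (3 + F) i)) j))
                     (λ _ → refl) (incr-at toℕ-rN (at-N i (<⇒≤ i<n))))
          (from d (suc i) (trans (+-suc d i) e)))
        where
        i<n : i < n
        i<n = subst (i <_) e (s≤s (m≤n+m i d))

    Correct-extend : ∀ {β β′ s} → (∀ p → p ≤ s → β p ≡ β′ p) → Correct β s → Correct β′ s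
    Correct-extend {s = s} h (γ , agree , e) =
      γ , (λ p lt → trans (agree p lt) (h p (<⇒≤ lt))) ,
      mk⇔ (λ b → Equivalence.to e (trans (h s ≤-refl) b)) (λ c → trans (sym (h s ≤-refl)) (Equivalence.from e c))

    ∪-self : ∀ β t → (β ∪ t) t ≡ true
    ∪-self β t rewrite ≡ᵇ-refl t = refl

    ∪-other : ∀ β t p → p ≢ t → (β ∪ t) p ≡ β p
    ∪-other β t p ne rewrite ≢⇒≡ᵇ-false p t ne = refl

    Upto-mark : ∀ {t β} → Upto t β → ⟦ C ⟧ w β (env n t) → Upto (suc t) (β ∪ t)
    Upto-mark {t} {β} (done , rest) c =
      (λ s lt → [ (λ lt′ → Correct-extend (λ p le → sym (∪-other β t p (<⇒≢ (≤-<-trans le lt′)))) (done s lt′))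
                , (λ { refl → β , (λ p lt′ → sym (∪-other β t p (<⇒≢ lt′))) ,
                              mk⇔ (λ _ → c) (λ _ → ∪-self β t) }) ]′ (m≤n⇒m<n∨m≡n (s≤s⁻¹ lt))) ,
      (λ p le → trans (∪-other β t p (λ e → <⇒≢ le (sym e))) (rest p (<⇒≤ le)))

    Upto-skip : ∀ {t β} → Upto t β → ¬ ⟦ C ⟧ w β (env n t) → Upto (suc t) β
    Upto-skip {t} {β} (done , rest) c =
      (λ s lt → [ done s
                , (λ { refl → β , (λ _ _ → refl) ,
                              mk⇔ (λ b → contradiction (trans (sym b) (rest t ≤-refl)) λ ())
                                  (λ h → contradiction h c) }) ]′ (m≤n⇒m<n∨m≡n (s≤s⁻¹ lt))) ,
      (λ p le → rest p (<⇒≤ le))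

    Exec-fill : ∀ d t β → d + t ≡ P → Upto t β →
      ∃[ β′ ] (Upto P β′ × Exec fill (env n t) β true (env n P) β′ (d * roundTime (B₂ n) + visit (B₂ n)))
    Exec-fill d t β e up = go d e
      where
      B : ℕ
      B = B₂ n
      t≤P : t ≤ P
      t≤P = subst (t ≤_) e (m≤n+m t d)
      at-T : env n t F ≤ B
      at-T = subst (_≤ B) (sym (≔-same (ρP n) F t)) (≤-trans t≤P P≤)
      compare : ∀ β → state (env n t) β (env n t F) (pebble rP) ≡ (P ≡ᵇ t)
      compare β = cong₂ _≡ᵇ_ (trans (cong (env n t) toℕ-rP)
                   (trans (≔-other (ρP n) F t (1 + F) 1+n≢n) (≔-same (ρM n) (1 + F) P)))
                 (≔-same (ρP n) F t)
      next : ∀ {β} → Exec (prim incr rT) (env n t) β true (env n (suc t)) β (visit B)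
      next = Exec-post (λ j → trans (≔-≔ (ρP n) F t _ j) (≔-value (cong suc (≔-same (ρP n) F t)) j))
                       (λ _ → refl) (incr-at toℕ-rT at-T)

      go : ∀ d → d + t ≡ P →
        ∃[ β′ ] (Upto P β′ × Exec fill (env n t) β true (env n P) β′ (d * roundTime B + visit B))
      go zero refl = β , up , Exec-until-done (test-at toℕ-rT at-T (trans (compare β) (≡ᵇ-refl t)))
      go (suc d) e with Exec-form F≤K C (env n t) β B (Fresh-≔ F ≤-refl fresh-P)
                          (≔-≤ bound-P (≤-trans t≤P P≤))
      ... | b , verdict , ex = proceed b verdict ex
        where
        t<P : t < P
        t<P = subst (t <_) e (s≤s (m≤n+m t d))

        enter : Exec (prim (test (pebble rP)) rT) (env n t) β false (env n t) β (visit B)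
        enter = test-at toℕ-rT at-T (trans (compare β) (≢⇒≡ᵇ-false P t (λ e → <⇒≢ t<P (sym e))))

        round : ∀ {β₁} → Upto (suc t) β₁ →
          Exec (ite (compile F≤K C) (prim mark rT) (exit true)) (env n t) β true (env n t) β₁
               (time C B + visit B) →
          ∃[ β′ ] (Upto P β′ × Exec fill (env n t) β true (env n P) β′ (suc d * roundTime B + visit B))
        round {β₁} up₁ ex with β′ , up′ , ex′ ← Exec-fill d (suc t) β₁ (trans (+-suc d t) e) up₁ =
          β′ , up′ ,
          Exec-weaken (≤-reflexive (sym (trans (+-assoc (roundTime B) (d * roundTime B) (visit B))
                                               (+-assoc (visit B) _ _))))
            (Exec-until-step enter (Exec-then ex next) ex′)

        proceed : ∀ b → Reflects (⟦ C ⟧ w β (env n t)) b →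
          Exec (compile F≤K C) (env n t) β b (env n t) β (time C B) →
          ∃[ β′ ] (Upto P β′ × Exec fill (env n t) β true (env n P) β′ (suc d * roundTime B + visit B))
        proceed true (ofʸ c) ex = round (Upto-mark up c) (Exec-then ex
          (Exec-weaken (visit-mono (subst (λ r → env n t r ≤ B) (sym toℕ-rT) at-T))
            (Exec-post (λ _ → refl) (λ p → cong (λ a → (β ∪ a) p)
              (trans (cong (env n t) toℕ-rT) (≔-same (ρP n) F t))) (Exec-mark rT (env n t) β))))
        proceed false (ofⁿ c) ex = round (Upto-skip up c)
          (Exec-else ex (Exec-weaken (m≤n⇒m≤o+n (2 * B) (s≤s z≤n)) (Exec-exit true)))

    Exec-program : ∃[ β ] ∃[ b ] (Table β × Reflects (⟦ V ⟧ w β (env n P)) b ×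
      Exec program initial unmarked b (env n P) β (programTime n))
    Exec-program
      with β , (table , _) , ex ← Exec-fill P 0 unmarked (+-identityʳ P) ((λ s ()) , (λ _ _ → refl))
      with b , verdict , ex′ ← Exec-form F≤K V (env n P) β (B₂ n) (Fresh-≔ F ≤-refl fresh-P)
                                 (≔-≤ bound-P P≤)
      = β , b , table , verdict ,
        Exec-then Exec-measure (Exec-then compute-M (Exec-then compute-P (Exec-then
          (Exec-pre (λ i → sym (≔-id (ρP n) F ρP-unset i))
            (Exec-weaken (+-monoˡ-≤ (visit (B₂ n)) (*-monoˡ-≤ (roundTime (B₂ n)) P≤)) ex)) ex′)))
      where
      compute-M : Exec (add F≤K rM sizeE) (ρN n) unmarked true (ρM n) unmarked (addTime sizeE (B₁ n))
      compute-M = Exec-post (λ j → trans (cong (λ r → (ρN n [ r ≔ ρN n r + value (ρN n) sizeE ]) j) toℕ-rM)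
                                         (≔-value (cong (_+ value (ρN n) sizeE) unset) j)) (λ _ → refl)
        (Exec-add F≤K rM sizeE (ρN n) unmarked (B₁ n)
          (subst (F ≤_) (sym toℕ-rM) (m≤n+m F 2)) (subst (_< 3 + F) (sym toℕ-rM) ≤-refl) fresh-N
          (λ i → ≤-trans (bound-N ≤-refl i) (m≤m+n n _))
          (+-mono-≤ (bound-N ≤-refl _) sizeE-≤))
        where
        unset : ρN n (2 + F) ≡ 0
        unset = ≔-other initial (3 + F) n (2 + F) (<⇒≢ ≤-refl)
      compute-P : Exec (add F≤K rP bitsE) (ρM n) unmarked true (ρP n) unmarked (addTime bitsE (B₂ n))
      compute-P = Exec-post (λ j → trans (cong (λ r → (ρM n [ r ≔ ρM n r + P ]) j) toℕ-rP)
                                         (≔-value (cong (_+ P) ρM-unset) j)) (λ _ → refl)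
        (Exec-add F≤K rP bitsE (ρM n) unmarked (B₂ n)
          (subst (F ≤_) (sym toℕ-rP) (m≤n+m F 1)) (subst (_< 2 + F) (sym toℕ-rP) ≤-refl) fresh-M
          (λ i → ≤-trans (bound-M i) (m≤m+n (B₁ n) _))
          (+-mono-≤ (bound-M _) (value-≤ bitsE bound-M)))

  open Compile K

  ^-distrib-* : ∀ a b k → (a * b) ^ k ≡ a ^ k * b ^ k
  ^-distrib-* a b zero = refl
  ^-distrib-* a b (suc k) = trans (cong (a * b *_) (^-distrib-* a b k)) ([m*n]*[o*p]≡[m*o]*[n*p] a b (a ^ k) (b ^ k))

  -- For n ≥ 1 this is 2 + n ≤ 3n; the additive constant covers n = 0.
  pow-bound : ∀ k n → (2 + n) ^ k ≤ 3 ^ k * n ^ k + 3 ^ k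
  pow-bound k zero = ≤-trans (^-monoˡ-≤ k (n≤1+n 2)) (m≤n+m (3 ^ k) _)
  pow-bound k n@(suc m) = ≤-trans (^-monoˡ-≤ k triple)
    (≤-trans (≤-reflexive (^-distrib-* 3 n k)) (m≤m+n (3 ^ k * n ^ k) (3 ^ k)))
    where
    triple : 2 + n ≤ 3 * n
    triple = +-mono-≤ (s≤s (z≤n {m})) (+-mono-≤ (s≤s (z≤n {m})) (≤-reflexive (sym (+-identityʳ n))))

  Decider : Set
  Decider = Σ TM λ M → ∃[ c ] ∃[ d ] (∀ w →
    ∃[ b ] (run M (c * length w ^ d + c) (initConfig M w) ≡ halted b ×
      ∃[ β ] (Table w β × Reflects (⟦ V ⟧ w β (env (length w) (bits (length w)))) b)))

  decides : Decider
  decides = within (Poly-+ {λ _ → 2} (Poly-const 2) Poly-programTime)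
    where
    within : Poly (λ n → 2 + programTime n) → Decider
    within (k , bound) = machine program , 3 ^ k , k , λ w →
      let β , b , table , verdict , ex = Exec-program w in
      b , Exec-machine w ex (3 ^ k * length w ^ k + 3 ^ k) (≤-trans (bound (length w)) (pow-bound k (length w))) ,
      β , table , verdict

-- Distance and parity on the integer line

open import Data.Integer using (+_; -[1+_])

odd : ℕ → Bool
odd zero = false
odd (suc n) = not (odd n)

odd-+ : ∀ m n → odd (m + n) ≡ odd m xor odd n
odd-+ zero n = refl
odd-+ (suc m) n rewrite odd-+ m n with odd m
... | true = not-involutive (odd n)
... | false = refl

odd-double : ∀ n → odd (n + n) ≡ false
odd-double n rewrite odd-+ n n with odd n
... | true = refl
... | false = refl

xor-cancelˡ : ∀ b {c d} → b xor c ≡ b xor d → c ≡ d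
xor-cancelˡ true = not-injective
xor-cancelˡ false e = e

not-odd⇒double : ∀ n → odd n ≡ false → ∃[ c ] (n ≡ c + c)
not-odd⇒double zero e = 0 , refl
not-odd⇒double (suc (suc n)) e
  with c , refl ← not-odd⇒double n (trans (sym (not-involutive (odd n))) e) = suc c , cong suc (sym (+-suc c c))

same-parity : ∀ {m n} → m ≤ n → odd m ≡ odd n → ∃[ c ] (n ≡ m + (c + c))
same-parity {m} le e with k , refl ← m≤n⇒∃[o]m+o≡n le
  with c , refl ← not-odd⇒double k (sym (xor-cancelˡ (odd m) (trans (xor-identityʳ (odd m)) (trans e (odd-+ m k))))) = c , refl

-- Walking w steps of ±1 from u can end in v.
Con : ℕ → ℤ → ℤ → Set
Con w u v = ∃[ i ] ∃[ k ] (i + k ≡ w × u ℤ.+ (+ i) ≡ v ℤ.+ (+ k))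

open ℤ.+-*-Solver using (solve; _:+_; _:-_; :-_; _:=_; con)

Con-refl : ∀ u → Con 0 u u
Con-refl u = 0 , 0 , refl , refl

Con-sym : ∀ {w u v} → Con w u v → Con w v u
Con-sym (i , k , e , f) = k , i , trans (+-comm k i) e , sym f

Con-trans : ∀ {a b u v t} → Con a u v → Con b v t → Con (a + b) u t
Con-trans {u = u} {v} {t} (i , k , refl , f) (i′ , k′ , refl , f′) =
  i + i′ , k + k′ , +-interchange i i′ k k′ , (let open ≡-Reasoning in begin
    u ℤ.+ (+ i ℤ.+ + i′)          ≡⟨ ℤ.+-assoc u (+ i) (+ i′) ⟨
    u ℤ.+ + i ℤ.+ + i′            ≡⟨ cong (λ d → d ℤ.+ + i′) f ⟩
    v ℤ.+ + k ℤ.+ + i′            ≡⟨ solve 3 (λ v k i → v :+ k :+ i := v :+ i :+ k) refl v (+ k) (+ i′) ⟩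
    v ℤ.+ + i′ ℤ.+ + k            ≡⟨ cong (λ d → d ℤ.+ + k) f′ ⟩
    t ℤ.+ + k′ ℤ.+ + k            ≡⟨ solve 3 (λ t k′ k → t :+ k′ :+ k := t :+ (k :+ k′)) refl t (+ k′) (+ k) ⟩
    t ℤ.+ (+ k ℤ.+ + k′)          ∎)

Con-double : ∀ c {w u v} → Con w u v → Con (w + (c + c)) u v
Con-double c {u = u} {v} (i , k , refl , f) =
  i + c , k + c , +-interchange i c k c , (let open ≡-Reasoning in begin
    u ℤ.+ (+ i ℤ.+ + c)  ≡⟨ ℤ.+-assoc u (+ i) (+ c) ⟨
    u ℤ.+ + i ℤ.+ + c    ≡⟨ cong (λ d → d ℤ.+ + c) f ⟩
    v ℤ.+ + k ℤ.+ + c    ≡⟨ ℤ.+-assoc v (+ k) (+ c) ⟩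
    v ℤ.+ (+ k ℤ.+ + c)  ∎)

Con-closed : ∀ {w u} → Con w u u → odd w ≡ false
Con-closed {u = u} (i , k , refl , f)
  with refl ← ℤ.+-injective (ℤ-+-cancelˡ u (+ i) (+ k) f) = odd-double i

Con-0 : ∀ {u v} → Con 0 u v → u ≡ v
Con-0 {u} {v} (zero , zero , refl , f) = trans (sym (ℤ.+-identityʳ u)) (trans f (ℤ.+-identityʳ v))

Con-weaken : ∀ {a b u v} → a ≤ b → odd a ≡ odd b → Con a u v → Con b u v
Con-weaken {u = u} {v} le e x with c , refl ← same-parity le e = Con-double c {u = u} {v} x

Adj⇒Con : ∀ {u v} → Adj u v → Con 1 u v
Adj⇒Con {u} {v} adj with u ℤ.- v in eq
... | + 1 = 0 , 1 , refl , (let open ≡-Reasoning in begin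
  u ℤ.+ + 0           ≡⟨ solve 2 (λ u v → u :+ con (+ 0) := v :+ (u :- v)) refl u v ⟩
  v ℤ.+ (u ℤ.- v)     ≡⟨ cong (λ d → v ℤ.+ d) eq ⟩
  v ℤ.+ + 1           ∎)
... | -[1+ 0 ] = 1 , 0 , refl , (let open ≡-Reasoning in begin
  u ℤ.+ + 1                ≡⟨ solve 2 (λ u v → u :+ con (+ 1) := v :+ (u :- v) :+ con (+ 1)) refl u v ⟩
  v ℤ.+ (u ℤ.- v) ℤ.+ + 1  ≡⟨ cong (λ d → v ℤ.+ d ℤ.+ + 1) eq ⟩
  v ℤ.+ -[1+ 0 ] ℤ.+ + 1   ≡⟨ solve 1 (λ v → v :+ con (-[1+ 0 ]) :+ con (+ 1) := v :+ con (+ 0)) refl v ⟩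
  v ℤ.+ + 0                ∎)

Con⇒Adj : ∀ {u v} → Con 1 u v → Adj u v
Con⇒Adj {u} {v} (zero , suc zero , refl , f) = cong ℤ.∣_∣ (let open ≡-Reasoning in begin
  u ℤ.- v            ≡⟨ solve 2 (λ u v → u :- v := (u :+ con (+ 0)) :- v) refl u v ⟩
  u ℤ.+ + 0 ℤ.- v    ≡⟨ cong (λ d → d ℤ.- v) f ⟩
  v ℤ.+ + 1 ℤ.- v    ≡⟨ solve 1 (λ v → v :+ con (+ 1) :- v := con (+ 1)) refl v ⟩
  + 1                ∎)
Con⇒Adj {u} {v} (suc zero , zero , refl , f) = cong ℤ.∣_∣ (let open ≡-Reasoning in begin
  u ℤ.- v                 ≡⟨ solve 2 (λ u v → u :- v := u :+ con (+ 1) :- (v :+ con (+ 1))) refl u v ⟩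
  u ℤ.+ + 1 ℤ.- (v ℤ.+ + 1) ≡⟨ cong (λ d → d ℤ.- (v ℤ.+ + 1)) f ⟩
  v ℤ.+ + 0 ℤ.- (v ℤ.+ + 1) ≡⟨ solve 1 (λ v → v :+ con (+ 0) :- (v :+ con (+ 1)) := con (-[1+ 0 ])) refl v ⟩
  -[1+ 0 ]                ∎)

-- A point with a larger point within the same reach of u is not extreme: one of
-- its steps can be dropped.
Con-below : ∀ {a u z z′} → z ℤ.< z′ → Con a u z → Con a u z′ →
            ∃[ i ] ∃[ k ] (i + suc k ≡ a × u ℤ.+ + i ≡ z ℤ.+ + suc k)
Con-below lt (i , suc k , e , f) _ = i , k , e , f
Con-below {a} {u} {z} {z′} lt (i , zero , refl , f) (i′ , k′ , e , f′) =
  contradiction (begin-strict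
    z ℤ.+ + 0      <⟨ ℤ.+-monoˡ-< (+ 0) lt ⟩
    z′ ℤ.+ + 0     ≤⟨ ℤ.+-monoʳ-≤ z′ (ℤ.+≤+ z≤n) ⟩
    z′ ℤ.+ + k′    ≡⟨ f′ ⟨
    u ℤ.+ + i′     ≤⟨ ℤ.+-monoʳ-≤ u (ℤ.+≤+ (≤-trans (m≤m+n i′ k′) (≤-reflexive (trans e (+-identityʳ i))))) ⟩
    u ℤ.+ + i      ≡⟨ f ⟩
    z ℤ.+ + 0      ∎) (ℤ.<-irrefl refl)
  where open ℤ.≤-Reasoning

-- The smaller point `z` is the right end of neither interval, so the ways from `u` and from `v` to
-- it each contain a step down. Without these two steps both ways meet in z + 1.
Con-pair-ordered : ∀ {a b w u v z z′} → z ℤ.< z′ → a + b ≡ 2 + w →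
  Con a u z → Con a u z′ → Con b v z → Con b v z′ → Con w u v
Con-pair-ordered {w = w} {u} {v} {z} lt e x x′ y y′
  with i , k , refl , f ← Con-below {u = u} {z} lt x x′ | i′ , k′ , refl , f′ ← Con-below {u = v} {z} lt y y′ =
  i + k′ , k + i′ , suc-injective (suc-injective (trans (sym shuffle) e)) , (let open ≡-Reasoning in begin
    u ℤ.+ (+ i ℤ.+ + k′)                  ≡⟨ ℤ.+-assoc u (+ i) (+ k′) ⟨
    u ℤ.+ + i ℤ.+ + k′                    ≡⟨ cong (λ d → d ℤ.+ + k′) f ⟩
    z ℤ.+ (+ 1 ℤ.+ + k) ℤ.+ + k′          ≡⟨ solve 3 (λ z k k′ → z :+ (con (+ 1) :+ k) :+ k′ := z :+ (con (+ 1) :+ k′) :+ k) refl z (+ k) (+ k′) ⟩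
    z ℤ.+ (+ 1 ℤ.+ + k′) ℤ.+ + k          ≡⟨ cong (λ d → d ℤ.+ + k) f′ ⟨
    v ℤ.+ + i′ ℤ.+ + k                    ≡⟨ solve 3 (λ v i k → v :+ i :+ k := v :+ (k :+ i)) refl v (+ i′) (+ k) ⟩
    v ℤ.+ (+ k ℤ.+ + i′)                  ∎)
  where
  shuffle : (i + suc k) + (i′ + suc k′) ≡ 2 + ((i + k′) + (k + i′))
  shuffle = ℕ-solve 4 (λ i k i′ k′ → (i ⊹ (con′ 1 ⊹ k)) ⊹ (i′ ⊹ (con′ 1 ⊹ k′)) ≗′ con′ 2 ⊹ ((i ⊹ k′) ⊹ (k ⊹ i′))) refl i k i′ k′
    where open ℕ.+-*-Solver using () renaming (solve to ℕ-solve; _:+_ to _⊹_; _:=_ to _≗′_; con to con′)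

Con-pair : ∀ {a b w u v z z′} → z ≢ z′ → a + b ≡ 2 + w →
  Con a u z → Con a u z′ → Con b v z → Con b v z′ → Con w u v
Con-pair {u = u} {v} {z} {z′} ne e x x′ y y′ with ℤ.<-cmp z z′
... | tri< lt _ _ = Con-pair-ordered {u = u} {v} lt e x x′ y y′
... | tri≈ _ eq _ = contradiction eq ne
... | tri> _ _ gt = Con-pair-ordered {u = u} {v} gt e x′ x y′ y

-- Were i > b, then k < a, and v - b = u + i - k - b would exceed u - a.
left-end-≤ : ∀ {a b i k u v} → v ℤ.- + b ℤ.≤ u ℤ.- + a → i + k ≡ a + b →
             u ℤ.+ + i ≡ v ℤ.+ + k → i ≤ b
left-end-≤ {a} {b} {i} {k} {u} {v} le e f = ≮⇒≥ λ b<i →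
  ℤ.<⇒≱ (ℤ.+-monoʳ-< u (ℤ.+<+ (+-mono-< b<i (k<a b<i)))) bound
  where
  k<a : b < i → k < a
  k<a b<i = +-cancelʳ-< b k a (<-≤-trans (+-monoʳ-< k b<i) (≤-reflexive (trans (+-comm k i) e)))
  open ℤ.≤-Reasoning
  bound : u ℤ.+ + (i + a) ℤ.≤ u ℤ.+ + (b + k)
  bound = begin
    u ℤ.+ (+ i ℤ.+ + a)                   ≡⟨ ℤ.+-assoc u (+ i) (+ a) ⟨
    u ℤ.+ + i ℤ.+ + a                     ≡⟨ cong (λ d → d ℤ.+ + a) f ⟩
    v ℤ.+ + k ℤ.+ + a                     ≡⟨ solve 4 (λ v k a b → v :+ k :+ a := v :- b :+ (a :+ (b :+ k))) refl v (+ k) (+ a) (+ b) ⟩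
    v ℤ.- + b ℤ.+ (+ a ℤ.+ (+ b ℤ.+ + k)) ≤⟨ ℤ.+-monoˡ-≤ (+ a ℤ.+ (+ b ℤ.+ + k)) le ⟩
    u ℤ.- + a ℤ.+ (+ a ℤ.+ (+ b ℤ.+ + k)) ≡⟨ solve 4 (λ u k a b → u :- a :+ (a :+ (b :+ k)) := u :+ (b :+ k)) refl u (+ k) (+ a) (+ b) ⟩
    u ℤ.+ (+ b ℤ.+ + k)                   ∎

left-end-eq : ∀ {a b i k j u v} → i + k ≡ a + b → u ℤ.+ + i ≡ v ℤ.+ + k → i + j ≡ b →
              v ℤ.+ + j ≡ u ℤ.- + a ℤ.+ + i
left-end-eq {a} {i = i} {k} {j} {u} {v} e f refl = let open ≡-Reasoning in begin
  v ℤ.+ + j                                  ≡⟨ solve 3 (λ v k j → v :+ j := v :+ k :+ j :- k) refl v (+ k) (+ j) ⟩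
  v ℤ.+ + k ℤ.+ + j ℤ.- + k                  ≡⟨ cong (λ t → t ℤ.+ + j ℤ.- + k) f ⟨
  u ℤ.+ + i ℤ.+ + j ℤ.- + k                  ≡⟨ solve 5 (λ u i j k a → u :+ i :+ j :- k := u :- a :+ (a :+ (i :+ j)) :- k) refl u (+ i) (+ j) (+ k) (+ a) ⟩
  u ℤ.- + a ℤ.+ + (a + (i + j)) ℤ.- + k      ≡⟨ cong (λ t → u ℤ.- + a ℤ.+ + t ℤ.- + k) e ⟨
  u ℤ.- + a ℤ.+ (+ i ℤ.+ + k) ℤ.- + k        ≡⟨ solve 4 (λ u i k a → u :- a :+ (i :+ k) :- k := u :- a :+ i) refl u (+ i) (+ k) (+ a) ⟩
  u ℤ.- + a ℤ.+ + i                          ∎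

-- Helly's theorem on the line, for two intervals: if they meet, the larger left end lies in both.
-- The parities fit because a + b has the parity of the distance.
Con-left-end : ∀ {a b u v} → v ℤ.- + b ℤ.≤ u ℤ.- + a → Con (a + b) u v → Con b v (u ℤ.- + a)
Con-left-end {a} {b} {u} {v} le (i , k , e , f)
  with j , refl ← m≤n⇒∃[o]m+o≡n (left-end-≤ {a} {b} {i} {k} {u} {v} le e f) =
  j , i , +-comm j i , left-end-eq {a} {i = i} {k} {j} {u} {v} e f refl

suc-both : ∀ {i k u v} → u ℤ.+ + i ≡ v ℤ.+ + k → u ℤ.+ + suc i ≡ v ℤ.+ + suc k
suc-both {i} {k} {u} {v} f = let open ≡-Reasoning in begin
  u ℤ.+ (+ 1 ℤ.+ + i)  ≡⟨ solve 2 (λ u i → u :+ (con (+ 1) :+ i) := con (+ 1) :+ (u :+ i)) refl u (+ i) ⟩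
  + 1 ℤ.+ (u ℤ.+ + i)  ≡⟨ cong (λ d → + 1 ℤ.+ d) f ⟩
  + 1 ℤ.+ (v ℤ.+ + k)  ≡⟨ solve 2 (λ v k → v :+ (con (+ 1) :+ k) := con (+ 1) :+ (v :+ k)) refl v (+ k) ⟨
  v ℤ.+ (+ 1 ℤ.+ + k)  ∎

-- The slack of 2 leaves room for the next point of equal parity. `suc-both` spends it on a detour,
-- which brings the length of the way from `u` to `v` up to a + b.
Con-left-end₂ : ∀ {a b w u v} → v ℤ.- + b ℤ.≤ u ℤ.- + a → a + b ≡ 2 + w → Con w u v →
                Con b v (u ℤ.- + a) × Con b v (u ℤ.- + a ℤ.+ + 2)
Con-left-end₂ {a} {b} {u = u} {v} le g (i , k , refl , f)
  with e ← trans (cong suc (+-suc i k)) (sym g) | f′ ← suc-both {i} {k} {u} {v} f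
  with j , refl ← m≤n⇒∃[o]m+o≡n (left-end-≤ {a} {b} {suc i} {suc k} {u} {v} le e f′) =
  (j , suc i , +-comm j (suc i) , left-end-eq {a} {i = suc i} {suc k} {j} {u} {v} e f′ refl) ,
  (suc j , i , trans (sym (+-suc j i)) (+-comm j (suc i)) , (let open ≡-Reasoning in begin
    v ℤ.+ (+ 1 ℤ.+ + j)                    ≡⟨ solve 2 (λ v j → v :+ (con (+ 1) :+ j) := con (+ 1) :+ (v :+ j)) refl v (+ j) ⟩
    + 1 ℤ.+ (v ℤ.+ + j)                    ≡⟨ cong (λ d → + 1 ℤ.+ d) (left-end-eq {a} {i = suc i} {suc k} {j} {u} {v} e f′ refl) ⟩
    + 1 ℤ.+ (u ℤ.- + a ℤ.+ (+ 1 ℤ.+ + i))  ≡⟨ solve 2 (λ p i → con (+ 1) :+ (p :+ (con (+ 1) :+ i)) := p :+ con (+ 2) :+ i) refl (u ℤ.- + a) (+ i) ⟩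
    u ℤ.- + a ℤ.+ + 2 ℤ.+ + i              ∎))

argmax : ∀ {A : Set} {P : A → Set} (P? : ∀ a → Dec (P a)) (f : A → ℤ) (xs : List A) →
         (∀ a → a ∈ xs → ¬ P a) ⊎ ∃[ m ] (P m × (∀ a → a ∈ xs → P a → f a ℤ.≤ f m))
argmax P? f [] = inj₁ λ a ()
argmax P? f (x ∷ xs) with P? x | argmax P? f xs
... | no ¬p | inj₁ none = inj₁ λ { a (here refl) → ¬p ; a (there i) → none a i }
... | yes p | inj₁ none =
  inj₂ (x , p , λ { a (here refl) _ → ℤ.≤-refl ; a (there i) q → contradiction q (none a i) })
... | no ¬p | inj₂ (m , q , max) =
  inj₂ (m , q , λ { a (here refl) p → contradiction p ¬p ; a (there i) → max a i })
... | yes p | inj₂ (m , q , max) with ℤ.≤-total (f x) (f m)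
...   | inj₁ le = inj₂ (m , q , λ { a (here refl) _ → le ; a (there i) → max a i })
...   | inj₂ le = inj₂ (x , p , λ { a (here refl) _ → ℤ.≤-refl ; a (there i) r → ℤ.≤-trans (max a i r) le })

-- Elimination of the quantified variables

-- What an elimination takes off the sum of two radii: constraints fix the parity of a value, so two
-- values are at least 2 apart.
gap : Quant → ℕ
gap ex1 = 0
gap ex2 = 2

gap-even : ∀ q → odd (gap q) ≡ false
gap-even ex1 = refl
gap-even ex2 = refl

update-same : ∀ ρ j z → (ρ [ j ↦ z ]) j ≡ z
update-same ρ j z rewrite ≡ᵇ-refl j = refl

update-below : ∀ ρ j z {x} → x < j → (ρ [ j ↦ z ]) x ≡ ρ x
update-below ρ j z {x} lt rewrite ≢⇒≡ᵇ-false x j (<⇒≢ lt) = refl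

module Graph (as : List (ℕ × ℕ)) where

  Edge : ℕ → ℕ → Set
  Edge u v = (u , v) ∈ as ⊎ (v , u) ∈ as

  Edge-sym : ∀ {u v} → Edge u v → Edge v u
  Edge-sym = Data.Sum.swap

  data Walk : ℕ → ℕ → ℕ → Set where
    nil : ∀ {x} → Walk 0 x x
    _▹_ : ∀ {w x u y} → Walk w x u → Edge u y → Walk (suc w) x y

  _++ʷ_ : ∀ {a b x y z} → Walk a x y → Walk b y z → Walk (b + a) x z
  p ++ʷ nil = p
  p ++ʷ (q ▹ e) = (p ++ʷ q) ▹ e

  Walk-sym : ∀ {w x y} → Walk w x y → Walk w y x
  Walk-sym nil = nil
  Walk-sym {suc w} {x} {y} (p ▹ e) =
    subst (λ n → Walk n y x) (+-comm w 1) ((nil ▹ Edge-sym e) ++ʷ Walk-sym p)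

  split : ∀ {x y} i k → Walk (k + i) x y → ∃[ v ] (Walk i x v × Walk k v y)
  split i zero p = _ , p , nil
  split i (suc k) (p ▹ e) with v , p₁ , p₂ ← split i k p = v , p₁ , p₂ ▹ e

  -- Tab qs j lists the facts Con w (ρ x) (ρ y), x , y < j, that the formula
  -- quantified by qs from variable j on enforces on an assignment ρ of the earlier
  -- variables. Two values for variable j require its interval to have length at least 2.
  module _ (M : ℕ) where
    Tab : List Quant → ℕ → ℕ → ℕ → ℕ → Set
    Tab [] j w x y = Walk w x y
    Tab (q ∷ qs) j w x y = Tab qs (suc j) w x y ⊎
      (x < j × y < j × ∃[ a ] ∃[ b ] (a < M × b < M ×
        Tab qs (suc j) a x j × Tab qs (suc j) b y j × a + b ≡ gap q + w))

    Free : List Quant → ℕ → Set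
    Free [] j = ⊤
    Free (q ∷ qs) j = (q ≡ ex2 → ∀ x → x < j → ¬ Tab qs (suc j) 0 x j) × Free qs (suc j)

    -- The bounds make this expressible by a bounded formula; a longer odd closed walk can be
    -- shortened to one below `M`.
    Bipartite : Set
    Bipartite = ∀ w x → w < M → x < M → odd w ≡ true → ¬ Walk w x x

    Respects : List Quant → ℕ → Env → Set
    Respects qs j ρ = ∀ w x y → w < M → x < j → y < j → Tab qs j w x y → Con w (ρ x) (ρ y)

    Tab-sym : ∀ qs j {w x y} → Tab qs j w x y → Tab qs j w y x
    Tab-sym [] j p = Walk-sym p
    Tab-sym (q ∷ qs) j (inj₁ p) = inj₁ (Tab-sym qs (suc j) p)
    Tab-sym (q ∷ qs) j (inj₂ (x< , y< , a , b , a< , b< , p , p′ , e)) =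
      inj₂ (y< , x< , b , a , b< , a< , p′ , p , trans (+-comm b a) e)

    Walk⇒Tab : ∀ qs j {w x y} → Walk w x y → Tab qs j w x y
    Walk⇒Tab [] j p = p
    Walk⇒Tab (q ∷ qs) j p = inj₁ (Walk⇒Tab qs (suc j) p)

    -- Only the parity is kept, since ∃^{≥2} makes radii smaller than lengths of walks. This is
    -- enough to replace facts of radius `M` or more by short walks, and to reduce facts about a
    -- single variable to the absence of odd closed walks.
    Tab⇒Walk : ∀ qs j {w x y} → Tab qs j w x y → ∃[ w′ ] (odd w′ ≡ odd w × Walk w′ x y)
    Tab⇒Walk [] j p = _ , refl , p
    Tab⇒Walk (q ∷ qs) j (inj₁ p) = Tab⇒Walk qs (suc j) p
    Tab⇒Walk (q ∷ qs) j {w} (inj₂ (_ , _ , a , b , _ , _ , p , p′ , e))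
      with a′ , ea , r ← Tab⇒Walk qs (suc j) p | b′ , eb , s ← Tab⇒Walk qs (suc j) p′ =
      b′ + a′ , parity , r ++ʷ Walk-sym s
      where
      open ≡-Reasoning
      parity : odd (b′ + a′) ≡ odd w
      parity = begin
        odd (b′ + a′)          ≡⟨ odd-+ b′ a′ ⟩
        odd b′ xor odd a′      ≡⟨ cong₂ _xor_ eb ea ⟩
        odd b xor odd a        ≡⟨ odd-+ b a ⟨
        odd (b + a)            ≡⟨ cong odd (trans (+-comm b a) e) ⟩
        odd (gap q + w)        ≡⟨ odd-+ (gap q) w ⟩
        odd (gap q) xor odd w  ≡⟨ cong (_xor odd w) (gap-even q) ⟩
        odd w                  ∎

    module Bounded (n : ℕ) (wf : All (λ (p : ℕ × ℕ) → (proj₁ p < n) × (proj₂ p < n)) as)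
                   (2n<M : 2 * n < M) where

      n<M : n < M
      n<M = ≤-<-trans (m≤m+n n (n + 0)) 2n<M

      Edge-< : ∀ {u v} → Edge u v → u < n × v < n
      Edge-< (inj₁ i) = All.lookup wf i
      Edge-< (inj₂ i) = Data.Product.swap (All.lookup wf i)

      Walk-<ˡ : ∀ {w x y} → Walk (suc w) x y → x < n
      Walk-<ˡ {zero} (nil ▹ e) = proj₁ (Edge-< e)
      Walk-<ˡ {suc w} (p ▹ e) = Walk-<ˡ p

      Walk-<ʳ : ∀ {w x y} → Walk (suc w) x y → y < n
      Walk-<ʳ (p ▹ e) = proj₂ (Edge-< e)

      bit : Bool → Fin 2
      bit false = zero
      bit true = suc zero

      bit-injective : ∀ {b c} → bit b ≡ bit c → b ≡ c
      bit-injective {false} {false} e = refl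
      bit-injective {true} {true} e = refl

      split-< : ∀ i k {x v y} → 0 < k + i → Walk i x v → Walk k v y → v < n
      split-< (suc i) k lt p q = Walk-<ʳ p
      split-< zero (suc k) lt p q = Walk-<ˡ q

      opaque
        -- A long walk passes twice through the same vertex at times of equal parity.
        shorter : ∀ {w x y} → M ≤ w → Walk w x y → ∃[ w′ ] (w′ < w × odd w′ ≡ odd w × Walk w′ x y)
        shorter {w} {x} {y} le p = cut (Fin.pigeonhole {2 * n} {suc w} (m<n⇒m<1+n (<-≤-trans 2n<M le)) label)
          where
          rest : Fin (suc w) → ℕ
          rest i = w ∸ toℕ i

          rest-+ : ∀ i → rest i + toℕ i ≡ w
          rest-+ i = m∸n+n≡m (s≤s⁻¹ (Fin.toℕ<n i))

          at : ∀ i → ∃[ v ] (Walk (toℕ i) x v × Walk (rest i) v y)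
          at i = split (toℕ i) (rest i) (subst (λ n → Walk n x y) (sym (rest-+ i)) p)

          vertex-< : ∀ i → proj₁ (at i) < n
          vertex-< i = split-< (toℕ i) (rest i)
            (subst (0 <_) (sym (rest-+ i)) (≤-<-trans z≤n (<-≤-trans 2n<M le)))
            (proj₁ (proj₂ (at i))) (proj₂ (proj₂ (at i)))

          label : Fin (suc w) → Fin (2 * n)
          label i = Data.Fin.combine (bit (odd (toℕ i))) (fromℕ< (vertex-< i))

          cut : (∃[ i ] ∃[ j ] (i Data.Fin.< j × label i ≡ label j)) →
                ∃[ w′ ] (w′ < w × odd w′ ≡ odd w × Walk w′ x y)
          cut (i , j , i<j , e) with same-bit , same-vertex ← Fin.combine-injective _ _ _ _ e =
            rest j + toℕ i ,
            <-≤-trans (+-monoʳ-< (rest j) i<j) (≤-reflexive (rest-+ j)) ,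
            (begin
              odd (rest j + toℕ i)           ≡⟨ odd-+ (rest j) (toℕ i) ⟩
              odd (rest j) xor odd (toℕ i)   ≡⟨ cong (odd (rest j) xor_) (bit-injective same-bit) ⟩
              odd (rest j) xor odd (toℕ j)   ≡⟨ odd-+ (rest j) (toℕ j) ⟨
              odd (rest j + toℕ j)           ≡⟨ cong odd (rest-+ j) ⟩
              odd w                          ∎) ,
            proj₁ (proj₂ (at i)) ++ʷ
              subst (λ v → Walk (rest j) v y) (sym (Fin.fromℕ<-injective _ _ _ _ same-vertex))
                    (proj₂ (proj₂ (at j)))
            where open ≡-Reasoning

        shorten : ∀ {w x y} → Walk w x y → ∃[ w′ ] (w′ ≤ w × w′ < M × odd w′ ≡ odd w × Walk w′ x y)
        shorten {w} p = go p (<-wellFounded w)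
          where
          go : ∀ {w x y} → Walk w x y → Acc _<_ w →
               ∃[ w′ ] (w′ ≤ w × w′ < M × odd w′ ≡ odd w × Walk w′ x y)
          go {w} p (acc rs) = case w <? M of λ where
            (yes lt) → w , ≤-refl , lt , refl , p
            (no ≮) → let w₁ , lt₁ , e₁ , p₁ = shorter (≮⇒≥ ≮) p
                         w₂ , le₂ , lt₂ , e₂ , p₂ = go p₁ (rs lt₁)
                     in w₂ , ≤-trans le₂ (<⇒≤ lt₁) , lt₂ , trans e₂ e₁ , p₂

      Edge? : ∀ u v → Dec (Edge u v)
      Edge? u v = (u , v) ∈? as ⊎-dec (v , u) ∈? as
        where
        _∈?_ : ∀ (p : ℕ × ℕ) ps → Dec (p ∈ ps)
        p ∈? ps = Any.any? (λ q → Product.≡-dec _≟_ _≟_ p q) ps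

      Walk? : ∀ w x y → Dec (Walk w x y)
      Walk? zero x y = map′ (λ { refl → nil }) (λ { nil → refl }) (x ≟ y)
      Walk? (suc w) x y =
        map′ (λ { (u , _ , p , e) → p ▹ e }) (λ { (p ▹ e) → _ , proj₁ (Edge-< e) , p , e })
             (anyUpTo? (λ u → Walk? w x u ×-dec Edge? u y) n)

      Tab? : ∀ qs j w x y → Dec (Tab qs j w x y)
      Tab? [] j w x y = Walk? w x y
      Tab? (q ∷ qs) j w x y = Tab? qs (suc j) w x y ⊎-dec
        ((x <? j) ×-dec ((y <? j) ×-dec
          map′ (λ { (a , a< , b , b< , h) → a , b , a< , b< , h }) (λ { (a , b , a< , b< , h) → a , a< , b , b< , h })
            (anyUpTo? (λ a → anyUpTo? (λ b → Tab? qs (suc j) a x j ×-dec (Tab? qs (suc j) b y j ×-dec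
                                             (a + b ≟ gap q + w))) M) M)))

      Edge⇒Con : ∀ {ρ u v} → SatAtoms ρ as → Edge u v → Con 1 (ρ u) (ρ v)
      Edge⇒Con {ρ} {u} {v} s (inj₁ i) = Adj⇒Con {ρ u} {ρ v} (All.lookup s i)
      Edge⇒Con {ρ} {u} {v} s (inj₂ i) = Con-sym {u = ρ v} {ρ u} (Adj⇒Con {ρ v} {ρ u} (All.lookup s i))

      Walk⇒Con : ∀ {ρ w x y} → SatAtoms ρ as → Walk w x y → Con w (ρ x) (ρ y)
      Walk⇒Con {ρ} {x = x} s nil = Con-refl (ρ x)
      Walk⇒Con {ρ} {suc w} {x} {y} s (_▹_ {u = u} p e) =
        subst (λ n → Con n (ρ x) (ρ y)) (+-comm w 1)
          (Con-trans {u = ρ x} {ρ u} {ρ y} (Walk⇒Con {ρ} s p) (Edge⇒Con {ρ} s e))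

      restrict : ∀ {qs j ρ z w x y} → Respects qs (suc j) (ρ [ j ↦ z ]) → w < M → x < j → y < j →
                 Tab qs (suc j) w x y → Con w (ρ x) (ρ y)
      restrict {ρ = ρ} {z} Rs w< x< y< t =
        subst₂ (Con _) (update-below ρ _ z x<) (update-below ρ _ z y<) (Rs _ _ _ w< (m<n⇒m<1+n x<) (m<n⇒m<1+n y<) t)

      reach : ∀ {qs j ρ z w x} → Respects qs (suc j) (ρ [ j ↦ z ]) → w < M → x < j →
              Tab qs (suc j) w x j → Con w (ρ x) z
      reach {j = j} {ρ} {z} Rs w< x< t =
        subst₂ (Con _) (update-below ρ _ z x<) (update-same ρ j z) (Rs _ _ _ w< (m<n⇒m<1+n x<) ≤-refl t)

      -- Both branches of ∃^{≥2} are governed by one table, so both values meet the same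
      -- constraints; a constraint of radius 0 would make them equal.
      sound : ∀ qs j ρ → Sat qs j ρ as → Respects qs j ρ × Free qs j × Bipartite
      sound [] j ρ s = (λ w x y _ _ _ p → Walk⇒Con {ρ} s p) , tt ,
        λ w x _ _ o p → contradiction (trans (sym (Con-closed {u = ρ x} (Walk⇒Con {ρ} s p))) o) λ ()
      sound (ex1 ∷ qs) j ρ (z , s) with R₁ , F , B ← sound qs (suc j) _ s = respects , ((λ ()) , F) , B
        where
        respects : Respects (ex1 ∷ qs) j ρ
        respects w x y w< x< y< (inj₁ t) = restrict {qs} {z = z} R₁ w< x< y< t
        respects w x y w< x< y< (inj₂ (_ , _ , a , b , a< , b< , t , t′ , refl)) =
          Con-trans {u = ρ x} {z} {ρ y} (reach {qs} R₁ a< x< t) (Con-sym {u = ρ y} {z} (reach {qs} R₁ b< y< t′))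
      sound (ex2 ∷ qs) j ρ (z , z′ , ne , s , s′)
        with R₁ , F , B ← sound qs (suc j) _ s | R₂ , _ ← sound qs (suc j) _ s′ =
        respects , ((λ _ → free) , F) , B
        where
        respects : Respects (ex2 ∷ qs) j ρ
        respects w x y w< x< y< (inj₁ t) = restrict {qs} {z = z} R₁ w< x< y< t
        respects w x y w< x< y< (inj₂ (_ , _ , a , b , a< , b< , t , t′ , e)) =
          Con-pair {u = ρ x} {ρ y} {z} {z′} ne e (reach {qs} R₁ a< x< t) (reach {qs} R₂ a< x< t)
            (reach {qs} R₁ b< y< t′) (reach {qs} R₂ b< y< t′)

        free : ∀ x → x < j → ¬ Tab qs (suc j) 0 x j
        free x x< t = ne (trans (sym (Con-0 {ρ x} {z} (reach {qs} R₁ 0<M x< t))) (Con-0 {ρ x} {z′} (reach {qs} R₂ 0<M x< t)))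
          where
          0<M : 0 < M
          0<M = ≤-<-trans z≤n 2n<M

      -- The facts not covered by `near` or by the earlier variables relate variable `j` to itself.
      -- They ask only for an even radius, which holds as there is no odd closed walk.
      extend : ∀ {q qs j ρ z} → Bipartite → j < n → Respects (q ∷ qs) j ρ →
               (∀ y b → y < j → b < M → Tab qs (suc j) b y j → Con b (ρ y) z) →
               Respects qs (suc j) (ρ [ j ↦ z ])
      extend {q} {qs} {j} {ρ} {z} B j<n Rs near w x y w< x< y< t
        with m≤n⇒m<n∨m≡n (s≤s⁻¹ x<) | m≤n⇒m<n∨m≡n (s≤s⁻¹ y<)
      ... | inj₁ x<j | inj₁ y<j =
        subst₂ (Con w) (sym (update-below ρ j z x<j)) (sym (update-below ρ j z y<j)) (Rs w x y w< x<j y<j (inj₁ t))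
      ... | inj₁ x<j | inj₂ refl =
        subst₂ (Con w) (sym (update-below ρ j z x<j)) (sym (update-same ρ j z)) (near x w x<j w< t)
      ... | inj₂ refl | inj₁ y<j =
        subst₂ (Con w) (sym (update-same ρ j z)) (sym (update-below ρ j z y<j))
          (Con-sym {u = ρ y} {z} (near y w y<j w< (Tab-sym qs (suc j) t)))
      ... | inj₂ refl | inj₂ refl
        with w₁ , e₁ , p₁ ← Tab⇒Walk qs (suc j) t
        with w₂ , _ , w₂< , e₂ , p₂ ← shorten p₁
        with odd w₂ in o
      ...   | true = contradiction p₂ (B w₂ j w₂< (<-trans j<n n<M) o)
      ...   | false with c , refl ← not-odd⇒double w (trans (sym e₁) (sym e₂)) =
        Con-double c {0} {(ρ [ j ↦ z ]) j} {(ρ [ j ↦ z ]) j} (Con-refl ((ρ [ j ↦ z ]) j))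

      gap-≤ : ∀ {q qs j a b x y} → Free (q ∷ qs) j → x < j → y < j →
              Tab qs (suc j) a x j → Tab qs (suc j) b y j → gap q ≤ a + b
      gap-≤ {ex1} F x< y< t t′ = z≤n
      gap-≤ {ex2} {qs} {j} (free , _) x< y< t t′ = +-mono-≤ (positive x< t) (positive y< t′)
        where
        positive : ∀ {c v} → v < j → Tab qs (suc j) c v j → 0 < c
        positive {zero} v< t = contradiction t (free refl _ v<)
        positive {suc c} v< t = s≤s z≤n

      -- If the derived radius is `M` or more, `Respects` says nothing about it. But then a walk
      -- from `x` to `y` of the same parity and length below `M` gives a tighter constraint.
      derived : ∀ {q qs j ρ a b x y} → Free (q ∷ qs) j → Respects (q ∷ qs) j ρ → a < M → b < M → x < j → y < j →
                Tab qs (suc j) a x j → Tab qs (suc j) b y j →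
                ∃[ w ] (a + b ≡ gap q + w × Con w (ρ x) (ρ y))
      derived {q} {qs} {j} {ρ} {a} {b} {x} {y} F Rs a< b< x< y< t t′
        with w , e ← m≤n⇒∃[o]m+o≡n (gap-≤ {q} {qs} F x< y< t t′)
        with t″ ← inj₂ (x< , y< , a , b , a< , b< , t , t′ , sym e)
        with w <? M
      ... | yes w< = w , sym e , Rs w x y w< x< y< t″
      ... | no ≮M
        with w₁ , e₁ , p₁ ← Tab⇒Walk (q ∷ qs) j t″
        with w₂ , _ , w₂< , e₂ , p₂ ← shorten p₁ =
        w , sym e , Con-weaken {u = ρ x} {ρ y} (<⇒≤ (<-≤-trans w₂< (≮⇒≥ ≮M))) (trans e₂ e₁)
                      (Rs w₂ x y w₂< x< y< (Walk⇒Tab (q ∷ qs) j p₂))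

      -- The value for variable `j` is the largest left end among the constraints that tie it to
      -- earlier variables, with the point 2 beyond it as second value; if there are none, any value
      -- will do.
      complete : ∀ qs j ρ → length qs + j ≡ n → Bipartite → Free qs j → Respects qs j ρ → Sat qs j ρ as
      complete [] j ρ refl B F Rs = All.tabulate λ {p} i → Con⇒Adj {ρ (proj₁ p)} {ρ (proj₂ p)}
        (Rs 1 _ _ (1<M i) (proj₁ (All.lookup wf i)) (proj₂ (All.lookup wf i)) (nil ▹ inj₁ i))
        where
        1<M : ∀ {p} → p ∈ as → 1 < M
        1<M i = ≤-<-trans (≤-trans (≤-<-trans z≤n (proj₁ (All.lookup wf i))) (m≤m+n n (n + 0))) 2n<M
      complete (q ∷ qs) j ρ len B F Rs = choose q F Rs
        (argmax (λ { (x , a) → (x <? j) ×-dec ((a <? M) ×-dec Tab? qs (suc j) a x j) })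
                (λ { (x , a) → ρ x ℤ.- + a }) (cartesianProduct (upTo j) (upTo M)))
        where
        Fact : ℕ × ℕ → Set
        Fact (x , a) = x < j × a < M × Tab qs (suc j) a x j

        candidates : List (ℕ × ℕ)
        candidates = cartesianProduct (upTo j) (upTo M)

        low : ℕ × ℕ → ℤ
        low (x , a) = ρ x ℤ.- + a

        candidate : ∀ {x a} → x < j → a < M → (x , a) ∈ candidates
        candidate x< a< = ∈-cartesianProduct⁺ (∈-upTo⁺ x<) (∈-upTo⁺ a<)

        j<n : j < n
        j<n = subst (j <_) len (s≤s (m≤n+m j (length qs)))

        continue : ∀ {q} → Free (q ∷ qs) j → Respects (q ∷ qs) j ρ → ∀ z →
                   (∀ y b → y < j → b < M → Tab qs (suc j) b y j → Con b (ρ y) z) →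
                   Sat qs (suc j) (ρ [ j ↦ z ]) as
        continue {q} F Rs z near = complete qs (suc j) (ρ [ j ↦ z ]) (trans (+-suc (length qs) j) len) B (proj₂ F)
          (extend {q} {qs} {z = z} B j<n Rs near)

        choose : ∀ q → Free (q ∷ qs) j → Respects (q ∷ qs) j ρ →
          (∀ p → p ∈ candidates → ¬ Fact p) ⊎
          ∃[ m ] (Fact m × (∀ p → p ∈ candidates → Fact p → low p ℤ.≤ low m)) → Sat (q ∷ qs) j ρ as
        choose ex1 F Rs (inj₁ none) =
          0ℤ , continue F Rs 0ℤ (λ y b y< b< t → contradiction (y< , b< , t) (none _ (candidate y< b<)))
        choose ex2 F Rs (inj₁ none) =
          0ℤ , 1ℤ , (λ ()) ,
          continue F Rs 0ℤ (λ y b y< b< t → contradiction (y< , b< , t) (none _ (candidate y< b<))) ,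
          continue F Rs 1ℤ (λ y b y< b< t → contradiction (y< , b< , t) (none _ (candidate y< b<)))
        choose ex1 F Rs (inj₂ ((x , a) , (x< , a< , t) , max)) = low (x , a) , continue F Rs _ near
          where
          near : ∀ y b → y < j → b < M → Tab qs (suc j) b y j → Con b (ρ y) (low (x , a))
          near y b y< b< t′ with w , refl , c ← derived {ex1} {qs} {ρ = ρ} F Rs a< b< x< y< t t′ =
            Con-left-end {a} {b} {ρ x} {ρ y} (max _ (candidate y< b<) (y< , b< , t′)) c
        choose ex2 F Rs (inj₂ ((x , a) , (x< , a< , t) , max)) =
          low (x , a) , low (x , a) ℤ.+ + 2 , distinct ,
          continue F Rs _ (λ y b y< b< t′ → proj₁ (near y b y< b< t′)) ,
          continue F Rs _ (λ y b y< b< t′ → proj₂ (near y b y< b< t′))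
          where
          distinct : low (x , a) ≢ low (x , a) ℤ.+ + 2
          distinct e with () ← ℤ-+-cancelˡ (low (x , a)) 0ℤ (+ 2) (trans (ℤ.+-identityʳ _) e)

          near : ∀ y b → y < j → b < M → Tab qs (suc j) b y j →
                 Con b (ρ y) (low (x , a)) × Con b (ρ y) (low (x , a) ℤ.+ + 2)
          near y b y< b< t′ with w , e , c ← derived {ex2} {qs} {ρ = ρ} F Rs a< b< x< y< t t′ =
            Con-left-end₂ {a} {b} {u = ρ x} {ρ y} (max _ (candidate y< b<) (y< , b< , t′)) e c

      decide : ∀ qs ρ → length qs ≡ n → Sat qs 0 ρ as ⇔ (Bipartite × Free qs 0)
      decide qs ρ len = mk⇔ (λ s → let _ , F , B = sound qs 0 ρ s in B , F)
        (λ (B , F) → complete qs 0 ρ (trans (+-identityʳ _) len) B F (λ _ _ _ _ ()))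

-- The table and the answer as bounded formulas

module Formulas where
  open Language 24

  t P M N : Fin 24
  t = # 20
  P = # 21
  M = # 22
  N = # 23

  -- The number with digits k, w, x, y to base `M`, in Horner form because every product is by a
  -- register.
  addrE : ∀ {m l} {_ : T (m ℕ.≤ᵇ 22)} →
          Exp m l → Exp m (suc l) → Exp m (2 + l) → Exp m (3 + l) → Exp m (3 + l)
  addrE {_} {_} {v} k w x y = (_⊗_ ((_⊗_ ((_⊗_ k M {v}) ⊕ w) M {v}) ⊕ x) M {v}) ⊕ y

  -- At the position in register 11 starts E 1^i # 1^k, with i and k in registers 13 and 12. The
  -- double negations are bounded universal quantifiers; the last clause keeps k from being a proper
  -- part of a longer run of ones.
  atom : Form 12
  atom = any N {_}
    (symAt sE (var (# 11)) ∧ᶠ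
     neg (any (# 13) (neg (symAt sOne (var (# 11) ⊕ num 1 ⊕ var (# 10))))) ∧ᶠ
     symAt sSep (var (# 11) ⊕ num 1 ⊕ var (# 13)) ∧ᶠ
     neg (any (# 12) (neg (symAt sOne (var (# 11) ⊕ num 2 ⊕ var (# 13) ⊕ var (# 10))))) ∧ᶠ
     neg (symAt sOne (var (# 11) ⊕ num 2 ⊕ var (# 13) ⊕ var (# 12))))

  edge : Form 14
  edge = any M (any M
    ((eq (var (# 13)) (var (# 14)) ∧ᶠ eq (var (# 12)) (var (# 16)) ∨ᶠ
      eq (var (# 13)) (var (# 16)) ∧ᶠ eq (var (# 12)) (var (# 14))) ∧ᶠ atom))

  base : Form 16
  base = eq (var (# 18)) (num 0) ∧ᶠ eq (var (# 17)) (var (# 16)) ∨ᶠ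
    any M (any M
      (eq (var (# 18)) (var (# 15) ⊕ num 1) ∧ᶠ
       bitAt (addrE (num 0) (var (# 15)) (var (# 17)) (var (# 14))) ∧ᶠ edge))

  elim : Form 16
  elim = any M
    (eq (var (# 19)) (var (# 15) ⊕ num 1) ∧ᶠ
     (bitAt (addrE (var (# 15)) (var (# 18)) (var (# 17)) (var (# 16))) ∨ᶠ
      any N
        -- The eliminated variable z, in register 14, is also the position of its own quantifier in
        -- the input, which is read below.
        (eq (var (# 14) ⊕ var (# 19)) (var N) ∧ᶠ
         -- The language has no order relation: x < z is a search for x below z.
         any (# 14) (eq (var (# 13)) (var (# 17))) ∧ᶠ
         any (# 14) (eq (var (# 13)) (var (# 16))) ∧ᶠ
         any M (any M
           (bitAt (addrE (var (# 15)) (var (# 13)) (var (# 17)) (var (# 14))) ∧ᶠ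
            bitAt (addrE (var (# 15)) (var (# 12)) (var (# 16)) (var (# 14))) ∧ᶠ
            (symAt sQ1 (var (# 14)) ∧ᶠ eq (var (# 13) ⊕ var (# 12)) (var (# 18)) ∨ᶠ
             symAt sQ2 (var (# 14)) ∧ᶠ eq (var (# 13) ⊕ var (# 12)) (num 2 ⊕ var (# 18))))))))

  -- With k, w, x, y in registers 19 to 16: the bit at address M k w x y records
  -- Tab M (drop j qs) j w x y for k + j = N, so that k = 0 is the table of walks and
  -- step k eliminates variable z = N − k.
  tableF : Form 20
  tableF = any M (any M (any M (any M
    (eq (var t) (addrE (var (# 19)) (var (# 18)) (var (# 17)) (var (# 16))) ∧ᶠ
     (eq (var (# 19)) (num 0) ∧ᶠ base ∨ᶠ elim)))))

  answerF : Form 20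
  answerF =
    neg (any M (any M (any M (eq (var (# 19)) (num 1 ⊕ (var (# 17) ⊕ var (# 17)))) ∧ᶠ
                       bitAt (addrE (num 0) (var (# 19)) (var (# 18)) (var (# 18)))))) ∧ᶠ
    neg (any N (symAt sQ2 (var (# 19)) ∧ᶠ
                -- The stage N - (1 + z) is the one at which z is the last variable not yet
                -- eliminated.
                any (# 19) (any M (eq (var (# 17) ⊕ (num 1 ⊕ var (# 19))) (var N) ∧ᶠ
                                   bitAt (addrE (var (# 17)) (num 0) (var (# 18)) (var (# 19)))))))

  -- 2N + 2 exceeds twice the number of variables, which is at most the input length N.
  sizeE : Exp 23 20
  sizeE = var N ⊕ var N ⊕ num 2

  bitsE : Exp 22 20
  bitsE = var M ⊗ M ⊗ M ⊗ M

  open Program 20 sizeE bitsE tableF answerF public using (env; bits; Table; Decider; decides)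

width : ℕ → ℕ
width n = n + n + 2

address : ℕ → ℕ → ℕ → ℕ → ℕ → ℕ
address M k w x y = M * (M * (M * k + w) + x) + y

-- This and the statements in `Meaning` copy the formulas clause by clause, so that they agree with
-- the meaning of the formulas by computation.
AtomAt : List Sym → ℕ → ℕ → ℕ → Set
AtomAt v i k p =
  symbolAt v p sE ≡ true ×
  ¬ (∃[ q ] (q < i × ¬ symbolAt v (p + 1 + q) sOne ≡ true)) ×
  symbolAt v (p + 1 + i) sSep ≡ true ×
  ¬ (∃[ q ] (q < k × ¬ symbolAt v (p + 2 + i + q) sOne ≡ true)) ×
  ¬ symbolAt v (p + 2 + i + k) sOne ≡ true

module Meaning (v : List Sym) (β : ℕ → Bool) where

  N M : ℕ
  N = length v
  M = width N

  Bit : ℕ → ℕ → ℕ → ℕ → Set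
  Bit k w x y = β (address M k w x y) ≡ true

  EdgeIn : ℕ → ℕ → Set
  EdgeIn u y = ∃[ i ] (i < M × ∃[ k ] (k < M ×
    ((i ≡ u × k ≡ y ⊎ i ≡ y × k ≡ u) × ∃[ p ] (p < N × AtomAt v i k p))))

  Base : ℕ → ℕ → ℕ → Set
  Base w x y = w ≡ 0 × x ≡ y ⊎
    ∃[ w′ ] (w′ < M × ∃[ u ] (u < M × (w ≡ w′ + 1 × Bit 0 w′ x u × EdgeIn u y)))

  Through : ℕ → ℕ → ℕ → ℕ → ℕ → Set
  Through k w x y z = ∃[ a ] (a < M × ∃[ b ] (b < M × (Bit k a x z × Bit k b y z ×
    (symbolAt v z sQ1 ≡ true × a + b ≡ w ⊎ symbolAt v z sQ2 ≡ true × a + b ≡ 2 + w))))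

  Elim : ℕ → ℕ → ℕ → ℕ → Set
  Elim k w x y = ∃[ k′ ] (k′ < M × (k ≡ k′ + 1 × (Bit k′ w x y ⊎
    ∃[ z ] (z < N × (z + k ≡ N × (∃[ i ] (i < z × i ≡ x)) × (∃[ i ] (i < z × i ≡ y)) ×
      Through k′ w x y z)))))

  Entry : ℕ → Set
  Entry t = ∃[ k ] (k < M × ∃[ w ] (w < M × ∃[ x ] (x < M × ∃[ y ] (y < M ×
    (t ≡ address M k w x y × (k ≡ 0 × Base w x y ⊎ Elim k w x y))))))

  Answer : Set
  Answer =
    ¬ (∃[ w ] (w < M × ∃[ x ] (x < M × ((∃[ h ] (h < M × w ≡ 1 + (h + h))) × Bit 0 w x x)))) ×
    ¬ (∃[ z ] (z < N × (symbolAt v z sQ2 ≡ true ×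
       ∃[ x ] (x < z × ∃[ k ] (k < M × (k + (1 + z) ≡ N × Bit k 0 x z))))))

  open Language 24 using (⟦_⟧)
  open Formulas using (tableF; answerF; env; bits)

  opaque
    unfolding _[_≔_]

    Entry-meaning : ∀ t → ⟦ tableF ⟧ v β (env N t) ≡ Entry t
    Entry-meaning t = refl

    Answer-meaning : ∀ t → ⟦ answerF ⟧ v β (env N t) ≡ Answer
    Answer-meaning t = refl

    bits-meaning : bits N ≡ M * (M * (M * M))
    bits-meaning = refl

-- Reading atoms and quantifiers off the encoded sentence

==ˢ-sound : ∀ a b → (a ==ˢ b) ≡ true → a ≡ b
==ˢ-sound sQ1  sQ1  e = refl
==ˢ-sound sQ2  sQ2  e = refl
==ˢ-sound sE   sE   e = refl
==ˢ-sound sOne sOne e = refl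
==ˢ-sound sSep sSep e = refl

symbolAt-< : ∀ w p s → symbolAt w p s ≡ true → p < length w
symbolAt-< (x ∷ w) zero s e = s≤s z≤n
symbolAt-< (x ∷ w) (suc p) s e = s≤s (symbolAt-< w p s e)

symbolAt-unique : ∀ w p {s s′} → symbolAt w p s ≡ true → symbolAt w p s′ ≡ true → s ≡ s′
symbolAt-unique (x ∷ w) zero {s} {s′} e e′ = trans (sym (==ˢ-sound x s e)) (==ˢ-sound x s′ e′)
symbolAt-unique (x ∷ w) (suc p) e e′ = symbolAt-unique w p e e′

symbolAt-All : ∀ {P : Sym → Set} {w} p s → All P w → symbolAt w p s ≡ true → P s
symbolAt-All {P} zero s (_∷_ {x} px _) e = subst P (==ˢ-sound x s e) px
symbolAt-All (suc p) s (_ ∷ ps) e = symbolAt-All p s ps e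

-- An atom starts with `sE`, hence not within `l`.
AtomAt-skip : ∀ {l} u i k p → All (_≢ sE) l → AtomAt (l ++ u) i k p → ∃[ p′ ] AtomAt u i k p′
AtomAt-skip u i k p [] h = p , h
AtomAt-skip u i k zero (_∷_ {x} ne _) (e , _) = contradiction (==ˢ-sound x sE e) ne
AtomAt-skip u i k (suc p) (_ ∷ ps) h = AtomAt-skip u i k p ps h

AtomAt-shift : ∀ l u i k p → AtomAt u i k p → AtomAt (l ++ u) i k (length l + p)
AtomAt-shift [] u i k p h = h
AtomAt-shift (x ∷ l) u i k p h = AtomAt-shift l u i k p h

ones : ℕ → List Sym → List Sym
ones m u = replicate m sOne ++ u

ones-end : ∀ m u i → symbolAt u 0 sOne ≡ false → (∀ q → q < i → symbolAt (ones m u) q sOne ≡ true) →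
           ¬ symbolAt (ones m u) i sOne ≡ true → i ≡ m
ones-end zero u zero f h n = refl
ones-end zero u (suc i) f h n = contradiction (trans (sym (h 0 (s≤s z≤n))) f) λ ()
ones-end (suc m) u zero f h n = contradiction refl n
ones-end (suc m) u (suc i) f h n = cong suc (ones-end m u i f (λ q lt → h (suc q) (s≤s lt)) n)

ones-in : ∀ m u q → q < m → symbolAt (ones m u) q sOne ≡ true
ones-in (suc m) u zero lt = refl
ones-in (suc m) u (suc q) lt = ones-in m u q (s≤s⁻¹ lt)

ones-after : ∀ m u q s → symbolAt (ones m u) (m + q) s ≡ symbolAt u q s
ones-after zero u q s = refl
ones-after (suc m) u q s = ones-after m u q s

ones-at : ∀ m u s → symbolAt (ones m u) m s ≡ symbolAt u 0 s
ones-at m u s = trans (cong (λ q → symbolAt (ones m u) q s) (sym (+-identityʳ m))) (ones-after m u 0 s)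

ones-next : ∀ m c u q s → symbolAt (ones m (c ∷ u)) (suc (m + q)) s ≡ symbolAt u q s
ones-next m c u q s =
  trans (cong (λ q → symbolAt (ones m (c ∷ u)) q s) (sym (+-suc m q))) (ones-after m (c ∷ u) (suc q) s)

true-stable : ∀ {b} → ¬ ¬ b ≡ true → b ≡ true
true-stable {true} h = refl
true-stable {false} h = contradiction (λ ()) h

encAtom-++ : ∀ m l u → encAtom (m , l) ++ u ≡ sE ∷ ones m (sSep ∷ ones l u)
encAtom-++ m l u = cong (sE ∷_) (++-assoc (replicate m sOne) (sSep ∷ replicate l sOne) u)

-- Both unary numbers are determined by where their ones end: the first run at the separator, the
-- second because `u` does not begin with a one.
AtomAt-head : ∀ m l u {i k} → symbolAt u 0 sOne ≡ false → AtomAt (encAtom (m , l) ++ u) i k 0 →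
              (i , k) ≡ (m , l)
AtomAt-head m l u {i} {k} f h with subst (λ w → AtomAt w i k 0) (encAtom-++ m l u) h
... | _ , first , sep , second , end
  with refl ← ones-end m (sSep ∷ ones l u) i refl (λ q lt → true-stable λ n → first (q , lt , n))
                (λ one → case symbolAt-unique (ones m (sSep ∷ ones l u)) i sep one of λ ())
  with refl ← ones-end l u k f
                (λ q lt → trans (sym (ones-next m sSep (ones l u) q sOne)) (true-stable λ n → second (q , lt , n)))
                (λ one → end (trans (ones-next m sSep (ones l u) k sOne) one))
  = refl

AtomAt-encAtom : ∀ i k u → symbolAt u 0 sOne ≡ false → AtomAt (encAtom (i , k) ++ u) i k 0
AtomAt-encAtom i k u f = subst (λ w → AtomAt w i k 0) (sym (encAtom-++ i k u))
  (refl , (λ (q , lt , n) → n (ones-in i _ q lt)) , ones-at i _ sSep ,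
   (λ (q , lt , n) → n (trans (ones-next i sSep (ones k u) q sOne) (ones-in k u q lt))) ,
   λ e → contradiction (trans (sym e) (trans (ones-next i sSep (ones k u) k sOne) (trans (ones-at k u sOne) f))) λ ())

encAtoms-head : ∀ as → symbolAt (concatMap encAtom as) 0 sOne ≡ false
encAtoms-head [] = refl
encAtoms-head (a ∷ as) = refl

encAtom-tail : ∀ i k → All (_≢ sE) (replicate i sOne ++ sSep ∷ replicate k sOne)
encAtom-tail i k = All.++⁺ (All.replicate⁺ i (λ ())) ((λ ()) ∷ All.replicate⁺ k (λ ()))

AtomAt⇒∈ : ∀ as {i k} p → AtomAt (concatMap encAtom as) i k p → (i , k) ∈ as
AtomAt⇒∈ [] p (() , _)
AtomAt⇒∈ ((m , l) ∷ as) zero h = here (AtomAt-head m l (concatMap encAtom as) (encAtoms-head as) h)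
AtomAt⇒∈ ((m , l) ∷ as) {i} {k} (suc p) h
  with p′ , h′ ← AtomAt-skip (concatMap encAtom as) i k p (encAtom-tail m l) h = there (AtomAt⇒∈ as p′ h′)

∈⇒AtomAt : ∀ as {i k} → (i , k) ∈ as → ∃[ p ] AtomAt (concatMap encAtom as) i k p
∈⇒AtomAt ((i , k) ∷ as) (here refl) = 0 , AtomAt-encAtom i k (concatMap encAtom as) (encAtoms-head as)
∈⇒AtomAt ((m , l) ∷ as) (there i) with p , h ← ∈⇒AtomAt as i =
  length (encAtom (m , l)) + p , AtomAt-shift (encAtom (m , l)) (concatMap encAtom as) _ _ p h

encQ-injective : ∀ {q q′} → encQ q ≡ encQ q′ → q ≡ q′
encQ-injective {ex1} {ex1} e = refl
encQ-injective {ex2} {ex2} e = refl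

encQ≢sE : ∀ qs → All (_≢ sE) (map encQ qs)
encQ≢sE [] = []
encQ≢sE (ex1 ∷ qs) = (λ ()) ∷ encQ≢sE qs
encQ≢sE (ex2 ∷ qs) = (λ ()) ∷ encQ≢sE qs

-- So a quantifier symbol at position z of the input shows that variable z exists.
encAtoms-noQ : ∀ as → All (λ s → ∀ q → s ≢ encQ q) (concatMap encAtom as)
encAtoms-noQ [] = []
encAtoms-noQ ((i , k) ∷ as) =
  All.++⁺ (noE ∷ All.++⁺ (All.replicate⁺ i noOne) (noSep ∷ All.replicate⁺ k noOne)) (encAtoms-noQ as)
  where
  noE : ∀ q → sE ≢ encQ q
  noE ex1 ()
  noE ex2 ()
  noOne : ∀ q → sOne ≢ encQ q
  noOne ex1 ()
  noOne ex2 ()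
  noSep : ∀ q → sSep ≢ encQ q
  noSep ex1 ()
  noSep ex2 ()

module Parsing (φ : Sentence) where

  word : List Sym
  word = encode φ

  atom⇒∈ : ∀ {i k} p → AtomAt word i k p → (i , k) ∈ atoms φ
  atom⇒∈ p h with p′ , h′ ← AtomAt-skip (concatMap encAtom (atoms φ)) _ _ p (encQ≢sE (quants φ)) h =
    AtomAt⇒∈ (atoms φ) p′ h′

  ∈⇒atom : ∀ {i k} → (i , k) ∈ atoms φ → ∃[ p ] (p < length word × AtomAt word i k p)
  ∈⇒atom m with p , h ← ∈⇒AtomAt (atoms φ) m
    with h′ ← AtomAt-shift (map encQ (quants φ)) (concatMap encAtom (atoms φ)) _ _ p h =
    length (map encQ (quants φ)) + p , symbolAt-< word _ sE (proj₁ h′) , h′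

  symbol⇒quant : ∀ z q → symbolAt word z (encQ q) ≡ true → drop z (quants φ) ≡ q ∷ drop (suc z) (quants φ)
  symbol⇒quant z q = go (quants φ) z
    where
    go : ∀ qs z → symbolAt (map encQ qs ++ concatMap encAtom (atoms φ)) z (encQ q) ≡ true →
         drop z qs ≡ q ∷ drop (suc z) qs
    go [] z e = contradiction refl (symbolAt-All z (encQ q) (encAtoms-noQ (atoms φ)) e q)
    go (q′ ∷ qs) zero e = cong (_∷ qs) (encQ-injective (==ˢ-sound (encQ q′) (encQ q) e))
    go (q′ ∷ qs) (suc z) e = go qs z e

  quant⇒symbol : ∀ z {q r} → drop z (quants φ) ≡ q ∷ r → symbolAt word z (encQ q) ≡ true
  quant⇒symbol z {q} {r} = go (quants φ) z
    where
    go : ∀ qs z → drop z qs ≡ q ∷ r →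
         symbolAt (map encQ qs ++ concatMap encAtom (atoms φ)) z (encQ q) ≡ true
    go (ex1 ∷ qs) zero refl = refl
    go (ex2 ∷ qs) zero refl = refl
    go (q′ ∷ qs) (suc z) e = go qs z e
    go [] zero ()
    go [] (suc z) ()

  quants-≤ : length (quants φ) ≤ length word
  quants-≤ = go (quants φ)
    where
    go : ∀ qs → length qs ≤ length (map encQ qs ++ concatMap encAtom (atoms φ))
    go [] = z≤n
    go (q ∷ qs) = s≤s (go qs)

-- Addresses and the order in which the table is filled

pair-mono : ∀ M {a b a′} b′ → a < a′ → b < M → M * a + b < M * a′ + b′
pair-mono M {a} {b} {a′} b′ a<a′ b<M = begin-strict
  M * a + b     <⟨ +-monoʳ-< (M * a) b<M ⟩
  M * a + M     ≡⟨ trans (+-comm (M * a) M) (sym (*-suc M a)) ⟩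
  M * suc a     ≤⟨ *-monoʳ-≤ M a<a′ ⟩
  M * a′        ≤⟨ m≤m+n (M * a′) b′ ⟩
  M * a′ + b′   ∎
  where open ≤-Reasoning

pair-injective : ∀ M {a b a′ b′} → b < M → b′ < M → M * a + b ≡ M * a′ + b′ → a ≡ a′ × b ≡ b′
pair-injective M {a} {b} {a′} {b′} b<M b′<M e with <-cmp a a′
... | tri< lt _ _ = contradiction e (<⇒≢ (pair-mono M b′ lt b<M))
... | tri≈ _ refl _ = refl , +-cancelˡ-≡ (M * a) b b′ e
... | tri> _ _ gt = contradiction (sym e) (<⇒≢ (pair-mono M b gt b′<M))

pair-< : ∀ M {a b A} → a < A → b < M → M * a + b < M * A
pair-< M {A = A} a<A b<M = <-≤-trans (pair-mono M 0 a<A b<M) (≤-reflexive (+-identityʳ (M * A)))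

address-< : ∀ M {k w x y} → k < M → w < M → x < M → y < M → address M k w x y < M * (M * (M * M))
address-< M k< w< x< y< = pair-< M (pair-< M (pair-< M k< w<) x<) y<

address-injective : ∀ M {k w x y k′ w′ x′ y′} → w < M → x < M → y < M → w′ < M → x′ < M → y′ < M →
  address M k w x y ≡ address M k′ w′ x′ y′ → (k ≡ k′ × w ≡ w′) × (x ≡ x′ × y ≡ y′)
address-injective M w< x< y< w′< x′< y′< e
  with e₁ , ey ← pair-injective M y< y′< e
  with e₂ , ex ← pair-injective M x< x′< e₁
  with e₃ , ew ← pair-injective M w< w′< e₂ = (e₃ , ew) , (ex , ey)

-- With the radius as a higher digit than both vertices, the entries for shorter walks come earlier
-- whatever the vertices are.
address-<-w : ∀ M {k w x u x′} y → x < M → u < M → address M k w x u < address M k (suc w) x′ y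
address-<-w M {k} {w} {x} {u} {x′} y x< u< =
  pair-mono M y (pair-mono M x′ (+-monoʳ-< (M * k) (n<1+n w)) x<) u<

-- With the stage as leading digit, all of stage k is earlier, including radii above `w`, which an
-- elimination for ∃^{≥2} may read.
address-<-k : ∀ M {k a x z w x′} y → a < M → x < M → z < M → address M k a x z < address M (suc k) w x′ y
address-<-k M {w = w} {x′} y a< x< z< = pair-mono M y (pair-mono M x′ (pair-mono M w ≤-refl a<) x<) z<

drop-tail : ∀ {A : Set} (xs : List A) j {x r} → drop j xs ≡ x ∷ r → drop (suc j) xs ≡ r
drop-tail (x ∷ xs) zero refl = refl
drop-tail (x ∷ xs) (suc j) e = drop-tail xs j e

drop-cases : ∀ {A : Set} (xs : List A) j →
             (drop j xs ≡ [] × drop (suc j) xs ≡ []) ⊎ ∃[ x ] (drop j xs ≡ x ∷ drop (suc j) xs)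
drop-cases [] zero = inj₁ (refl , refl)
drop-cases [] (suc j) = inj₁ (refl , refl)
drop-cases (x ∷ xs) zero = inj₂ (x , refl)
drop-cases (x ∷ xs) (suc j) = drop-cases xs j

module _ (as : List (ℕ × ℕ)) (M : ℕ) where
  open Graph as

  NoStart : List Quant → ℕ → Set
  NoStart r z = ∀ x → x < z → ¬ Tab M r (suc z) 0 x z

  -- Together with `Free-intro` this replaces the recursion over the prefix by a condition on each
  -- position z, the form in which the answer is evaluated.
  Free-elim : ∀ qs j z {r} → Free M qs j → drop z qs ≡ ex2 ∷ r → NoStart r (j + z)
  Free-elim (q ∷ qs) j zero (f , _) refl = subst (NoStart qs) (sym (+-identityʳ j)) (f refl)
  Free-elim (q ∷ qs) j (suc z) {r} (_ , F) e = subst (NoStart r) (sym (+-suc j z)) (Free-elim qs (suc j) z F e)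
  Free-elim [] j zero F ()
  Free-elim [] j (suc z) F ()

  Free-intro : ∀ qs j → (∀ z {r} → drop z qs ≡ ex2 ∷ r → NoStart r (j + z)) → Free M qs j
  Free-intro [] j h = tt
  Free-intro (q ∷ qs) j h =
    (λ { refl → subst (NoStart qs) (+-identityʳ j) (h 0 refl) }) ,
    Free-intro qs (suc j) (λ z {r} e → subst (NoStart r) (+-suc j z) (h (suc z) e))

width-> : ∀ {m n} → m ≤ n → 2 * m < width n
width-> {m} {n} le = ≤-<-trans (+-mono-≤ le (≤-trans (≤-reflexive (+-identityʳ m)) le))
                               (m<m+n (n + n) (s≤s z≤n))

-- The computed table is the table of constraints

module Correctness (φ : Sentence) (β : ℕ → Bool) (table : Formulas.Table (encode φ) β) where
  open Parsing φ
  open Meaning word β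
  open Graph (atoms φ)
  open Bounded M (length (quants φ)) (wf φ) (width-> quants-≤)

  qs : List Quant
  qs = quants φ

  N<M : N < M
  N<M = ≤-<-trans (m≤m+n N (N + 0)) (width-> {N} ≤-refl)

  n≤N : length qs ≤ N
  n≤N = quants-≤

  edge⇔ : ∀ {u y} → EdgeIn u y ⇔ Edge u y
  edge⇔ {u} {y} = mk⇔ to from
    where
    to : EdgeIn u y → Edge u y
    to (i , _ , k , _ , inj₁ (refl , refl) , p , _ , h) = inj₁ (atom⇒∈ p h)
    to (i , _ , k , _ , inj₂ (refl , refl) , p , _ , h) = inj₂ (atom⇒∈ p h)

    bound : ∀ {i} → i < length qs → i < M
    bound lt = <-trans (<-≤-trans lt n≤N) N<M

    from : Edge u y → EdgeIn u y
    from e with u< , y< ← Edge-< e with e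
    ... | inj₁ m = u , bound u< , y , bound y< , inj₁ (refl , refl) , ∈⇒atom m
    ... | inj₂ m = y , bound y< , u , bound u< , inj₂ (refl , refl) , ∈⇒atom m

  Rule : (ℕ → Bool) → ℕ → ℕ → ℕ → ℕ → Set
  Rule γ k w x y = k ≡ 0 × Meaning.Base word γ w x y ⊎ Meaning.Elim word γ k w x y

  -- An address determines its digits, so those guessed by the formula are the given ones. The rule
  -- speaks about the partial table `γ` and is carried over to `β` at each entry it reads, by the
  -- agreement on smaller addresses.
  entry : ∀ {k w x y} → k < M → w < M → x < M → y < M →
    ∃[ γ ] ((∀ p → p < address M k w x y → γ p ≡ β p) × (Bit k w x y ⇔ Rule γ k w x y))
  entry {k} {w} {x} {y} k< w< x< y< =
    let γ , agree , e = table (address M k w x y)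
          (subst (address M k w x y <_) (sym bits-meaning) (address-< M k< w< x< y<))
        meaning = Meaning.Entry-meaning word γ (address M k w x y)
    in γ , agree , mk⇔ (λ b → unpack γ (subst id meaning (Equivalence.to e b)))
                       (λ r → Equivalence.from e (subst id (sym meaning) (pack γ r)))
    where
    pack : ∀ γ → Rule γ k w x y → Meaning.Entry word γ (address M k w x y)
    pack γ r = k , k< , w , w< , x , x< , y , y< , refl , r

    unpack : ∀ γ → Meaning.Entry word γ (address M k w x y) → Rule γ k w x y
    unpack γ (k′ , _ , w′ , w′< , x′ , x′< , y′ , y′< , e , r)
      with (refl , refl) , (refl , refl) ← address-injective M {k} {k′ = k′} w< x< y< w′< x′< y′< e = r

  0<M : 0 < M
  0<M = ≤-<-trans z≤n N<M

  +1-injective : ∀ {m n} → suc m ≡ n + 1 → m ≡ n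
  +1-injective {n = n} e = suc-injective (trans e (+-comm n 1))

  0≢+1 : ∀ {n} → 0 ≢ n + 1
  0≢+1 {n} e = case trans e (+-comm n 1) of λ ()

  base⇒ : ∀ w {x y} → w < M → x < M → y < M → Bit 0 w x y → Walk w x y
  base⇒ w {x} {y} w< x< y< b =
    let γ , agree , e = entry {0} {w} 0<M w< x< y< in go w w< agree (Equivalence.to e b)
    where
    go : ∀ w {γ} → w < M → (∀ p → p < address M 0 w x y → γ p ≡ β p) → Rule γ 0 w x y → Walk w x y
    go w w< agree (inj₁ (_ , inj₁ (refl , refl))) = nil
    go zero w< agree (inj₁ (_ , inj₂ (w′ , _ , u , _ , e , _))) = contradiction e 0≢+1
    go (suc w) w< agree (inj₁ (_ , inj₂ (w′ , w′< , u , u< , e , b , edge))) with refl ← +1-injective e =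
      base⇒ w w′< x< u< (trans (sym (agree _ (address-<-w M {0} y x< u<))) b) ▹ Equivalence.to edge⇔ edge
    go w w< agree (inj₂ (k′ , _ , e , _)) = contradiction e 0≢+1

  base⇐ : ∀ w {x y} → w < M → x < M → y < M → Walk w x y → Bit 0 w x y
  base⇐ w {x} {y} w< x< y< p =
    let γ , agree , e = entry {0} {w} 0<M w< x< y< in Equivalence.from e (inj₁ (refl , go w w< agree p))
    where
    go : ∀ w {γ} → w < M → (∀ p → p < address M 0 w x y → γ p ≡ β p) → Walk w x y → Meaning.Base word γ w x y
    go zero w< agree nil = inj₁ (refl , refl)
    go (suc w) w< agree (_▹_ {u = u} p edge) =
      inj₂ (w , below w< , u , u< , +-comm 1 w ,
            trans (agree _ (address-<-w M {0} y x< u<)) (base⇐ w (below w<) x< u< p) , Equivalence.from edge⇔ edge)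
      where
      below : suc w < M → w < M
      below lt = <-trans (n<1+n w) lt
      u< : u < M
      u< = <-trans (<-≤-trans (proj₁ (Edge-< edge)) n≤N) N<M

  quant⇒symbols : ∀ {z a b w} q → drop z qs ≡ q ∷ drop (suc z) qs → a + b ≡ gap q + w →
            symbolAt word z sQ1 ≡ true × a + b ≡ w ⊎ symbolAt word z sQ2 ≡ true × a + b ≡ 2 + w
  quant⇒symbols ex1 d e = inj₁ (quant⇒symbol _ d , e)
  quant⇒symbols ex2 d e = inj₂ (quant⇒symbol _ d , e)

  -- Induction on `k`, that is, downwards in j = N - k. Positions past the last quantifier are
  -- stages too: there `drop j qs` is empty, the input shows no quantifier, and the stage repeats
  -- the previous one.
  link : ∀ k j → k + j ≡ N → ∀ w {x y} → w < M → x < M → y < M → Bit k w x y ⇔ Tab M (drop j qs) j w x y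
  link zero j refl w w< x< y< rewrite drop-all N qs n≤N = mk⇔ (base⇒ w w< x< y<) (base⇐ w w< x< y<)
  link (suc k) j kj w {x} {y} w< x< y< =
    let γ , agree , e = entry k< w< x< y<
    in mk⇔ (to agree ∘ Equivalence.to e) (Equivalence.from e ∘ inj₂ ∘ from agree)
    where
    k< : suc k < M
    k< = ≤-<-trans (subst (suc k ≤_) kj (m≤m+n (suc k) j)) N<M

    j<N : j < N
    j<N = subst (j <_) kj (s≤s (m≤n+m j k))

    j<M : j < M
    j<M = <-trans j<N N<M

    IH : ∀ w {x y} → w < M → x < M → y < M → Bit k w x y ⇔ Tab M (drop (suc j) qs) (suc j) w x y
    IH = link k (suc j) (trans (+-suc k j) kj)

    Earlier : (ℕ → Bool) → Set
    Earlier γ = ∀ p → p < address M (suc k) w x y → γ p ≡ β p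

    skip : Tab M (drop (suc j) qs) (suc j) w x y → Tab M (drop j qs) j w x y
    skip t with drop-cases qs j
    ... | inj₁ (d , d′) rewrite d | d′ = t
    ... | inj₂ (q , d) rewrite d = inj₁ t

    through : ∀ q → drop j qs ≡ q ∷ drop (suc j) qs → x < j → y < j → ∀ {a b} → a < M → b < M →
              Bit k a x j → Bit k b y j → a + b ≡ gap q + w → Tab M (drop j qs) j w x y
    through q d x<j y<j a< b< t t′ e rewrite d =
      inj₂ (x<j , y<j , _ , _ , a< , b< , Equivalence.to (IH _ a< x< j<M) t , Equivalence.to (IH _ b< y< j<M) t′ , e)

    to : ∀ {γ} → Earlier γ → Rule γ (suc k) w x y → Tab M (drop j qs) j w x y
    to agree (inj₂ (k′ , _ , e , inj₁ b)) with refl ← +1-injective e =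
      skip (Equivalence.to (IH w w< x< y<) (trans (sym (agree _ (address-<-k M y w< x< y<))) b))
    to agree (inj₂ (k′ , _ , e , inj₂ (z , _ , zk , (_ , x<z , refl) , (_ , y<z , refl) , a , a< , b , b< , t , t′ , s)))
      with refl ← +1-injective e
      -- The sum with the stage identifies the guessed z as variable `j`.
      with refl ← +-cancelʳ-≡ (suc k) z j (trans zk (trans (sym kj) (+-comm (suc k) j)))
      with s
    ... | inj₁ (sy , ab) = through ex1 (symbol⇒quant z ex1 sy) x<z y<z a< b<
      (trans (sym (agree _ (address-<-k M y a< x< j<M))) t) (trans (sym (agree _ (address-<-k M y b< y< j<M))) t′) ab
    ... | inj₂ (sy , ab) = through ex2 (symbol⇒quant z ex2 sy) x<z y<z a< b<
      (trans (sym (agree _ (address-<-k M y a< x< j<M))) t) (trans (sym (agree _ (address-<-k M y b< y< j<M))) t′) ab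

    keep : ∀ {γ} → Earlier γ → Tab M (drop (suc j) qs) (suc j) w x y → Meaning.Elim word γ (suc k) w x y
    keep agree t = k , <⇒≤ k< , +-comm 1 k ,
      inj₁ (trans (agree _ (address-<-k M y w< x< y<)) (Equivalence.from (IH w w< x< y<) t))

    from : ∀ {γ} → Earlier γ → Tab M (drop j qs) j w x y → Meaning.Elim word γ (suc k) w x y
    from agree t with drop-cases qs j
    ... | inj₁ (d , d′) rewrite d = keep agree (subst (λ r → Tab M r (suc j) w x y) (sym d′) t)
    ... | inj₂ (q , d) = split-cases (subst (λ r → Tab M r j w x y) d t)
      where
      split-cases : Tab M (q ∷ drop (suc j) qs) j w x y → _
      split-cases (inj₁ t) = keep agree t
      split-cases (inj₂ (x<j , y<j , a , b , a< , b< , t , t′ , e)) =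
        k , <⇒≤ k< , +-comm 1 k ,
        inj₂ (j , j<N , trans (+-comm j (suc k)) kj , (x , x<j , refl) , (y , y<j , refl) , a , a< , b , b< ,
          trans (agree _ (address-<-k M y a< x< j<M)) (Equivalence.from (IH a a< x< j<M) t) ,
          trans (agree _ (address-<-k M y b< y< j<M)) (Equivalence.from (IH b b< y< j<M) t′) ,
          quant⇒symbols {a = a} {b} q d e)

  answer⇔ : Answer ⇔ (Bipartite M × Free M qs 0)
  answer⇔ = mk⇔ to from
    where
    to : Answer → Bipartite M × Free M qs 0
    to (no-odd , no-zero) = bipartite , Free-intro (atoms φ) M qs 0 free
      where
      bipartite : Bipartite M
      bipartite (suc w) x w< x< o p with c , refl ← not-odd⇒double w (not-injective o) =
        no-odd (suc w , w< , x , x< , (c , ≤-<-trans (m≤m+n c c) (<-trans (n<1+n w) w<) , refl) ,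
                base⇐ (suc w) w< x< x< p)

      free : ∀ z {r} → drop z qs ≡ ex2 ∷ r → NoStart (atoms φ) M r z
      free z d x x<z t with refl ← drop-tail qs z d =
        no-zero (z , z<N , sym₂ , x , x<z , k , k<M , k+z , Equivalence.from (link k (suc z) k+z 0 0<M x<M z<M) t)
        where
        sym₂ : symbolAt word z sQ2 ≡ true
        sym₂ = quant⇒symbol z d
        z<N : z < N
        z<N = symbolAt-< word z sQ2 sym₂
        k : ℕ
        k = N ∸ suc z
        k+z : k + suc z ≡ N
        k+z = m∸n+n≡m z<N
        k<M : k < M
        k<M = ≤-<-trans (m∸n≤m N (suc z)) N<M
        z<M : z < M
        z<M = <-trans z<N N<M
        x<M : x < M
        x<M = <-trans x<z z<M

    from : Bipartite M × Free M qs 0 → Answer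
    from (B , F) =
      (λ (w , w< , x , x< , (h , _ , e) , b) → B w x w< x<
        (trans (cong odd e) (cong not (odd-double h))) (base⇒ w w< x< x< b)) ,
      (λ (z , z< , s , x , x< , k , _ , kz , b) →
        let z<M = <-trans z< N<M in
        Free-elim (atoms φ) M qs 0 z F (symbol⇒quant z ex2 s) x x<
          (Equivalence.to (link k (suc z) kz 0 0<M (<-trans x< z<M) z<M) b))

  true⇔ : Answer ⇔ TrueInP∞ φ
  true⇔ = mk⇔ (Equivalence.from decided ∘ Equivalence.to answer⇔) (Equivalence.from answer⇔ ∘ Equivalence.to decided)
    where
    decided : TrueInP∞ φ ⇔ (Bipartite M × Free M qs 0)
    decided = decide qs (λ _ → 0ℤ) refl

Reflects⇔ : ∀ {A : Set} {b} → Reflects A b → b ≡ true ⇔ A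
Reflects⇔ (ofʸ a) = mk⇔ (λ _ → a) (λ _ → refl)
Reflects⇔ (ofⁿ na) = mk⇔ (λ ()) (λ a → contradiction a na)

theorem14 : Σ TM λ M → ∃[ c ] ∃[ d ] ((φ : Sentence) →
                ∃[ b ] (run M (c * length (encode φ) ^ d + c) (initConfig M (encode φ)) ≡ halted b
                        × (b ≡ true ⇔ TrueInP∞ φ)))
theorem14 = answers Formulas.decides
  where
  correct : ∀ φ {β b} → Formulas.Table (encode φ) β → ∀ t →
    Reflects (Language.⟦_⟧ 24 Formulas.answerF (encode φ) β (Formulas.env (length (encode φ)) t)) b →
    b ≡ true ⇔ TrueInP∞ φ
  correct φ {β} {b} table t verdict = mk⇔ (Equivalence.to true⇔ ∘ Equivalence.to sem) (Equivalence.from sem ∘ Equivalence.from true⇔)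
    where
    open Correctness φ β table
    sem : b ≡ true ⇔ Meaning.Answer (encode φ) β
    sem = Reflects⇔ (subst (λ A → Reflects A b) (Meaning.Answer-meaning (encode φ) β t) verdict)

  answers : Formulas.Decider → _
  answers (M , c , d , ex) = M , c , d , λ φ →
    let b , halts , β , table , verdict = ex (encode φ)
    in b , halts , correct φ table (Formulas.bits (length (encode φ))) verdict
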